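{- Let $K$ be a real quadratic field with ring of integers $R$, let $\alpha\in R$ be a unit with $\alpha\neq\pm1$ and $\alpha>0$, and let $\Delta=(\Delta_n)_{n\geqslant 1}$ with $\Delta_n=N_{K/\mathbb{Q}}(\alpha^n-1)$ be the Lehmer-Pierce sequence associated to $\alpha$. (i) If $N_{K/\mathbb{Q}}(\alpha)=1$, then $\Delta_n$ has a primitive prime divisor for every $n>12$. (ii) If $N_{K/\mathbb{Q}}(\alpha)=-1$, then for every $n>24$, $\Delta_n$ fails to have a primitive prime divisor if and only if $n\equiv 2\pmod 4$.
   Context: For an integer sequence $(a_n)_{n\geqslant1}$, a prime $p$ dividing $a_n$ is called a primitive prime divisor of $a_n$ if $p$ does not divide $a_m$ for any $m<n$ with $a_m\neq0$. $N_{K/\mathbb{Q}}$ denotes the field norm. $K$ is regarded as a subfield of $\mathbb{R}$. -}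

module Defs where

open import Level using (0ℓ)
open import Algebra.Bundles using (RawRing)
open import Data.Integer using (ℤ; +_)
import Data.Integer.Divisibility as ℤ
open import Data.List using (List; []; _∷_)
open import Data.Nat as ℕ using (ℕ)
import Data.Nat.Divisibility as ℕ
open import Data.Nat.Primality using (Prime)
open import Data.Product using (∃; ∃-syntax; _×_)
open import Data.Rational as ℚ using (ℚ; 0ℚ; 1ℚ; _/_)
open import Relation.Binary.PropositionalEquality using (_≡_; _≢_)
open import Relation.Nullary using (¬_)
import Algebra.Definitions.RawSemiring as RawSemiringDefinitions

Squarefree : ℕ → Set
Squarefree d = ∀ m → (m ℕ.* m) ℕ.∣ d → m ≡ 1

-- The real quadratic fields, viewed as subfields of ℝ, are exactly the fields
-- ℚ(√d) with d > 1 a squarefree integer; distinct d give distinct fields.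
record RealQuadraticField : Set where
  field
    d          : ℕ
    1<d        : 1 ℕ.< d
    squarefree : Squarefree d

module QuadraticField (F : RealQuadraticField) where
  open RealQuadraticField F using (d)

  dℚ : ℚ
  dℚ = + d / 1

  -- ⟨ a , b ⟩ is a + b√d.  Since √d is irrational, the coordinates are unique
  -- and propositional equality is equality in the field.
  record K : Set where
    constructor ⟨_,_⟩
    field
      re : ℚ
      im : ℚ

  open K public

  K-rawRing : RawRing 0ℓ 0ℓ
  K-rawRing = record
    { Carrier = K
    ; _≈_     = _≡_
    ; _+_     = λ x y → ⟨ re x ℚ.+ re y , im x ℚ.+ im y ⟩
    ; _*_     = λ x y → ⟨ re x ℚ.* re y ℚ.+ dℚ ℚ.* (im x ℚ.* im y)
                        , re x ℚ.* im y ℚ.+ im x ℚ.* re y ⟩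
    ; -_      = λ x → ⟨ ℚ.- re x , ℚ.- im x ⟩
    ; 0#      = ⟨ 0ℚ , 0ℚ ⟩
    ; 1#      = ⟨ 1ℚ , 0ℚ ⟩
    }

  open RawRing K-rawRing public using (_+_; _*_; -_; 0#; 1#)
  open RawSemiringDefinitions (RawRing.rawSemiring K-rawRing) public using (_^_)

  infixl 6 _-_
  _-_ : K → K → K
  x - y = x + (- y)

  fromℤ : ℤ → K
  fromℤ c = ⟨ c / 1 , 0ℚ ⟩

  √d : K
  √d = ⟨ 0ℚ , 1ℚ ⟩

  -- The determinant of the ℚ-linear map y ↦ x * y in the basis (1 , √d).
  norm : K → ℚ
  norm x = re (x * 1#) ℚ.* im (x * √d) ℚ.- re (x * √d) ℚ.* im (x * 1#)

  -- The list c₀ , … , cₖ₋₁ stands for the monic polynomial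
  -- c₀ + c₁X + … + cₖ₋₁Xᵏ⁻¹ + Xᵏ.
  evalMonic : List ℤ → K → K
  evalMonic []       x = 1#
  evalMonic (c ∷ cs) x = fromℤ c + x * evalMonic cs x

  -- Membership in the ring of integers R.
  IsIntegral : K → Set
  IsIntegral x = ∃[ cs ] evalMonic cs x ≡ 0#

  IsUnit : K → Set
  IsUnit x = IsIntegral x × (∃[ y ] (IsIntegral y × x * y ≡ 1#))

  -- Positivity of the real number a + b√d, where √d > 0 is given by its
  -- Dedekind cut: the affine function t ↦ a + bt is positive at √d iff it is
  -- positive at both ends of some rational interval (r , s) containing √d.
  Positive : K → Set
  Positive x = ∃[ r ] ∃[ s ]
    ( (0ℚ ℚ.≤ r × r ℚ.* r ℚ.< dℚ)
    × (0ℚ ℚ.≤ s × dℚ ℚ.< s ℚ.* s)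
    × 0ℚ ℚ.< re x ℚ.+ im x ℚ.* r
    × 0ℚ ℚ.< re x ℚ.+ im x ℚ.* s )

  -- This determines the integers Δ n for n ≥ 1; Δ 0 is irrelevant.
  IsLehmerPierce : K → (ℕ → ℤ) → Set
  IsLehmerPierce α Δ = ∀ n → 1 ℕ.≤ n → Δ n / 1 ≡ norm (α ^ n - 1#)

-- Sequences are indexed by n ≥ 1, so the value at 0 is never consulted.
IsPrimitivePrimeDivisor : (ℕ → ℤ) → ℕ → ℕ → Set
IsPrimitivePrimeDivisor a n p =
  Prime p × (+ p) ℤ.∣ a n ×
  (∀ m → 1 ℕ.≤ m → m ℕ.< n → a m ≢ + 0 → ¬ ((+ p) ℤ.∣ a m))

HasPrimitivePrimeDivisor : (ℕ → ℤ) → ℕ → Set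
HasPrimitivePrimeDivisor a n = ∃[ p ] IsPrimitivePrimeDivisor a n p

{-# OPTIONS --safe #-}
module Submission where

-- For a unit of norm 1 and trace t ≥ 3, Δ n = - W n with W n = αⁿ + α⁻ⁿ - 2.  For a unit of
-- norm -1 and trace t the sequence W of the unit α², of trace t² + 2, gives Δ (2 k) = - W k and
-- (Δ n)² = W n for odd n.  Both parts follow once W n is known to have a primitive prime
-- divisor for n > 12.
--
-- A prime p divides W k exactly when its rank of apparition r divides k, and r < 2 p by the
-- pigeonhole principle.  Let A and B be the products of the W (n / e) over the squarefree e ∣ n
-- with an even and an odd number of prime factors, so that A / B is essentially Φₙ(α)².  If W n
-- has no primitive prime divisor, then A and B have the same p-adic valuation except when
-- n = r pⁱ with i ≥ 1, where the valuations differ by 2.  If a prime q > p divides n then q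
-- divides r < 2 p, so r = q; hence A divides p² B or p² q² B.  This contradicts the
-- lower bound 6 A > (W (φ n) + 1) B.

open import Defs
open import Data.Bool using (Bool; true; false; not)
open import Data.Bool.Properties using (not-involutive)
open import Data.Empty using (⊥; ⊥-elim)
open import Data.Fin using (toℕ; fromℕ<)
open import Data.Fin.Properties using (pigeonhole; toℕ-fromℕ<; toℕ<n)
open import Data.Integer as ℤ using (ℤ; +_)
import Data.Integer.Properties as ℤ
open import Data.Integer.Tactic.RingSolver using () renaming (solve-∀ to ℤ-identity)
open import Data.List using (List; []; _∷_; _++_; map; length)
open import Data.List.Membership.Propositional using (_∈_; find; lose)
open import Data.List.Membership.Propositional.Properties using (∈-++⁺ˡ; ∈-++⁺ʳ; ∈-++⁻; ∈-map⁺; ∈-∃++)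
open import Data.List.Properties using (map-++)
open import Data.List.Relation.Binary.Permutation.Propositional using (_↭_; ↭⇒↭ₛ)
open import Data.List.Relation.Binary.Permutation.Propositional.Properties using (shift; map⁺; All-resp-↭; ∈-resp-↭)
import Data.List.Relation.Binary.Permutation.Setoid.Properties as Permutation
open import Data.List.Relation.Unary.All as All using (All; []; _∷_)
open import Data.List.Relation.Unary.AllPairs using ([]; _∷_)
open import Data.List.Relation.Unary.Any using (here; there; any?)
open import Data.List.Relation.Unary.Unique.Propositional using (Unique)
open import Data.List.Relation.Unary.Unique.Propositional.Properties using (++⁺)
open import Data.Nat
open import Data.Nat.Coprimality as Coprimality using (Coprime; coprime-factors; coprime-divisor; GCD≡1⇒coprime)
open import Data.Nat.DivMod
open import Data.Nat.Divisibility
open import Data.Nat.GCD using (gcd; gcd[m,n]∣m; gcd[m,n]∣n; GCD; GCD-*; gcd-GCD)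
open import Data.Nat.Induction using (<-rec)
open import Data.Nat.ListAction using (product; sum)
open import Data.Nat.ListAction.Properties using (product-++; sum-++; product-↭; ∈⇒∣product)
open import Data.Nat.Primality
open import Data.Nat.Primality.Factorisation using (factorise; PrimeFactorisation; factorisationHasAllPrimeFactors)
open import Data.Nat.Properties
open import Data.Nat.Tactic.RingSolver using (solve-∀)
open import Data.Product using (Σ-syntax; ∃-syntax; _×_; _,_; proj₁; proj₂)
open import Data.Rational as ℚ using (ℚ; mkℚ; 0ℚ; 1ℚ; ↥_; ↧ₙ_) renaming (-_ to -ℚ_)
import Data.Rational.Properties as ℚ
import Data.Rational.Unnormalised as ℚᵘ using (*≡*)
import Data.Rational.Unnormalised.Properties as ℚᵘ
open import Data.Sum using (_⊎_; inj₁; inj₂; [_,_]′; reduce)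
open import Data.Unit using (tt)
open import Function.Bundles using (_⇔_; mk⇔)
open import Relation.Binary.PropositionalEquality
open import Relation.Nullary using (¬_; Dec; yes; no; contradiction)
open import Relation.Nullary.Decidable using (from-yes; from-no; ¬?; _×-dec_; dec⇒maybe; ¬¬-excluded-middle)
open import Tactic.RingSolver using () renaming (solve-∀ to ring-identity)
open import Tactic.RingSolver.Core.AlmostCommutativeRing using (AlmostCommutativeRing; fromCommutativeRing)

-- In terms of real square roots, W k = (α^(k/2) - α^(-k/2))², which is why a bad prime contributes
-- p² and not p. Treating W k as a polynomial in the natural number z keeps the arithmetic in ℕ: the
-- substitution rule W m (W k z) = W (m k) z takes the place of prime ideals of K, and the valuation
-- of W (m k) relative to W k is read off from the expansion of W m at 0.
--
-- The number 12 enters in three places. It makes φ n ≥ 6, and 6 is the first value of φ n at which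
-- 6 (φ n + 1)² ≤ W (φ n) + 1 for z = 1. For p = 2 and p = 3 the gain of exactly p² is only
-- guaranteed once 8 or 9 divides W (r pⁱ); the ranks are at most 3 and 4 respectively, and 12 = 3 ·
-- 2² = 4 · 3 is the largest n that the argument for 8 and 9 leaves open. The number 24 is 2 · 12,
-- because Δ (2 k) is - W k.

-- With z = t - 2, where t = α + α⁻¹, these are W k = α ^ k + α ⁻ᵏ - 2 and
-- S k = 1 + Σ_{1 ≤ j ≤ k} (α ^ j + α ⁻ʲ).  This form avoids subtraction.
mutual
  W : ℕ → ℕ → ℕ
  W zero    z = 0
  W (suc k) z = W k z + z * S k z

  S : ℕ → ℕ → ℕ
  S zero    z = 1
  S (suc k) z = S k z + (W k z + z * S k z + 2)

-- The Lucas sequence αᵏ + α⁻ᵏ, a Chebyshev polynomial (up to scaling) in t = z + 2.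
V : ℕ → ℕ → ℕ
V k z = W k z + 2

V-two-step : ∀ k z → V (2 + k) z + V k z ≡ (z + 2) * V (suc k) z
V-two-step k z = identity z (W k z) (S k z)
  where
  identity : ∀ z w s →
    w + z * s + z * (s + (w + z * s + 2)) + 2 + (w + 2) ≡ (z + 2) * (w + z * s + 2)
  identity = solve-∀

-- The rule V x * V y = V (x + y) + V (y - x), with the difference a = y - x as the parameter so
-- that no subtraction occurs.
V-Product : ℕ → ℕ → Set
V-Product z c = ∀ a → V (c + (c + a)) z + V a z ≡ V c z * V (c + a) z

-- The induction hypotheses are taken at the differences a + 2 for c and a + 1 for c + 1. This keeps
-- the larger index c + a + 2 fixed, so that the recurrence acts on the smaller one only.
V-product-step : ∀ z c a → V-Product z c → V-Product z (suc c) →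
  V (2 + c + (2 + c + a)) z + V a z ≡ V (2 + c) z * V (2 + c + a) z
V-product-step z c a ih₀ ih₁ = +-cancelʳ-≡ _ _ _ (begin
    V (2 + (c + (2 + (c + a)))) z + V a z + (V (2 + k) z + V (2 + a) z)
      ≡⟨ cong (λ i → V (2 + i) z + V a z + (V (2 + k) z + V (2 + a) z)) (shift₂ c (c + a)) ⟩
    V (4 + k) z + V a z + (V (2 + k) z + V (2 + a) z)
      ≡⟨ shuffle (V (4 + k) z) (V a z) (V (2 + k) z) (V (2 + a) z) ⟩
    V (4 + k) z + V (2 + k) z + (V (2 + a) z + V a z)
      ≡⟨ cong₂ _+_ (V-two-step (2 + k) z) (V-two-step a z) ⟩
    (z + 2) * V (3 + k) z + (z + 2) * V (1 + a) z
      ≡⟨ *-distribˡ-+ (z + 2) (V (3 + k) z) (V (1 + a) z) ⟨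
    (z + 2) * (V (3 + k) z + V (1 + a) z)
      ≡⟨ cong ((z + 2) *_) step₁ ⟩
    (z + 2) * (V (1 + c) z * V (2 + (c + a)) z)
      ≡⟨ *-assoc (z + 2) (V (1 + c) z) _ ⟨
    (z + 2) * V (1 + c) z * V (2 + (c + a)) z
      ≡⟨ cong (_* V (2 + (c + a)) z) (V-two-step c z) ⟨
    (V (2 + c) z + V c z) * V (2 + (c + a)) z
      ≡⟨ *-distribʳ-+ (V (2 + (c + a)) z) (V (2 + c) z) (V c z) ⟩
    V (2 + c) z * V (2 + (c + a)) z + V c z * V (2 + (c + a)) z
      ≡⟨ cong (λ e → V (2 + c) z * V (2 + (c + a)) z + e) step₀ ⟨
    V (2 + c) z * V (2 + (c + a)) z + (V (2 + k) z + V (2 + a) z) ∎)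
  where
  open ≡-Reasoning
  k = c + (c + a)

  shuffle : ∀ a b c d → a + b + (c + d) ≡ a + c + (d + b)
  shuffle = solve-∀

  shift₁ : ∀ c a → c + suc a ≡ suc (c + a)
  shift₁ = +-suc

  shift₂ : ∀ c a → c + suc (suc a) ≡ suc (suc (c + a))
  shift₂ c a = trans (+-suc c (suc a)) (cong suc (+-suc c a))

  step₀ : V (2 + k) z + V (2 + a) z ≡ V c z * V (2 + (c + a)) z
  step₀ = subst₂ (λ i j → V i z + V (2 + a) z ≡ V c z * V j z)
    (trans (cong (λ i → c + i) (shift₂ c a)) (shift₂ c (c + a))) (shift₂ c a) (ih₀ (2 + a))

  step₁ : V (3 + k) z + V (1 + a) z ≡ V (1 + c) z * V (2 + (c + a)) z
  step₁ = subst₂ (λ i j → V (1 + i) z + V (1 + a) z ≡ V (1 + c) z * V (1 + j) z)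
    (trans (cong (λ i → c + suc i) (shift₁ c a)) (shift₂ c (c + a))) (shift₁ c a)
    (ih₁ (suc a))

V-product : ∀ z c → V-Product z c
V-product z zero a = double (V a z)
  where
  double : ∀ x → x + x ≡ 2 * x
  double = solve-∀
V-product z 1 a = trans (V-two-step a z) (cong (_* V (suc a) z) (one z))
  where
  one : ∀ z → z + 2 ≡ 0 + z * 1 + 2
  one = solve-∀
V-product z (suc (suc c)) a = V-product-step z c a (V-product z c) (V-product z (suc c))

W-mono-index : ∀ {j k} z → j ≤ k → W j z ≤ W k z
W-mono-index {j} z j≤k with k , refl ← m≤n⇒∃[o]m+o≡n j≤k = go k
  where
  go : ∀ k → W j z ≤ W (j + k) z
  go zero    rewrite +-identityʳ j = ≤-refl
  go (suc k) rewrite +-suc j k = ≤-trans (go k) (m≤m+n _ _)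

-- With W k = (α^(k/2) - α^(-k/2))², the difference W (c + a) - W c is the product of the square
-- roots of W (2 c + a) and W a. Consequently a prime dividing W a makes W periodic with period a
-- modulo that prime.
W-difference : ∀ z c a → ∃[ q ] (W (c + a) z ≡ W c z + q × q * q ≡ W (c + (c + a)) z * W a z)
W-difference z c a = q , sym W+q , sym (+-cancelʳ-≡ _ _ _ (begin
    X * Y + 2 * (X + 2 + (Y + 2))            ≡⟨ expand X Y ⟩
    (X + 2) * (Y + 2) + 4                    ≡⟨ cong (_+ 4) (*-comm (X + 2) (Y + 2)) ⟩
    (Y + 2) * (X + 2) + 4                    ≡⟨ cong (_+ 4) sum-of-squares ⟨
    V 2[c+a] z + V (c + c) z + 4             ≡⟨ rearrange (V 2[c+a] z) (V (c + c) z) ⟩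
    (V 2[c+a] z + 2) + (V (c + c) z + 2)     ≡⟨ cong₂ _+_ (square (c + a)) (square c) ⟩
    V (c + a) z * V (c + a) z + V c z * V c z
      ≡⟨ cong (λ w → (w + 2) * (w + 2) + V c z * V c z) W+q ⟨
    (W c z + q + 2) * (W c z + q + 2) + V c z * V c z
      ≡⟨ complete (W c z) q ⟩
    q * q + 2 * (V c z * (W c z + q + 2))
      ≡⟨ cong (λ w → q * q + 2 * (V c z * (w + 2))) W+q ⟩
    q * q + 2 * (V c z * V (c + a) z)        ≡⟨ cong (λ e → q * q + 2 * e) (V-product z c a) ⟨
    q * q + 2 * (X + 2 + (Y + 2))            ∎))
  where
  open ≡-Reasoning
  q = W (c + a) z ∸ W c z
  X = W (c + (c + a)) z
  Y = W a z
  2[c+a] = c + a + (c + a)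

  W+q : W c z + q ≡ W (c + a) z
  W+q = m+[n∸m]≡n (W-mono-index z (m≤m+n c a))

  square : ∀ k → V (k + k) z + 2 ≡ V k z * V k z
  square k = subst (λ i → V (k + i) z + 2 ≡ V k z * V i z) (+-identityʳ k) (V-product z k 0)

  index₁ : ∀ c a → a + (a + (c + c)) ≡ c + a + (c + a)
  index₁ = solve-∀

  index₂ : ∀ c a → a + (c + c) ≡ c + (c + a)
  index₂ = solve-∀

  sum-of-squares : V 2[c+a] z + V (c + c) z ≡ (Y + 2) * (X + 2)
  sum-of-squares = subst₂ (λ i j → V i z + V (c + c) z ≡ V a z * V j z)
    (index₁ c a) (index₂ c a) (V-product z a (c + c))

  expand : ∀ x y → x * y + 2 * (x + 2 + (y + 2)) ≡ (x + 2) * (y + 2) + 4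
  expand = solve-∀

  rearrange : ∀ x y → x + y + 4 ≡ (x + 2) + (y + 2)
  rearrange = solve-∀

  complete : ∀ w q →
    (w + q + 2) * (w + q + 2) + (w + 2) * (w + 2) ≡ q * q + 2 * ((w + 2) * (w + q + 2))
  complete = solve-∀

-- The instance a = 1 of W-difference, where q = z * S k z.
W-odd : ∀ k z .{{_ : NonZero z}} → W (k + suc k) z ≡ z * (S k z * S k z)
W-odd k z = *-cancelʳ-≡ _ _ z (begin
    W (k + suc k) z * z           ≡⟨ cong₂ _*_ (cong (λ i → W (k + i) z) (+-comm 1 k)) (one z) ⟩
    W (k + (k + 1)) z * W 1 z     ≡⟨ proj₂ (proj₂ (W-difference z k 1)) ⟨
    q * q                         ≡⟨ cong (λ x → x * x) q≡zS ⟩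
    z * S k z * (z * S k z)       ≡⟨ regroup z (S k z) ⟩
    z * (S k z * S k z) * z       ∎)
  where
  open ≡-Reasoning
  q = proj₁ (W-difference z k 1)

  q≡zS : q ≡ z * S k z
  q≡zS = +-cancelˡ-≡ (W k z) _ _
    (trans (sym (proj₁ (proj₂ (W-difference z k 1)))) (cong (λ i → W i z) (+-comm k 1)))

  one : ∀ z → z ≡ 0 + z * 1
  one = solve-∀

  regroup : ∀ z s → z * s * (z * s) ≡ z * (s * s) * z
  regroup = solve-∀

W-two : ∀ z → W 2 z ≡ z * (z + 4)
W-two z = identity z
  where
  identity : ∀ z → 0 + z * 1 + z * (1 + (0 + z * 1 + 2)) ≡ z * (z + 4)
  identity = solve-∀

-- Replacing α by αᵏ turns z = α + α⁻¹ - 2 into W k z. Two consecutive indices are carried along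
-- because the recurrence has order two.
W-compose : ∀ m k z → W m (W k z) ≡ W (m * k) z
W-compose m k z = +-cancelʳ-≡ _ _ _ (proj₁ (go m))
  where
  open ≡-Reasoning
  x = W k z
  go : ∀ m → V m x ≡ V (m * k) z × V (suc m) x ≡ V (suc m * k) z
  go zero    = refl , trans (cong (_+ 2) (*-identityʳ x)) (cong (λ i → V i z) (sym (*-identityˡ k)))
  go (suc m) with ih₀ , ih₁ ← go m = ih₁ , +-cancelʳ-≡ _ _ _ (begin
    V (2 + m) x + V m x                 ≡⟨ V-two-step m x ⟩
    V k z * V (suc m) x                 ≡⟨ cong (V k z *_) ih₁ ⟩
    V k z * V (k + m * k) z             ≡⟨ V-product z k (m * k) ⟨
    V ((2 + m) * k) z + V (m * k) z     ≡⟨ cong (λ e → V ((2 + m) * k) z + e) ih₀ ⟨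
    V ((2 + m) * k) z + V m x           ∎)

-- Ranks of apparition

prime≢1 : ∀ {p} → Prime p → p ≢ 1
prime≢1 pp refl = ¬prime[1] pp

prime∣prime⇒≡ : ∀ {p q} → Prime p → Prime q → p ∣ q → p ≡ q
prime∣prime⇒≡ pp pq p∣q with prime⇒irreducible pq p∣q
... | inj₁ p≡1 = contradiction p≡1 (prime≢1 pp)
... | inj₂ p≡q = p≡q

prime∤* : ∀ {p} → Prime p → ∀ m n → p ∤ m → p ∤ n → p ∤ m * n
prime∤* pp m n p∤m p∤n p∣mn = [ p∤m , p∤n ]′ (euclidsLemma m n pp p∣mn)

∣square⇒∣ : ∀ {p} → Prime p → ∀ m → p ∣ m * m → p ∣ m
∣square⇒∣ pp m p∣mm = reduce (euclidsLemma m m pp p∣mm)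

even⊎odd : ∀ n → (∃[ k ] n ≡ k + k) ⊎ (∃[ k ] n ≡ k + suc k)
even⊎odd zero    = inj₁ (0 , refl)
even⊎odd (suc n) with even⊎odd n
... | inj₁ (k , refl) = inj₂ (k , sym (+-suc k k))
... | inj₂ (k , refl) = inj₁ (suc k , refl)

k+k≡2*k : ∀ k → k + k ≡ 2 * k
k+k≡2*k = solve-∀

prime-parity : ∀ {p} → Prime p → p ≡ 2 ⊎ (∃[ k ] p ≡ k + suc k)
prime-parity {p} pp with even⊎odd p
... | inj₂ odd        = inj₂ odd
... | inj₁ (k , p≡2k) =
  inj₁ (sym (prime∣prime⇒≡ prime[2] pp (subst (2 ∣_) (sym (trans p≡2k (k+k≡2*k k))) (m∣m*n k))))

z∣W : ∀ m z → z ∣ W m z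
z∣W zero    z = z ∣0
z∣W (suc m) z = ∣m∣n⇒∣m+n (z∣W m z) (m∣m*n (S m z))

W-∣ : ∀ {j k} z → j ∣ k → W j z ∣ W k z
W-∣ {j} z (divides m refl) = subst (W j z ∣_) (W-compose m j z) (z∣W m (W j z))

∣W-shift : ∀ {p} → Prime p → ∀ z a c → p ∣ W a z → p ∣ W (c + a) z → p ∣ W c z
∣W-shift {p} pp z a c p∣Wa p∣Wc+a with q , W≡ , qq≡ ← W-difference z c a =
  ∣m+n∣m⇒∣n (subst (p ∣_) (trans W≡ (+-comm (W c z) q)) p∣Wc+a)
            (∣square⇒∣ pp q (subst (p ∣_) (sym qq≡) (∣n⇒∣m*n (W (c + (c + a)) z) p∣Wa)))

record Rank (p z r : ℕ) : Set where
  field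
    positive : 1 ≤ r
    divides-W : p ∣ W r z
    minimal : ∀ {k} → p ∣ W k z → r ∣ k

  multiple : ∀ {k} → r ∣ k → p ∣ W k z
  multiple r∣k = ∣-trans divides-W (W-∣ z r∣k)

-- The least positive k with p ∣ W k is the rank: if p ∣ W j, periodicity gives p ∣ W (j % k), and
-- minimality leaves only j % k = 0.
rank-exists : ∀ {p} → Prime p → ∀ z k → 1 ≤ k → p ∣ W k z → ∃[ r ] Rank p z r
rank-exists {p} pp z = <-rec _ go
  where
  go : ∀ k → (∀ {j} → j < k → 1 ≤ j → p ∣ W j z → ∃[ r ] Rank p z r) →
       1 ≤ k → p ∣ W k z → ∃[ r ] Rank p z r
  go k rec 1≤k p∣Wk with anyUpTo? (λ j → (1 ≤? j) ×-dec (p ∣? W j z)) k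
  ... | yes (j , j<k , 1≤j , p∣Wj) = rec j<k 1≤j p∣Wj
  ... | no least = k , record { positive = 1≤k ; divides-W = p∣Wk ; minimal = k∣_ }
    where
    instance
      k≢0 : NonZero k
      k≢0 = >-nonZero 1≤k

    k∣_ : ∀ {j} → p ∣ W j z → k ∣ j
    k∣_ {j} p∣Wj = m%n≡0⇒n∣m j k (n≤0⇒n≡0 (≮⇒≥ λ 0<j%k →
      least (j % k , m%n<n j k , 0<j%k ,
        ∣W-shift pp z (j / k * k) (j % k) (∣-trans p∣Wk (W-∣ z (n∣m*n (j / k))))
          (subst (λ i → p ∣ W i z) (m≡m%n+[m/n]*n j k) p∣Wj))))

≡%⇒∣ : ∀ a q p .{{_ : NonZero p}} → a % p ≡ (a + q) % p → p ∣ q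
≡%⇒∣ a q p eq = ∣m+n∣m⇒∣n
  (divides (a / p + ((a + q) / p ∸ a / p)) (+-cancelˡ-≡ (a % p) _ _ (begin
    a % p + (a / p * p + q)                         ≡⟨ +-assoc (a % p) _ q ⟨
    a % p + a / p * p + q                           ≡⟨ cong (_+ q) (m≡m%n+[m/n]*n a p) ⟨
    a + q                                           ≡⟨ m≡m%n+[m/n]*n (a + q) p ⟩
    (a + q) % p + (a + q) / p * p                   ≡⟨ cong₂ (λ x y → x + y * p) (sym eq)
                                                        (sym (m+[n∸m]≡n (/-monoˡ-≤ p (m≤m+n a q)))) ⟩
    a % p + (a / p + ((a + q) / p ∸ a / p)) * p     ∎)))
  (n∣m*n (a / p))
  where open ≡-Reasoning

-- Two of the p + 1 values W 0 z, …, W p z agree modulo p.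
rank<2p : ∀ {p z r} → Prime p → Rank p z r → r < 2 * p
rank<2p {p} {z} {r} pp rank
  with i , j , i<j , fi≡fj ← pigeonhole (n<1+n p) (λ i → fromℕ< (m%n<n (W (toℕ i) z) p {{prime⇒nonZero pp}}))
  with a , si+a≡j ← m≤n⇒∃[o]m+o≡n i<j = bound
  where
  instance
    p≢0 : NonZero p
    p≢0 = prime⇒nonZero pp

  i′ = toℕ i
  open ≤-Reasoning

  j≡i+1+a : toℕ j ≡ i′ + suc a
  j≡i+1+a = trans (sym si+a≡j) (sym (+-suc i′ a))

  j≤p : i′ + suc a ≤ p
  j≤p = subst (_≤ p) j≡i+1+a (s≤s⁻¹ (toℕ<n j))

  values : W i′ z % p ≡ W (i′ + suc a) z % p
  values = trans (trans (sym (toℕ-fromℕ< _)) (trans (cong toℕ fi≡fj) (toℕ-fromℕ< _)))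
    (cong (λ k → W k z % p) j≡i+1+a)

  bound : r < 2 * p
  -- The square of the difference of the two values is W (i + j) * W (j - i), so p divides one
  -- factor; both indices are below 2 p because i < j ≤ p.
  bound with q , W≡ , qq≡ ← W-difference z i′ (suc a)
    with p∣q ← ≡%⇒∣ (W i′ z) q p (trans values (cong (_% p) W≡))
    with euclidsLemma (W (i′ + (i′ + suc a)) z) (W (suc a) z) pp (subst (p ∣_) qq≡ (∣m⇒∣m*n q p∣q))
  ... | inj₁ p∣W = begin-strict
    r                       ≤⟨ ∣⇒≤ {{>-nonZero (≤-trans (s≤s z≤n) (≤-trans (m≤n+m (suc a) i′) (m≤n+m _ i′)))}} (Rank.minimal rank p∣W) ⟩
    i′ + (i′ + suc a)       <⟨ +-mono-<-≤ (≤-trans (m<m+n i′ (s≤s z≤n)) j≤p) j≤p ⟩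
    p + p                   ≡⟨ k+k≡2*k p ⟩
    2 * p                   ∎
  ... | inj₂ p∣W = begin-strict
    r                       ≤⟨ ∣⇒≤ (Rank.minimal rank p∣W) ⟩
    suc a                   ≤⟨ ≤-trans (m≤n+m (suc a) i′) j≤p ⟩
    p                       <⟨ m<m+n p (>-nonZero⁻¹ p) ⟩
    p + p                   ≡⟨ k+k≡2*k p ⟩
    2 * p                   ∎

-- Valuations

∑□ : ℕ → ℕ
∑□ zero    = 0
∑□ (suc k) = ∑□ k + suc k * suc k

6∑□ : ∀ k → 6 * ∑□ k ≡ k * suc k * (k + suc k)
6∑□ zero    = refl
6∑□ (suc k) = trans (*-distribˡ-+ 6 (∑□ k) (suc k * suc k))
  (trans (cong (_+ 6 * (suc k * suc k)) (6∑□ k)) (identity k))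
  where
  identity : ∀ k → k * (1 + k) * (k + (1 + k)) + 6 * ((1 + k) * (1 + k))
                 ≡ (1 + k) * (2 + k) * (1 + k + (2 + k))
  identity = solve-∀

-- Expansion modulo z², obtained by summing W j = j² z + O(z²). The linear term of S matters when 2
-- k + 1 = p, where the constant term is itself divisible by p.
W-S-expansion : ∀ k z → (∃[ f ] W k z ≡ k * k * z + z * z * f)
                      × (∃[ e ] S k z ≡ k + suc k + z * ∑□ k + z * z * e)
W-S-expansion zero    z = (0 , sym (*-zeroʳ (z * z)))
                        , (0 , sym (cong₂ (λ a b → 1 + a + b) (*-zeroʳ z) (*-zeroʳ (z * z))))
W-S-expansion (suc k) z with (f , W≡) , (e , S≡) ← W-S-expansion k z
  rewrite W≡ | S≡ = (f + c + z * e , identity₁ k z f c e) , (f + c + z * e + e , identity₂ k z f c e)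
  where
  c = ∑□ k
  identity₁ : ∀ k z f c e → k * k * z + z * z * f + z * (k + (1 + k) + z * c + z * z * e)
                          ≡ (1 + k) * (1 + k) * z + z * z * (f + c + z * e)
  identity₁ = solve-∀
  identity₂ : ∀ k z f c e →
    k + (1 + k) + z * c + z * z * e
      + (k * k * z + z * z * f + z * (k + (1 + k) + z * c + z * z * e) + 2)
    ≡ 1 + k + (2 + k) + z * (c + (1 + k) * (1 + k)) + z * z * (f + c + z * e + e)
  identity₂ = solve-∀

p∤1+p* : ∀ {p} → Prime p → ∀ m → p ∤ 1 + p * m
p∤1+p* {p} pp m p∣ = prime≢1 pp (∣1⇒≡1 (∣m+n∣m⇒∣n (subst (p ∣_) (+-comm 1 (p * m)) p∣) (m∣m*n m)))

prime∣4⇒≡2 : ∀ {p} → Prime p → p ∣ 4 → p ≡ 2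
prime∣4⇒≡2 pp p∣4 = prime∣prime⇒≡ pp prime[2] (∣square⇒∣ pp 2 p∣4)

-- W q z / z is prime to p: it is ≡ q² modulo z.
W-prime : ∀ {p q} z .{{_ : NonZero z}} → Prime p → Prime q → p ≢ q → p ∣ z →
          ∃[ w ] (p ∤ w × W q z ≡ z * w)
W-prime {p} z pp pq p≢q p∣z with prime-parity pq
... | inj₁ refl =
  z + 4 , (λ p∣ → p≢q (prime∣4⇒≡2 pp (∣m+n∣m⇒∣n p∣ p∣z))) , W-two z
... | inj₂ (k , refl) = S k z * S k z , (λ p∣ → p∤S (∣square⇒∣ pp (S k z) p∣)) , W-odd k z
  where
  p∤S : p ∤ S k z
  p∤S p∣S with _ , (e , S≡) ← W-S-expansion k z =
    p≢q (prime∣prime⇒≡ pp pq (∣m+n∣m⇒∣n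
      (subst (p ∣_) (trans S≡ (identity (k + suc k) z (∑□ k) e)) p∣S) (∣m⇒∣m*n _ p∣z)))
    where
    identity : ∀ q z c e → q + z * c + z * z * e ≡ z * (c + z * e) + q
    identity = solve-∀

2∤odd : ∀ k → 2 ∤ k + suc k
2∤odd k 2∣ = prime≢1 prime[2] (∣1⇒≡1 (∣m+n∣m⇒∣n (subst (2 ∣_) (identity k) 2∣) (m∣m*n k)))
  where
  identity : ∀ k → k + (1 + k) ≡ 2 * k + 1
  identity = solve-∀

prime∤6 : ∀ {p} → Prime p → p ≢ 2 → p ≢ 3 → p ∤ 6
prime∤6 pp p≢2 p≢3 p∣6 with euclidsLemma 2 3 pp p∣6
... | inj₁ p∣2 = p≢2 (prime∣prime⇒≡ pp prime[2] p∣2)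
... | inj₂ p∣3 = p≢3 (prime∣prime⇒≡ pp (from-yes (prime? 3)) p∣3)

-- For p > 3 the relation 6 `∑□` k = k (k + 1) p makes the linear coefficient divisible by p, so
-- that every term after the constant term p is divisible by p². For p = 3 one has S 1 z = 3 + z,
-- and 9 ∣ z is needed for the same conclusion.
S-self : ∀ {p} k z → p ≡ k + suc k → Prime p → p ∣ z → (p ≡ 3 → 9 ∣ z) →
         ∃[ x ] S k z ≡ p * (1 + p * x)
S-self {p} k z p≡ pp p∣z 9∣ with p ≟ 2
S-self {p} k z p≡ pp p∣z 9∣ | yes refl = contradiction (subst (2 ∣_) p≡ ∣-refl) (2∤odd k)
S-self {p} k z p≡ pp p∣z 9∣ | no p≢2 with p ≟ 3
S-self {p} 1 z p≡ pp p∣z 9∣ | no p≢2 | yes refl with divides y refl ← 9∣ refl = y , three y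
  where
  three : ∀ y → 1 + (0 + y * 9 * 1 + 2) ≡ 3 * (1 + 3 * y)
  three = solve-∀
S-self {p} (suc (suc k)) z p≡ pp p∣z 9∣ | no p≢2 | yes refl
  with () ← trans p≡ (cong (λ i → 2 + i) (trans (+-suc k (suc (suc k))) (cong suc (+-suc k (suc k)))))
S-self {p} k z p≡ pp p∣z 9∣ | no p≢2 | no p≢3
  with euclidsLemma 6 (∑□ k) pp (subst (p ∣_) (sym (6∑□ k)) (∣n⇒∣m*n (k * suc k) (subst (p ∣_) p≡ ∣-refl)))
... | inj₁ p∣6 = contradiction p∣6 (prime∤6 pp p≢2 p≢3)
... | inj₂ (divides c c≡) with divides y z≡ ← p∣z with _ , (e , S≡) ← W-S-expansion k z =
  y * c + y * (y * e) , (begin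
    S k z                                           ≡⟨ S≡ ⟩
    k + suc k + z * ∑□ k + z * z * e                ≡⟨ cong₂ (λ a b → a + z * b + z * z * e) (sym p≡) c≡ ⟩
    p + z * (c * p) + z * z * e                     ≡⟨ cong (λ z → p + z * (c * p) + z * z * e) z≡ ⟩
    p + y * p * (c * p) + y * p * (y * p) * e       ≡⟨ factor p y c e ⟩
    p * (1 + p * (y * c + y * (y * e)))             ∎)
  where
  open ≡-Reasoning
  factor : ∀ p y c e → p + y * p * (c * p) + y * p * (y * p) * e ≡ p * (1 + p * (y * c + y * (y * e)))
  factor = solve-∀

-- W p z has exactly two more factors p than z.
W-self : ∀ p z .{{_ : NonZero z}} → Prime p → p ∣ z → (p ≡ 2 → 8 ∣ z) → (p ≡ 3 → 9 ∣ z) →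
         ∃[ w ] (p ∤ w × W p z ≡ p * p * (z * w))
W-self p z pp p∣z 8∣ 9∣ with prime-parity pp
-- With z = 8 y the second factor of W 2 z is z + 4 = 4 (1 + 2 y). If only 4 ∣ z were known, z + 4
-- could contain a higher power of 2.
... | inj₁ refl with divides y refl ← 8∣ refl = 1 + 2 * y , p∤1+p* pp y , trans (W-two z) (identity y)
  where
  identity : ∀ y → y * 8 * (y * 8 + 4) ≡ 4 * (y * 8 * (1 + 2 * y))
  identity = solve-∀
W-self p z pp p∣z 8∣ 9∣ | inj₂ (k , p≡) with x , S≡ ← S-self k z p≡ pp p∣z 9∣ =
  (1 + p * x) * (1 + p * x) , prime∤* pp _ _ (p∤1+p* pp x) (p∤1+p* pp x) ,
  trans (trans (cong (λ i → W i z) p≡) (W-odd k z)) (trans (cong (λ s → z * (s * s)) S≡) (identity z p x))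
  where
  identity : ∀ z p x → z * (p * (1 + p * x) * (p * (1 + p * x))) ≡ p * p * (z * ((1 + p * x) * (1 + p * x)))
  identity = solve-∀

W-three : ∀ z → W 3 z ≡ z * ((3 + z) * (3 + z))
W-three z = identity z
  where
  identity : ∀ z → 0 + z * 1 + z * (1 + (0 + z * 1 + 2))
                     + z * (1 + (0 + z * 1 + 2) + (0 + z * 1 + z * (1 + (0 + z * 1 + 2)) + 2))
                 ≡ z * ((3 + z) * (3 + z))
  identity = solve-∀

W-four : ∀ z → W 4 z ≡ z * (z + 4) * ((z + 2) * (z + 2))
W-four z = begin
  W 4 z                                   ≡⟨ W-compose 2 2 z ⟨
  W 2 (W 2 z)                             ≡⟨ W-two (W 2 z) ⟩
  W 2 z * (W 2 z + 4)                     ≡⟨ cong (λ x → x * (x + 4)) (W-two z) ⟩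
  z * (z + 4) * (z * (z + 4) + 4)         ≡⟨ identity z ⟩
  z * (z + 4) * ((z + 2) * (z + 2))       ∎
  where
  open ≡-Reasoning
  identity : ∀ z → z * (z + 4) * (z * (z + 4) + 4) ≡ z * (z + 4) * ((z + 2) * (z + 2))
  identity = solve-∀

-- Supplies the hypothesis 8 ∣ z of `W-self` at indices that are four times a multiple of the rank
-- of 2.
8∣W[4k] : ∀ k z → 2 ∣ W k z → 8 ∣ W (4 * k) z
8∣W[4k] k z (divides y W≡) = divides (2 * y * (y + 2) * ((y + 1) * (y + 1))) (begin
  W (4 * k) z                             ≡⟨ W-compose 4 k z ⟨
  W 4 (W k z)                             ≡⟨ trans (cong (W 4) W≡) (W-four (y * 2)) ⟩
  y * 2 * (y * 2 + 4) * ((y * 2 + 2) * (y * 2 + 2))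
                                          ≡⟨ identity y ⟩
  2 * y * (y + 2) * ((y + 1) * (y + 1)) * 8 ∎)
  where
  open ≡-Reasoning
  identity : ∀ y → y * 2 * (y * 2 + 4) * ((y * 2 + 2) * (y * 2 + 2))
                 ≡ 2 * y * (y + 2) * ((y + 1) * (y + 1)) * 8
  identity = solve-∀

9∣W[3k] : ∀ k z → 3 ∣ W k z → 9 ∣ W (3 * k) z
9∣W[3k] k z (divides y W≡) = divides (3 * y * ((1 + y) * (1 + y))) (begin
  W (3 * k) z                             ≡⟨ W-compose 3 k z ⟨
  W 3 (W k z)                             ≡⟨ trans (cong (W 3) W≡) (W-three (y * 3)) ⟩
  y * 3 * ((3 + y * 3) * (3 + y * 3))     ≡⟨ identity y ⟩
  3 * y * ((1 + y) * (1 + y)) * 9         ∎)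
  where
  open ≡-Reasoning
  identity : ∀ y → y * 3 * ((3 + y * 3) * (3 + y * 3)) ≡ 3 * y * ((1 + y) * (1 + y)) * 9
  identity = solve-∀

-- The numbers z, z + 2 and z + 4 represent all residue classes modulo 3. The rank of 3 is therefore
-- at most 4; the pigeonhole bound alone would admit 5, and with it the case n = 5 · 3 > 12 without
-- the factor 9.
3∣W4 : ∀ z → 3 ∣ W 4 z
3∣W4 z = subst (3 ∣_) (sym (W-four z)) (residue (z % 3) (m%n<n z 3) (m≡m%n+[m/n]*n z 3))
  where
  residue : ∀ i → i < 3 → z ≡ i + z / 3 * 3 → 3 ∣ z * (z + 4) * ((z + 2) * (z + 2))
  residue 0 _ z≡ = ∣m⇒∣m*n _ (∣m⇒∣m*n (z + 4) (divides (z / 3) z≡))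
  residue 1 _ z≡ = ∣n⇒∣m*n (z * (z + 4)) (∣m⇒∣m*n (z + 2)
    (divides (1 + z / 3) (trans (cong (_+ 2) z≡) (+-comm (1 + z / 3 * 3) 2))))
  residue 2 _ z≡ = ∣m⇒∣m*n _ (∣n⇒∣m*n z
    (divides (2 + z / 3) (trans (cong (_+ 4) z≡) (+-comm (2 + z / 3 * 3) 4))))
  residue (suc (suc (suc _))) (s≤s (s≤s (s≤s ()))) _

-- The quotient A / B

-- For distinct primes qs, the numbers s * ∏ T with T ⊆ qs, split by the parity of
-- the number of omitted primes: Φ(s * ∏ qs) is the quotient of the two products.
divisors : Bool → ℕ → List ℕ → List ℕ
divisors true  s []       = s ∷ []
divisors false s []       = []
divisors b     s (q ∷ qs) = divisors b (s * q) qs ++ divisors (not b) s qs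

∏W : ℕ → List ℕ → ℕ
∏W z ks = product (map (λ k → W k z) ks)

∏W-∷ : ∀ z b s q qs →
  ∏W z (divisors b s (q ∷ qs)) ≡ ∏W z (divisors b (s * q) qs) * ∏W z (divisors (not b) s qs)
∏W-∷ z b s q qs = trans (cong (λ ks → product (map (λ k → W k z) ks)) (unfold b))
  (trans (cong product (map-++ _ (divisors b (s * q) qs) (divisors (not b) s qs)))
         (product-++ (map _ (divisors b (s * q) qs)) (map _ (divisors (not b) s qs))))
  where
  unfold : ∀ b → divisors b s (q ∷ qs) ≡ divisors b (s * q) qs ++ divisors (not b) s qs
  unfold true  = refl
  unfold false = refl

module Valuation {p : ℕ} (pp : Prime p) where

  infix 4 _≈_

  -- a and b have the same p-adic valuation.
  record _≈_ (a b : ℕ) : Set where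
    constructor balance
    field
      u v : ℕ
      p∤u : p ∤ u
      p∤v : p ∤ v
      au≡bv : a * u ≡ b * v

  p∤1 : p ∤ 1
  p∤1 p∣1 = prime≢1 pp (∣1⇒≡1 p∣1)

  ≈-reflexive : ∀ {a b} → a ≡ b → a ≈ b
  ≈-reflexive refl = balance 1 1 p∤1 p∤1 refl

  ≈-sym : ∀ {a b} → a ≈ b → b ≈ a
  ≈-sym (balance u v p∤u p∤v eq) = balance v u p∤v p∤u (sym eq)

  ≈-trans : ∀ {a b c} → a ≈ b → b ≈ c → a ≈ c
  ≈-trans {a} {b} {c} (balance u v p∤u p∤v eq) (balance u′ v′ p∤u′ p∤v′ eq′) =
    balance (u * u′) (v′ * v) (prime∤* pp u u′ p∤u p∤u′) (prime∤* pp v′ v p∤v′ p∤v) (begin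
      a * (u * u′)  ≡⟨ *-assoc a u u′ ⟨
      a * u * u′    ≡⟨ cong (_* u′) eq ⟩
      b * v * u′    ≡⟨ swap b v u′ ⟩
      b * u′ * v    ≡⟨ cong (_* v) eq′ ⟩
      c * v′ * v    ≡⟨ *-assoc c v′ v ⟩
      c * (v′ * v)  ∎)
    where
    open ≡-Reasoning
    swap : ∀ b v u → b * v * u ≡ b * u * v
    swap = solve-∀

  ≈-* : ∀ {a b c d} → a ≈ b → c ≈ d → a * c ≈ b * d
  ≈-* {a} {b} {c} {d} (balance u v p∤u p∤v eq) (balance u′ v′ p∤u′ p∤v′ eq′) =
    balance (u * u′) (v * v′) (prime∤* pp u u′ p∤u p∤u′) (prime∤* pp v v′ p∤v p∤v′)
      (trans (interchange a c u u′) (trans (cong₂ _*_ eq eq′) (sym (interchange b d v v′))))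
    where
    interchange : ∀ a c u v → a * c * (u * v) ≡ a * u * (c * v)
    interchange = solve-∀

  ∤⇒≈ : ∀ {a b} → p ∤ a → p ∤ b → a ≈ b
  ∤⇒≈ {a} {b} p∤a p∤b = balance b a p∤b p∤a (*-comm a b)

  ∤⇒≈1 : ∀ {a} → p ∤ a → a ≈ 1
  ∤⇒≈1 p∤a = ∤⇒≈ p∤a p∤1

  ≈⇒∣ : ∀ {a b} → a ≈ b → ∃[ u ] (p ∤ u × a ∣ u * b)
  ≈⇒∣ {a} {b} (balance u v _ p∤v eq) = v , p∤v , subst (a ∣_) (trans eq (*-comm b v)) (m∣m*n u)

prime∤⇒coprime : ∀ {q} c → Prime q → q ∤ c → Coprime c q
prime∤⇒coprime c pq q∤c (d∣c , d∣q) with prime⇒irreducible pq d∣q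
... | inj₁ d≡1  = d≡1
... | inj₂ refl = contradiction d∣c q∤c

prime∤product : ∀ {q} → Prime q → ∀ {qs} → All Prime qs → All (q ≢_) qs → q ∤ product qs
prime∤product pq pqs q≢qs q∣∏ =
  All.lookup q≢qs (factorisationHasAllPrimeFactors pq q∣∏ pqs) refl

module RankValuation {p : ℕ} (pp : Prime p) (z : ℕ) {r : ℕ} (rank : Rank p z r)
                     (W≢0 : ∀ k .{{_ : NonZero k}} → NonZero (W k z)) where
  open Valuation pp
  open Rank rank

  P : Bool → ℕ → List ℕ → ℕ
  P b s qs = ∏W z (divisors b s qs)

  P-∷ : ∀ b s q qs → P b s (q ∷ qs) ≡ P b (s * q) qs * P (not b) s qs
  P-∷ = ∏W-∷ z

  module _ {q} (pq : Prime q) (p≢q : p ≢ q) {n} {{n≢0 : NonZero n}} (rq∣n : r * q ∣ n) where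
    private instance
      q≢0 : NonZero q
      q≢0 = prime⇒nonZero pq

    k≢0 : ∀ k c → c * (k * q) ≡ n → NonZero k
    k≢0 k c ckq≡n = m*n≢0⇒m≢0 k {{m*n≢0⇒n≢0 c {{subst NonZero (sym ckq≡n) n≢0}}}}

    -- If p ∣ W k, then `W-prime` applies to W q at the argument W k z. If p ∤ W k, then p ∤ W (k q)
    -- as well: r q ∣ n = c k q gives r ∣ c k, and together with r ∣ k q and the coprimality of c
    -- and q this would give r ∣ k.
    W-step : ∀ k c → c * (k * q) ≡ n → q ∤ c → W (k * q) z ≈ W k z
    W-step k c ckq≡n q∤c with p ∣? W k z
    ... | yes p∣Wk with w , p∤w , W≡ ← W-prime (W k z) {{W≢0 k {{k≢0 k c ckq≡n}}}} pp pq p≢q p∣Wk =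
      balance 1 w p∤1 p∤w
        (trans (*-identityʳ (W (k * q) z)) (trans (cong (λ i → W i z) (*-comm k q)) (trans (sym (W-compose q k z)) W≡)))
    ... | no p∤Wk = ∤⇒≈ (λ p∣Wkq → p∤Wk (multiple (coprime-factors (prime∤⇒coprime c pq q∤c)
                      ( *-cancelʳ-∣ q (subst (r * q ∣_) (trans (sym ckq≡n) (sym (*-assoc c k q))) rq∣n)
                      , subst (r ∣_) (*-comm k q) (minimal p∣Wkq))))) p∤Wk

    -- Every index k is replaced by k q. The cofactor c collects the primes omitted along the way,
    -- which keeps the relation to n that the single step requires.
    P-scale : ∀ b s c qs → c * (s * q * product qs) ≡ n → q ∤ c → q ∤ product qs →
              P b (s * q) qs ≈ P b s qs
    P-scale true s c [] eq q∤c _ = ≈-* (W-step s c (trans (cong (c *_) (sym (*-identityʳ _))) eq) q∤c) (≈-reflexive refl)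
    P-scale false s c [] eq q∤c _ = ≈-reflexive refl
    P-scale b s c (q′ ∷ qs) eq q∤c q∤ = ≈-trans (≈-reflexive (P-∷ b (s * q) q′ qs)) (≈-trans
      (≈-* (subst (λ x → P b x qs ≈ P b (s * q′) qs) (swap s q′ q)
              (P-scale b (s * q′) c qs (trans (index₁ c s q q′ (product qs)) eq) q∤c
                (λ h → q∤ (∣n⇒∣m*n q′ h))))
           (P-scale (not b) s (c * q′) qs (trans (index₂ c s q q′ (product qs)) eq)
             (prime∤* pq c q′ q∤c (λ h → q∤ (∣m⇒∣m*n (product qs) h))) (λ h → q∤ (∣n⇒∣m*n q′ h))))
      (≈-reflexive (sym (P-∷ b s q′ qs))))
      where
      swap : ∀ s q q′ → s * q * q′ ≡ s * q′ * q
      swap = solve-∀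
      index₁ : ∀ c s q q′ m → c * (s * q′ * q * m) ≡ c * (s * q * (q′ * m))
      index₁ = solve-∀
      index₂ : ∀ c s q q′ m → c * q′ * (s * q * m) ≡ c * (s * q * (q′ * m))
      index₂ = solve-∀

    -- The indices fall into pairs k q and k. The two members have opposite parity and the same
    -- p-adic valuation of W, so the even and the odd product balance.
    P-balanced : ∀ b s c qs → Unique qs → All Prime qs → q ∈ qs → c * (s * product qs) ≡ n → q ∤ c →
                 P b s qs ≈ P (not b) s qs
    P-balanced b s c (.q ∷ qs) (q≢qs ∷ _) (_ ∷ pqs) (here refl) eq q∤c =
      ≈-trans (≈-reflexive (trans (P-∷ b s q qs) (*-comm (P b (s * q) qs) _))) (≈-trans
        (≈-* (≈-sym (scale (not b))) (subst (λ b′ → P b (s * q) qs ≈ P b′ s qs) (sym (not-involutive b)) (scale b)))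
        (≈-reflexive (sym (P-∷ (not b) s q qs))))
      where
      scale : ∀ b → P b (s * q) qs ≈ P b s qs
      scale b = P-scale b s c qs (trans (cong (c *_) (*-assoc s q _)) eq) q∤c (prime∤product pq pqs q≢qs)
    P-balanced b s c (q′ ∷ qs) (q′≢qs ∷ u) (pq′ ∷ pqs) (there q∈) eq q∤c =
      ≈-trans (≈-reflexive (P-∷ b s q′ qs)) (≈-trans
        (≈-* (P-balanced b (s * q′) c qs u pqs q∈ (trans (cong (c *_) (*-assoc s q′ _)) eq) q∤c)
             (P-balanced (not b) s (c * q′) qs u pqs q∈ (trans (index c s q′ (product qs)) eq)
               (prime∤* pq c q′ q∤c (λ h → All.lookup q′≢qs q∈ (sym (prime∣prime⇒≡ pq pq′ h))))))
        (≈-reflexive (sym (P-∷ (not b) s q′ qs))))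
      where
      index : ∀ c s q′ m → c * q′ * (s * m) ≡ c * (s * (q′ * m))
      index = solve-∀

  p∤P : ∀ b s qs → r ∤ s * product qs → p ∤ P b s qs
  p∤P true s [] r∤ = prime∤* pp (W s z) 1 (λ p∣ → r∤ (∣m⇒∣m*n 1 (minimal {s} p∣))) p∤1
  p∤P false s [] r∤ = p∤1
  p∤P b s (q ∷ qs) r∤ p∣ = prime∤* pp _ _
    (p∤P b (s * q) qs (λ h → r∤ (subst (r ∣_) (*-assoc s q _) h)))
    (p∤P (not b) s qs (λ h → r∤ (∣-trans h (*-monoʳ-∣ s (n∣m*n q)))))
    (subst (p ∣_) (P-∷ b s q qs) p∣)

  r∤-tail : ∀ s q m → ¬ (r * q ∣ s * (q * m)) → r ∤ s * m
  r∤-tail s q m ¬rq∣ r∣sm = ¬rq∣ (subst (r * q ∣_) (identity s q m) (*-monoˡ-∣ q r∣sm))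
    where
    identity : ∀ s q m → s * m * q ≡ s * (q * m)
    identity = solve-∀

  -- An index other than the top one omits some q of the list, hence divides s ∏ qs / q. Since r q
  -- does not divide s ∏ qs, such an index is not a multiple of r and contributes no factor p.
  P-top : ∀ s qs → (∀ {q} → q ∈ qs → ¬ (r * q ∣ s * product qs)) →
          P true s qs ≈ W (s * product qs) z × p ∤ P false s qs
  P-top s [] _ = ≈-reflexive (trans (*-identityʳ _) (cong (λ i → W i z) (sym (*-identityʳ s)))) , p∤1
  P-top s (q ∷ qs) ¬∣ with ih₁ , ih₀ ← P-top (s * q) qs
                             (λ {q′} q∈ h → ¬∣ (there q∈) (subst (r * q′ ∣_) (*-assoc s q (product qs)) h)) =
    ≈-trans (≈-reflexive (P-∷ true s q qs)) (≈-trans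
      (≈-* ih₁ (∤⇒≈1 (p∤P false s qs r∤)))
      (≈-reflexive (trans (*-identityʳ _) (cong (λ i → W i z) (*-assoc s q _))))) ,
    λ p∣ → prime∤* pp _ _ ih₀ (p∤P true s qs r∤) (subst (p ∣_) (P-∷ false s q qs) p∣)
    where
    r∤ : r ∤ s * product qs
    r∤ = r∤-tail s q _ (¬∣ (here refl))

  -- Only an index from which no prime but possibly p is omitted can be a multiple of r. These are s
  -- ∏ qs = m p and m, and they lie in opposite products.
  P-bad : ∀ s qs → Unique qs → p ∈ qs → (∀ {q} → q ∈ qs → p ≢ q → ¬ (r * q ∣ s * product qs)) →
          ∀ m → m * p ≡ s * product qs → P true s qs ≈ W (m * p) z × P false s qs ≈ W m z
  P-bad s (.p ∷ qs) (p≢qs ∷ u) (here refl) ¬∣ m mp≡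
    with top₁ , top₀ ← P-top (s * p) qs (λ {q′} q∈ h → ¬∣ (there q∈) (All.lookup p≢qs q∈) (subst (r * q′ ∣_) (*-assoc s p _) h))
       | bot₁ , bot₀ ← P-top s qs (λ q∈ h → ¬∣ (there q∈) (All.lookup p≢qs q∈) (∣-trans h (*-monoʳ-∣ s (n∣m*n p)))) =
    ≈-trans (≈-reflexive (P-∷ true s p qs)) (≈-trans (≈-* top₁ (∤⇒≈1 bot₀))
      (≈-reflexive (trans (*-identityʳ _) (cong (λ i → W i z) (trans (*-assoc s p _) (sym mp≡)))))) ,
    ≈-trans (≈-reflexive (P-∷ false s p qs)) (≈-trans (≈-* (∤⇒≈1 top₀) bot₁)
      (≈-reflexive (trans (*-identityˡ _) (cong (λ i → W i z) (sym m≡)))))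
    where
    instance
      p≢0 : NonZero p
      p≢0 = prime⇒nonZero pp
    identity : ∀ s p x → s * (p * x) ≡ s * x * p
    identity = solve-∀
    m≡ : m ≡ s * product qs
    m≡ = *-cancelʳ-≡ _ _ p (trans mp≡ (identity s p _))
  P-bad s (q ∷ qs) (q≢qs ∷ u) (there p∈) ¬∣ m mp≡
    with ih₁ , ih₀ ← P-bad (s * q) qs u p∈ (λ {q′} q∈ p≢ h → ¬∣ (there q∈) p≢ (subst (r * q′ ∣_) (*-assoc s q _) h))
                       m (trans mp≡ (sym (*-assoc s q _))) =
    ≈-trans (≈-reflexive (P-∷ true s q qs)) (≈-trans (≈-* ih₁ (∤⇒≈1 (p∤P false s qs r∤))) (≈-reflexive (*-identityʳ _))) ,
    ≈-trans (≈-reflexive (P-∷ false s q qs)) (≈-trans (≈-* ih₀ (∤⇒≈1 (p∤P true s qs r∤))) (≈-reflexive (*-identityʳ _)))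
    where
    r∤ : r ∤ s * product qs
    r∤ = r∤-tail s q _ (¬∣ (here refl) (λ p≡q → All.lookup q≢qs p∈ (sym p≡q)))

S-nonZero : ∀ k z → NonZero (S k z)
S-nonZero zero    z = _
S-nonZero (suc k) z = >-nonZero (≤-trans (>-nonZero⁻¹ _ {{S-nonZero k z}}) (m≤m+n (S k z) _))

W-nonZero : ∀ k z .{{_ : NonZero k}} .{{z≢0 : NonZero z}} → NonZero (W k z)
W-nonZero (suc k) z {{_}} {{z≢0}} = >-nonZero (≤-trans (>-nonZero⁻¹ _ {{m*n≢0 z (S k z) {{z≢0}} {{S-nonZero k z}}}}) (m≤n+m (z * S k z) (W k z)))

-- Local-to-global divisibility and the exceptional primes 2 and 3

prime-divisor : ∀ a → 2 ≤ a → ∃[ p ] (Prime p × p ∣ a)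
prime-divisor a 2≤a with factorise a {{>-nonZero (≤-trans (s≤s z≤n) 2≤a)}}
... | record { factors = [] ; isFactorisation = refl } = contradiction 2≤a λ { (s≤s ()) }
... | record { factors = p ∷ ps ; isFactorisation = a≡ ; factorsPrime = pp ∷ _ } =
  p , pp , subst (p ∣_) (sym a≡) (m∣m*n (product ps))

prime-power : ∀ p m .{{_ : NonZero m}} → (∀ {q} → Prime q → q ∣ m → q ≡ p) → ∃[ i ] m ≡ p ^ i
prime-power p m only-p = length factors , trans isFactorisation
  (power factors (All.tabulate λ {q} q∈ → only-p (All.lookup factorsPrime q∈)
    (subst (q ∣_) (sym isFactorisation) (∈⇒∣product q∈))))
  where
  open PrimeFactorisation (factorise m)
  power : ∀ qs → All (_≡ p) qs → product qs ≡ p ^ length qs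
  power [] [] = refl
  power (_ ∷ qs) (refl ∷ qs≡p) = cong (p *_) (power qs qs≡p)

-- After division by gcd a b, the reduced a′ divides u for the u attached to any prime. If a′ > 1,
-- choosing a prime factor p of a′ contradicts p ∤ u.
∣-locally : ∀ a b .{{_ : NonZero a}} → (∀ {p} → Prime p → ∃[ u ] (p ∤ u × a ∣ u * b)) → a ∣ b
∣-locally a b local with gcd a b in g≡ | gcd[m,n]∣m a b | gcd[m,n]∣n a b
... | zero    | 0∣a | _ = contradiction (0∣⇒≡0 0∣a) (≢-nonZero⁻¹ a)
... | g@(suc _) | divides a′ a≡ | divides b′ b≡ with 2 ≤? a′
...   | no a′≱2 = subst (_∣ b) (sym (trans a≡ (trans (cong (_* g) a′≡1) (*-identityˡ g)))) (divides b′ b≡)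
  where
  a′≡1 : a′ ≡ 1
  a′≡1 = ≤-antisym (s≤s⁻¹ (≰⇒> a′≱2)) (>-nonZero⁻¹ a′ {{m*n≢0⇒m≢0 a′ {g} {{subst NonZero a≡ (≢-nonZero (≢-nonZero⁻¹ a))}}}})
...   | yes 2≤a′ with p , pp , p∣a′ ← prime-divisor a′ 2≤a′ with u , p∤u , a∣ub ← local pp =
  contradiction (∣-trans p∣a′ (coprime-divisor coprime a′∣b′u)) p∤u
  where
  coprime : Coprime a′ b′
  coprime = GCD≡1⇒coprime (GCD-* {c = g} (subst₂ (λ x y → GCD x y (1 * g)) a≡ b≡
    (subst (GCD a b) (trans g≡ (sym (*-identityˡ g))) (gcd-GCD a b))))
  a′∣b′u : a′ ∣ b′ * u
  a′∣b′u = *-cancelʳ-∣ g (subst₂ _∣_ a≡ (trans (cong (u *_) b≡) (identity u b′ g)) a∣ub)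
    where
    identity : ∀ u b g → u * (b * g) ≡ b * u * g
    identity = solve-∀

∣∏W⇒∣W : ∀ {p} → Prime p → ∀ z b s qs → p ∣ ∏W z (divisors b s qs) → p ∣ W (s * product qs) z
∣∏W⇒∣W {p} pp z true s [] p∣ = subst (p ∣_)
  (trans (*-identityʳ (W s z)) (cong (λ i → W i z) (sym (*-identityʳ s)))) p∣
∣∏W⇒∣W pp z false s [] p∣ = contradiction (∣1⇒≡1 p∣) (prime≢1 pp)
∣∏W⇒∣W {p} pp z b s (q ∷ qs) p∣
  with euclidsLemma (∏W z (divisors b (s * q) qs)) _ pp (subst (p ∣_) (∏W-∷ z b s q qs) p∣)
... | inj₁ p∣₁ = subst (λ i → p ∣ W i z) (*-assoc s q (product qs)) (∣∏W⇒∣W pp z b (s * q) qs p∣₁)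
... | inj₂ p∣₂ = ∣-trans (∣∏W⇒∣W pp z (not b) s qs p∣₂) (W-∣ z (*-monoʳ-∣ s (n∣m*n q)))

-- Since r ≤ 3, the exponents i = 0 and i = 1 give r * 2 ^ suc i ≤ 12.
four-divides : ∀ r i → r < 4 → 12 < r * 2 ^ suc i → ∃[ k ] r * 2 ^ i ≡ 4 * (r * 2 ^ k)
four-divides r 0 r<4 12<n = contradiction (<-≤-trans 12<n (*-monoˡ-≤ 2 (s≤s⁻¹ r<4))) (from-no (12 <? 6))
four-divides r 1 r<4 12<n = contradiction (<-≤-trans 12<n (*-monoˡ-≤ 4 (s≤s⁻¹ r<4))) (<-irrefl refl)
four-divides r (suc (suc k)) _ _ = k , identity r (2 ^ k)
  where
  identity : ∀ r x → r * (2 * (2 * x)) ≡ 4 * (r * x)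
  identity = solve-∀

-- Since r ≤ 4, the exponent i = 0 gives r * 3 ≤ 12.
three-divides : ∀ r i → r < 5 → 12 < r * 3 ^ suc i → ∃[ k ] r * 3 ^ i ≡ 3 * (r * 3 ^ k)
three-divides r 0 r<5 12<n = contradiction (<-≤-trans 12<n (*-monoˡ-≤ 3 (s≤s⁻¹ r<5))) (<-irrefl refl)
three-divides r (suc k) _ _ = k , identity r (3 ^ k)
  where
  identity : ∀ r x → r * (3 * x) ≡ 3 * (r * x)
  identity = solve-∀

8∣W-of-rank : ∀ z r i → Rank 2 z r → 12 < r * 2 ^ suc i → 8 ∣ W (r * 2 ^ i) z
8∣W-of-rank z r i rank 12<n = multiple-of-4 (four-divides r i (rank<2p prime[2] rank) 12<n)
  where
  multiple-of-4 : ∃[ k ] r * 2 ^ i ≡ 4 * (r * 2 ^ k) → 8 ∣ W (r * 2 ^ i) z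
  multiple-of-4 (k , m≡) = subst (λ j → 8 ∣ W j z) (sym m≡)
    (8∣W[4k] (r * 2 ^ k) z (Rank.multiple rank {r * 2 ^ k} (m∣m*n (2 ^ k))))

rank-of-3<5 : ∀ z r → Rank 3 z r → r < 5
rank-of-3<5 z r rank = s≤s (∣⇒≤ (Rank.minimal rank {4} (3∣W4 z)))

9∣W-of-rank : ∀ z r i → Rank 3 z r → 12 < r * 3 ^ suc i → 9 ∣ W (r * 3 ^ i) z
9∣W-of-rank z r i rank 12<n = multiple-of-3 (three-divides r i (rank-of-3<5 z r rank) 12<n)
  where
  multiple-of-3 : ∃[ k ] r * 3 ^ i ≡ 3 * (r * 3 ^ k) → 9 ∣ W (r * 3 ^ i) z
  multiple-of-3 (k , m≡) = subst (λ j → 9 ∣ W j z) (sym m≡)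
    (9∣W[3k] (r * 3 ^ k) z (Rank.multiple rank {r * 3 ^ k} (m∣m*n (3 ^ k))))

-- Comparison of A and B prime by prime

module NoPrimitive
  (z n : ℕ) {{z≢0 : NonZero z}} (12<n : 12 < n)
  (s : ℕ) (qs : List ℕ) (n≡ : s * product qs ≡ n)
  (unique : Unique qs) (primes : All Prime qs) (complete : ∀ {q} → Prime q → q ∣ n → q ∈ qs)
  (imprimitive : ∀ {p} → Prime p → p ∣ W n z → ∃[ m ] (1 ≤ m × m < n × p ∣ W m z))
  where

  A = ∏W z (divisors true s qs)
  B = ∏W z (divisors false s qs)

  private instance
    n≢0 : NonZero n
    n≢0 = >-nonZero (≤-trans (s≤s z≤n) 12<n)

  -- The primes p at which A / B is not a p-adic unit.
  record Bad (p : ℕ) : Set where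
    field
      isPrime : Prime p
      r i   : ℕ
      rank  : Rank p z r
      n≡rp^ : n ≡ r * p ^ suc i
      exact : ∀ {q} → q ∈ qs → p ≢ q → ¬ (r * q ∣ n)

    member : p ∈ qs
    member = complete isPrime (subst (p ∣_) (sym n≡rp^) (∣n⇒∣m*n r (m∣m*n (p ^ i))))

  -- A prime not dividing W n does not divide A, so u = A serves. A prime q ≠ p with r q ∣ n makes A
  -- and B balance. Otherwise p is the only prime factor of n / r, so n = r pʲ; here j = 0 would
  -- mean that n is the rank of p, against the assumption that no prime is primitive.
  good-or-bad : ∀ {p} → Prime p → (∃[ u ] (p ∤ u × A ∣ u * B)) ⊎ Bad p
  good-or-bad {p} pp with p ∣? W n z
  ... | no p∤Wn = inj₁ (A , (λ p∣A → p∤Wn (subst (λ i → p ∣ W i z) n≡ (∣∏W⇒∣W pp z true s qs p∣A))) , m∣m*n B)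
  ... | yes p∣Wn with r , rank ← rank-exists pp z n (>-nonZero⁻¹ n) p∣Wn
    with any? (λ q → ¬? (p ≟ q) ×-dec (r * q ∣? n)) qs
  ... | yes some with q , q∈ , p≢q , rq∣n ← find some = inj₁ (≈⇒∣ A≈B)
    where
    open Valuation pp
    open RankValuation pp z rank (λ k → W-nonZero k z)
    pq : Prime q
    pq = All.lookup primes q∈
    A≈B : A ≈ B
    A≈B = P-balanced pq p≢q rq∣n true s 1 qs unique primes q∈ (trans (*-identityˡ _) n≡)
            (λ q∣1 → prime≢1 pq (∣1⇒≡1 q∣1))
  ... | no none with divides m n≡mr ← Rank.minimal rank p∣Wn
    with prime-power p m {{m*n≢0⇒m≢0 m {{subst NonZero n≡mr n≢0}}}} only-p
    where
    only-p : ∀ {q} → Prime q → q ∣ m → q ≡ p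
    only-p {q} pq q∣m with p ≟ q
    ... | yes p≡q = sym p≡q
    ... | no  p≢q = contradiction
      (lose (complete pq (∣-trans q∣m (subst (m ∣_) (sym n≡mr) (m∣m*n r))))
        (p≢q , subst (r * q ∣_) (trans (*-comm r m) (sym n≡mr)) (*-monoʳ-∣ r q∣m))) none
  ... | zero , refl with m′ , 1≤m′ , m′<n , p∣Wm′ ← imprimitive pp p∣Wn =
    contradiction (∣⇒≤ {{>-nonZero 1≤m′}} (Rank.minimal rank p∣Wm′))
      (<⇒≱ (subst (m′ <_) (trans n≡mr (*-identityˡ r)) m′<n))
  ... | suc i , m≡ = inj₂ (record
    { isPrime = pp ; r = r ; i = i ; rank = rank
    ; n≡rp^ = trans n≡mr (trans (*-comm m r) (cong (r *_) m≡))
    ; exact = λ q∈ p≢q rq∣n → none (lose q∈ (p≢q , rq∣n)) })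

  module BadPrime {p} (bad : Bad p) where
    open Bad bad
    open Valuation isPrime
    open RankValuation isPrime z rank (λ k → W-nonZero k z)

    private
      m : ℕ
      m = r * p ^ i

      mp≡n : m * p ≡ n
      mp≡n = trans (identity r (p ^ i) p) (sym n≡rp^)
        where
        identity : ∀ r x p → r * x * p ≡ r * (p * x)
        identity = solve-∀

      m≢0 : NonZero m
      m≢0 = m*n≢0⇒m≢0 m {{subst NonZero (sym mp≡n) n≢0}}

    8∣ : p ≡ 2 → 8 ∣ W m z
    8∣ p≡2 = subst (λ p → 8 ∣ W (r * p ^ i) z) (sym p≡2) (8∣W-of-rank z r i
      (subst (λ p → Rank p z r) p≡2 rank) (subst (12 <_) (trans n≡rp^ (cong (λ p → r * p ^ suc i) p≡2)) 12<n))

    9∣ : p ≡ 3 → 9 ∣ W m z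
    9∣ p≡3 = subst (λ p → 9 ∣ W (r * p ^ i) z) (sym p≡3) (9∣W-of-rank z r i
      (subst (λ p → Rank p z r) p≡3 rank) (subst (12 <_) (trans n≡rp^ (cong (λ p → r * p ^ suc i) p≡3)) 12<n))

    W[mp]≈ : (∃[ w ] (p ∤ w × W p (W m z) ≡ p * p * (W m z * w))) → W (m * p) z ≈ p * p * W m z
    W[mp]≈ (w , p∤w , W≡) = balance 1 w p∤1 p∤w (trans (*-identityʳ _)
      (trans (cong (λ j → W j z) (*-comm m p)) (trans (sym (W-compose p m z)) (trans W≡ (sym (*-assoc (p * p) (W m z) w))))))

    A≈p²B : A ≈ W (m * p) z × B ≈ W m z → A ≈ p * p * B
    A≈p²B (A≈ , B≈) = ≈-trans A≈ (≈-trans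
      (W[mp]≈ (W-self p (W m z) {{W-nonZero m z {{m≢0}}}} isPrime (Rank.multiple rank (m∣m*n (p ^ i))) 8∣ 9∣))
      (≈-* (≈-reflexive {p * p} refl) (≈-sym B≈)))

    A∣p²B : ∃[ u ] (p ∤ u × A ∣ u * (p * p * B))
    A∣p²B = ≈⇒∣ (A≈p²B (P-bad s qs unique member
      (λ {q} q∈ p≢q h → exact q∈ p≢q (subst (r * q ∣_) n≡ h)) m (trans mp≡n (sym n≡))))

-- Size estimates

W-mono : ∀ k {y z} → y ≤ z → W k y ≤ W k z
S-mono : ∀ k {y z} → y ≤ z → S k y ≤ S k z
W-mono zero    y≤z = z≤n
W-mono (suc k) y≤z = +-mono-≤ (W-mono k y≤z) (*-mono-≤ y≤z (S-mono k y≤z))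
S-mono zero    y≤z = s≤s z≤n
S-mono (suc k) y≤z = +-mono-≤ (S-mono k y≤z) (+-monoˡ-≤ 2 (W-mono (suc k) y≤z))

module _ (z : ℕ) {{z≢0 : NonZero z}} where

  private
    1≤z : 1 ≤ z
    1≤z = >-nonZero⁻¹ z

    w : ℕ → ℕ
    w k = W k z

  -- Because t = z + 2 ≥ 3, the quantity W + 1 at least doubles from one index to the next, which is
  -- enough to outgrow the quadratic bounds below.
  2W+2≤W : ∀ k → 2 * w (suc k) + 2 ≤ w (2 + k)
  2W+2≤W k = +-cancelʳ-≤ (w k + 4) _ _ (begin
    2 * w (suc k) + 2 + (w k + 4)           ≤⟨ +-monoʳ-≤ (2 * w (suc k) + 2) (+-monoˡ-≤ 4 (W-mono-index z (n≤1+n k))) ⟩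
    2 * w (suc k) + 2 + (w (suc k) + 4)     ≡⟨ identity₁ (w (suc k)) ⟩
    3 * (w (suc k) + 2)                     ≤⟨ *-monoˡ-≤ (w (suc k) + 2) (+-monoˡ-≤ 2 1≤z) ⟩
    (z + 2) * V (suc k) z                   ≡⟨ V-two-step k z ⟨
    w (2 + k) + 2 + (w k + 2)               ≡⟨ identity₂ (w (2 + k)) (w k) ⟩
    w (2 + k) + (w k + 4)                   ∎)
    where
    open ≤-Reasoning
    identity₁ : ∀ w → 2 * w + 2 + (w + 4) ≡ 3 * (w + 2)
    identity₁ = solve-∀
    identity₂ : ∀ a b → a + 2 + (b + 2) ≡ a + (b + 4)
    identity₂ = solve-∀

  module _ (c a : ℕ) where
    private
      W₊ = w (c + (c + a))

      product-formula : (w c + 2) * (w (c + a) + 2) ≡ W₊ + 2 + (w a + 2)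
      product-formula = sym (V-product z c a)

    V-submultiplicative′ : V (c + (c + a)) z ≤ V c z * V (c + a) z
    V-submultiplicative′ = subst (W₊ + 2 ≤_) (V-product z c a) (m≤m+n (W₊ + 2) (w a + 2))

    W+1-supermultiplicative′ : (w c + 1) * (w (c + a) + 1) ≤ W₊ + 1
    W+1-supermultiplicative′ = +-cancelʳ-≤ (w c + w (c + a) + 3) _ _ (begin
      (w c + 1) * (w (c + a) + 1) + (w c + w (c + a) + 3)  ≡⟨ identity₁ (w c) (w (c + a)) ⟩
      (w c + 2) * (w (c + a) + 2)                          ≡⟨ product-formula ⟩
      W₊ + 2 + (w a + 2)                                   ≡⟨ identity₂ W₊ (w a) ⟩
      W₊ + 1 + (w a + 3)
        ≤⟨ +-monoʳ-≤ (W₊ + 1) (+-monoˡ-≤ 3 (≤-trans (W-mono-index z (m≤n+m a c)) (m≤n+m _ (w c)))) ⟩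
      W₊ + 1 + (w c + w (c + a) + 3)                       ∎)
      where
      open ≤-Reasoning
      identity₁ : ∀ x y → (x + 1) * (y + 1) + (x + y + 3) ≡ (x + 2) * (y + 2)
      identity₁ = solve-∀
      identity₂ : ∀ x y → x + 2 + (y + 2) ≡ x + 1 + (y + 3)
      identity₂ = solve-∀

  -- Integers standing in for the real power αˣ: W x + 1 ≤ αˣ < V x. The upper substitute is
  -- submultiplicative and the lower one supermultiplicative, so both turn products over indices
  -- into sums of indices.
  V-submultiplicative : ∀ x y → V (x + y) z ≤ V x z * V y z
  V-submultiplicative x y with ≤-total x y
  ... | inj₁ x≤y with a , refl ← m≤n⇒∃[o]m+o≡n x≤y = V-submultiplicative′ x a
  ... | inj₂ y≤x with a , refl ← m≤n⇒∃[o]m+o≡n y≤x =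
    subst₂ _≤_ (cong (λ k → V k z) (+-comm y (y + a))) (*-comm (V y z) _) (V-submultiplicative′ y a)

  W+1-supermultiplicative : ∀ x y → (w x + 1) * (w y + 1) ≤ w (x + y) + 1
  W+1-supermultiplicative x y with ≤-total x y
  ... | inj₁ x≤y with a , refl ← m≤n⇒∃[o]m+o≡n x≤y = W+1-supermultiplicative′ x a
  ... | inj₂ y≤x with a , refl ← m≤n⇒∃[o]m+o≡n y≤x =
    subst₂ _≤_ (*-comm (w y + 1) _) (cong (λ k → w k + 1) (+-comm y (y + a))) (W+1-supermultiplicative′ y a)

  ∏V : List ℕ → ℕ
  ∏V ks = product (map (λ k → V k z) ks)

  -- The list has to be nonempty, since V 0 = 2 exceeds the empty product.
  V-sum≤∏V : ∀ k ks → V (sum (k ∷ ks)) z ≤ ∏V (k ∷ ks)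
  V-sum≤∏V k [] = ≤-reflexive (trans (cong (λ i → V i z) (+-identityʳ k)) (sym (*-identityʳ (V k z))))
  V-sum≤∏V k (l ∷ ks) = ≤-trans (V-submultiplicative k (sum (l ∷ ks))) (*-monoʳ-≤ (V k z) (V-sum≤∏V l ks))

  ∏W≤W-sum+1 : ∀ ks → ∏W z ks ≤ w (sum ks) + 1
  ∏W≤W-sum+1 [] = ≤-refl
  ∏W≤W-sum+1 (k ∷ ks) = ≤-trans (*-mono-≤ (m≤m+n (w k) 1) (∏W≤W-sum+1 ks)) (W+1-supermultiplicative k (sum ks))

  -- Here 6 + j stands for φ n, and j + 7 = φ n + 1 bounds a prime factor of n. At index 5 with z =
  -- 1 the inequality would read 216 ≤ 122.
  6[j+7]²≤W+1 : ∀ j → 6 * ((j + 7) * (j + 7)) ≤ w (6 + j) + 1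
  6[j+7]²≤W+1 zero = ≤-trans (from-yes (6 * (7 * 7) ≤? W 6 1 + 1)) (+-monoˡ-≤ 1 (W-mono 6 1≤z))
  6[j+7]²≤W+1 (suc j) = begin
    6 * ((1 + j + 7) * (1 + j + 7))                                          ≤⟨ m≤m+n _ _ ⟩
    6 * ((1 + j + 7) * (1 + j + 7)) + (6 * (j * j) + 72 * j + 204)           ≡⟨ identity j ⟩
    2 * (6 * ((j + 7) * (j + 7)))                                            ≤⟨ *-monoʳ-≤ 2 (6[j+7]²≤W+1 j) ⟩
    2 * (w (6 + j) + 1)                                                      ≡⟨ *-distribˡ-+ 2 (w (6 + j)) 1 ⟩
    2 * w (6 + j) + 2                                                        ≤⟨ 2W+2≤W (5 + j) ⟩
    w (7 + j)                                                                ≤⟨ m≤m+n (w (7 + j)) 1 ⟩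
    w (7 + j) + 1                                                            ≡⟨ cong (λ k → w k + 1) (sym (+-suc 6 j)) ⟩
    w (6 + suc j) + 1                                                        ∎
    where
    open ≤-Reasoning
    identity : ∀ j → 6 * ((1 + j + 7) * (1 + j + 7)) + (6 * (j * j) + 72 * j + 204) ≡ 2 * (6 * ((j + 7) * (j + 7)))
    identity = solve-∀

  -- Here 8 + j stands for φ n, and 24 (φ n)² is 6 (2 φ n)², where 2 φ n bounds the product p q. At
  -- index 7 with z = 1 it would read 1176 ≤ 842.
  24[j+8]²≤W+1 : ∀ j → 24 * ((j + 8) * (j + 8)) ≤ w (8 + j) + 1
  24[j+8]²≤W+1 zero = ≤-trans (from-yes (24 * (8 * 8) ≤? W 8 1 + 1)) (+-monoˡ-≤ 1 (W-mono 8 1≤z))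
  24[j+8]²≤W+1 (suc j) = begin
    24 * ((1 + j + 8) * (1 + j + 8))                                         ≤⟨ m≤m+n _ _ ⟩
    24 * ((1 + j + 8) * (1 + j + 8)) + (24 * (j * j) + 336 * j + 1128)       ≡⟨ identity j ⟩
    2 * (24 * ((j + 8) * (j + 8)))                                           ≤⟨ *-monoʳ-≤ 2 (24[j+8]²≤W+1 j) ⟩
    2 * (w (8 + j) + 1)                                                      ≡⟨ *-distribˡ-+ 2 (w (8 + j)) 1 ⟩
    2 * w (8 + j) + 2                                                        ≤⟨ 2W+2≤W (7 + j) ⟩
    w (9 + j)                                                                ≤⟨ m≤m+n (w (9 + j)) 1 ⟩
    w (9 + j) + 1                                                            ≡⟨ cong (λ k → w k + 1) (sym (+-suc 8 j)) ⟩
    w (8 + suc j) + 1                                                        ∎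
    where
    open ≤-Reasoning
    identity : ∀ j → 24 * ((1 + j + 8) * (1 + j + 8)) + (24 * (j * j) + 336 * j + 1128) ≡ 2 * (24 * ((j + 8) * (j + 8)))
    identity = solve-∀

-- Products over sets of indices

extract : ∀ x xs → Unique xs →
  All (_≢ x) xs ⊎ (∃[ ys ] (xs ↭ x ∷ ys × All (_≢ x) ys × Unique ys))
extract x xs u with any? (x ≟_) xs
... | no ∉ = inj₁ (All.tabulate λ y∈ y≡x → ∉ (lose y∈ (sym y≡x)))
... | yes ∈ with _ , x∈ , refl ← find ∈ with ys , zs , refl ← ∈-∃++ x∈
  with x≢ ∷ u′ ← Permutation.Unique-resp-↭ (setoid ℕ) (↭⇒↭ₛ (shift x ys zs)) u =
  inj₂ (ys ++ zs , shift x ys zs , All.map ≢-sym x≢ , u′)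

∏≤ : (ℕ → ℕ) → ℕ → ℕ
∏≤ f zero    = 1
∏≤ f (suc n) = ∏≤ f n * f (suc n)

∏≤-nonZero : ∀ f n → (∀ k .{{_ : NonZero k}} → NonZero (f k)) → NonZero (∏≤ f n)
∏≤-nonZero f zero    f≢0 = _
∏≤-nonZero f (suc n) f≢0 = m*n≢0 _ _ {{∏≤-nonZero f n f≢0}} {{f≢0 (suc n)}}

-- Every factor f k / g k is at least 1, so enlarging the index set to 1, ..., n can only increase
-- the product of these ratios. The inequality is cross-multiplied to avoid division.
∏-subset : ∀ (f g : ℕ → ℕ) → (∀ k → g k ≤ f k) → ∀ n ks → Unique ks → All (1 ≤_) ks → All (_≤ n) ks →
  product (map f ks) * ∏≤ g n ≤ ∏≤ f n * product (map g ks)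
∏-subset f g g≤f zero [] u pos bound = ≤-refl
∏-subset f g g≤f zero (k ∷ ks) u (1≤k ∷ _) (k≤0 ∷ _) = contradiction (≤-trans 1≤k k≤0) λ ()
∏-subset f g g≤f (suc n) ks u pos bound with extract (suc n) ks u
... | inj₁ ≢n+1 = begin
  product (map f ks) * (∏≤ g n * g (suc n))  ≡⟨ *-assoc (product (map f ks)) _ _ ⟨
  product (map f ks) * ∏≤ g n * g (suc n)    ≤⟨ *-mono-≤ (∏-subset f g g≤f n ks u pos bound′) (g≤f (suc n)) ⟩
  ∏≤ f n * product (map g ks) * f (suc n)    ≡⟨ identity (∏≤ f n) _ _ ⟩
  ∏≤ f n * f (suc n) * product (map g ks)    ∎
  where
  open ≤-Reasoning
  bound′ : All (_≤ n) ks
  bound′ = All.zipWith (λ (k≤ , k≢) → s≤s⁻¹ (≤∧≢⇒< k≤ k≢)) (bound , ≢n+1)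
  identity : ∀ a b c → a * b * c ≡ a * c * b
  identity = solve-∀
... | inj₂ (ks′ , ks↭ , ≢n+1 , u′) with _ ∷ pos′ ← All-resp-↭ ks↭ pos | _ ∷ bound₀ ← All-resp-↭ ks↭ bound = begin
  product (map f ks) * (∏≤ g n * g (suc n))              ≡⟨ cong (_* (∏≤ g n * g (suc n))) (product-↭ (map⁺ f ks↭)) ⟩
  f (suc n) * product (map f ks′) * (∏≤ g n * g (suc n)) ≡⟨ identity₁ (f (suc n)) (product (map f ks′)) (∏≤ g n) (g (suc n)) ⟩
  product (map f ks′) * ∏≤ g n * (f (suc n) * g (suc n)) ≤⟨ *-monoˡ-≤ _ (∏-subset f g g≤f n ks′ u′ pos′ bound′) ⟩
  ∏≤ f n * product (map g ks′) * (f (suc n) * g (suc n)) ≡⟨ identity₂ (∏≤ f n) (product (map g ks′)) (f (suc n)) (g (suc n)) ⟩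
  ∏≤ f n * f (suc n) * (g (suc n) * product (map g ks′)) ≡⟨ cong (∏≤ f n * f (suc n) *_) (product-↭ (map⁺ g ks↭)) ⟨
  ∏≤ f n * f (suc n) * product (map g ks)                ∎
  where
  open ≤-Reasoning
  bound′ : All (_≤ n) ks′
  bound′ = All.zipWith (λ (k≤ , k≢) → s≤s⁻¹ (≤∧≢⇒< k≤ k≢)) (bound₀ , ≢n+1)
  identity₁ : ∀ a b c d → a * b * (c * d) ≡ b * c * (a * d)
  identity₁ = solve-∀
  identity₂ : ∀ a b c d → a * b * (c * d) ≡ a * c * (d * b)
  identity₂ = solve-∀

module _ (z : ℕ) {{z≢0 : NonZero z}} where

  private
    1≤z : 1 ≤ z
    1≤z = >-nonZero⁻¹ z

    w v : ℕ → ℕ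
    w k = W k z
    v k = V k z

  -- ∏_{k ≥ 1} V k / W k < 6; the factor w n + 3 makes the induction go through.
  ∏V[W+3]≤6∏WW : ∀ n → ∏≤ v (3 + n) * (w (3 + n) + 3) ≤ 6 * ∏≤ w (3 + n) * w (3 + n)
  -- For z = 1 the values W 1, W 2, W 3 are 1, 5, 16, and each ratio (x + d) / x is largest there.
  -- With 1280 = 5 · 16 · 16 the bound is 7182 / 1280 < 7680 / 1280 = 6.
  ∏V[W+3]≤6∏WW zero = *-cancelˡ-≤ 1280 (begin
    1280 * (1 * v 1 * v 2 * v 3 * (w 3 + 3))                      ≡⟨ identity₁ (v 1) (v 2) (v 3) (w 3 + 3) ⟩
    1 * v 1 * (5 * v 2) * (16 * v 3) * (16 * (w 3 + 3))
      ≤⟨ *-mono-≤ (*-mono-≤ (*-mono-≤ (shift≤ 1 2 (W-mono 1 1≤z)) (shift≤ 5 2 (W-mono 2 1≤z)))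
                            (shift≤ 16 2 (W-mono 3 1≤z))) (shift≤ 16 3 (W-mono 3 1≤z)) ⟩
    (1 + 2) * w 1 * ((5 + 2) * w 2) * ((16 + 2) * w 3) * ((16 + 3) * w 3)
                                                                  ≡⟨ identity₂ (w 1) (w 2) (w 3) ⟩
    7182 * (w 1 * w 2 * w 3 * w 3)                                ≤⟨ *-monoˡ-≤ (w 1 * w 2 * w 3 * w 3) (m≤m+n 7182 498) ⟩
    7680 * (w 1 * w 2 * w 3 * w 3)                                ≡⟨ identity₃ (w 1) (w 2) (w 3) ⟩
    1280 * (6 * (1 * w 1 * w 2 * w 3) * w 3)                      ∎)
    where
    open ≤-Reasoning
    shift≤ : ∀ b d {x} → b ≤ x → b * (x + d) ≤ (b + d) * x
    shift≤ b d {x} b≤x = subst₂ _≤_ (sym (*-distribˡ-+ b x d))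
      (sym (*-distribʳ-+ x b d)) (+-monoʳ-≤ (b * x) (subst (_≤ d * x) (*-comm d b) (*-monoʳ-≤ d b≤x)))
    identity₁ : ∀ a b c d → 1280 * (1 * a * b * c * d) ≡ 1 * a * (5 * b) * (16 * c) * (16 * d)
    identity₁ = solve-∀
    identity₂ : ∀ a b c → (1 + 2) * a * ((5 + 2) * b) * ((16 + 2) * c) * ((16 + 3) * c) ≡ 7182 * (a * b * c * c)
    identity₂ = solve-∀
    identity₃ : ∀ a b c → 7680 * (a * b * c * c) ≡ 1280 * (6 * (1 * a * b * c) * c)
    identity₃ = solve-∀
  ∏V[W+3]≤6∏WW (suc n) = *-cancelʳ-≤ _ _ (x + 3) {{>-nonZero (≤-trans (s≤s z≤n) (m≤n+m 3 x))}} (begin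
    Pv * (y + 2) * (y + 3) * (x + 3)               ≡⟨ identity₁ Pv (y + 2) (y + 3) (x + 3) ⟩
    Pv * (x + 3) * ((y + 2) * (y + 3))             ≤⟨ *-monoˡ-≤ ((y + 2) * (y + 3)) (∏V[W+3]≤6∏WW n) ⟩
    6 * Pw * x * ((y + 2) * (y + 3))               ≡⟨ *-assoc (6 * Pw) x _ ⟩
    6 * Pw * (x * ((y + 2) * (y + 3)))             ≤⟨ *-monoʳ-≤ (6 * Pw) quadratic ⟩
    6 * Pw * (y * y * (x + 3))                     ≡⟨ identity₂ Pw y (x + 3) ⟩
    6 * (Pw * y) * y * (x + 3)                     ∎)
    where
    open ≤-Reasoning
    Pv = ∏≤ v (3 + n)
    Pw = ∏≤ w (3 + n)
    x  = w (3 + n)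
    y  = w (4 + n)
    identity₁ : ∀ p a b c → p * a * b * c ≡ p * c * (a * b)
    identity₁ = solve-∀
    identity₂ : ∀ p y c → 6 * p * (y * y * c) ≡ 6 * (p * y) * y * c
    identity₂ = solve-∀
    identity₃ : ∀ x y → x * (y * y) + 3 * y * y ≡ y * y * (x + 3)
    identity₃ = solve-∀
    identity₄ : ∀ x y → x * ((y + 2) * (y + 3)) ≡ x * (y * y) + (5 * (x * y) + 6 * x)
    identity₄ = solve-∀
    identity₅ : ∀ x y → 5 * (x * y) + 6 * y + x * y ≡ 3 * (2 * x + 2) * y
    identity₅ = solve-∀
    x≤y : x ≤ y
    x≤y = W-mono-index z (n≤1+n (3 + n))
    -- That is, (1 + 2/y) (1 + 3/y) ≤ 1 + 3/x, so the correction 1 + 3/x absorbs each new factor; it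
    -- follows from y ≥ 2 x + 2.
    quadratic : x * ((y + 2) * (y + 3)) ≤ y * y * (x + 3)
    quadratic = begin
      x * ((y + 2) * (y + 3))                      ≡⟨ identity₄ x y ⟩
      x * (y * y) + (5 * (x * y) + 6 * x)          ≤⟨ +-monoʳ-≤ (x * (y * y)) (+-monoʳ-≤ (5 * (x * y)) (*-monoʳ-≤ 6 x≤y)) ⟩
      x * (y * y) + (5 * (x * y) + 6 * y)          ≤⟨ +-monoʳ-≤ (x * (y * y)) (m≤m+n _ (x * y)) ⟩
      x * (y * y) + (5 * (x * y) + 6 * y + x * y)  ≡⟨ cong (λ e → x * (y * y) + e) (identity₅ x y) ⟩
      x * (y * y) + 3 * (2 * x + 2) * y            ≤⟨ +-monoʳ-≤ (x * (y * y)) (*-monoˡ-≤ y (*-monoʳ-≤ 3 (2W+2≤W z (2 + n)))) ⟩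
      x * (y * y) + 3 * y * y                      ≡⟨ identity₃ x y ⟩
      y * y * (x + 3)                              ∎

  ∏V≤6∏W : ∀ n ks → 3 ≤ n → Unique ks → All (1 ≤_) ks → All (_≤ n) ks → ∏V z ks ≤ 6 * ∏W z ks
  ∏V≤6∏W n ks 3≤n u pos bound with j , refl ← m≤n⇒∃[o]m+o≡n 3≤n = *-cancelʳ-≤ _ _ Pw {{Pw≢0}} (begin
    product (map v ks) * Pw        ≤⟨ ∏-subset v w (λ k → m≤m+n (w k) 2) (3 + j) ks u pos bound ⟩
    ∏≤ v (3 + j) * ∏W z ks         ≤⟨ *-monoˡ-≤ (∏W z ks) Pv≤6Pw ⟩
    6 * Pw * ∏W z ks               ≡⟨ identity Pw (∏W z ks) ⟩
    6 * ∏W z ks * Pw               ∎)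
    where
    open ≤-Reasoning
    Pw = ∏≤ w (3 + j)
    Pw≢0 : NonZero Pw
    Pw≢0 = ∏≤-nonZero w (3 + j) (λ k → W-nonZero k z)
    identity : ∀ a b → 6 * a * b ≡ 6 * b * a
    identity = solve-∀
    Pv≤6Pw : ∏≤ v (3 + j) ≤ 6 * Pw
    Pv≤6Pw = *-cancelʳ-≤ _ _ (w (3 + j)) {{W-nonZero (3 + j) z}}
      (≤-trans (*-monoʳ-≤ (∏≤ v (3 + j)) (m≤m+n (w (3 + j)) 3)) (∏V[W+3]≤6∏WW j))

-- The indices n / e and the lower bound for A / B

∈-divisors : ∀ b s qs {k} → k ∈ divisors b s qs →
  ∃[ m ] (k ≡ s * m × m ∣ product qs × (∀ {q} → Prime q → All Prime qs → All (q ≢_) qs → q ∤ m))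
∈-divisors true s [] (here refl) = 1 , sym (*-identityʳ s) , ∣-refl , λ pq _ _ q∣1 → prime≢1 pq (∣1⇒≡1 q∣1)
∈-divisors b s (q ∷ qs) k∈ with ∈-++⁻ (divisors b (s * q) qs) (subst (_ ∈_) (unfold b) k∈)
  where
  unfold : ∀ b → divisors b s (q ∷ qs) ≡ divisors b (s * q) qs ++ divisors (not b) s qs
  unfold true  = refl
  unfold false = refl
... | inj₁ k∈₁ with m , k≡ , m∣ , ∤m ← ∈-divisors b (s * q) qs k∈₁ =
  q * m , trans k≡ (*-assoc s q m) , *-monoʳ-∣ q m∣ ,
  λ { pq (pq′ ∷ pqs) (q≢ ∷ q≢qs) → prime∤* pq q m (λ q∣ → q≢ (prime∣prime⇒≡ pq pq′ q∣)) (∤m pq pqs q≢qs) }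
... | inj₂ k∈₂ with m , k≡ , m∣ , ∤m ← ∈-divisors (not b) s qs k∈₂ =
  m , k≡ , ∣n⇒∣m*n q m∣ , λ { pq (_ ∷ pqs) (_ ∷ q≢qs) → ∤m pq pqs q≢qs }

-- The two halves of the list are disjoint because, after removal of s, the indices of the first are
-- divisible by q and those of the second are not.
divisors-unique : ∀ b s .{{s≢0 : NonZero s}} qs → Unique qs → All Prime qs → Unique (divisors b s qs)
divisors-unique true  s [] _ _ = [] ∷ []
divisors-unique false s [] _ _ = []
divisors-unique b s {{s≢0}} (q ∷ qs) (q≢qs ∷ u) (pq ∷ pqs) = unfold b (++⁺
  (divisors-unique b (s * q) {{m*n≢0 s q {{s≢0}} {{prime⇒nonZero pq}}}} qs u pqs) (divisors-unique (not b) s qs u pqs)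
  λ (k∈₁ , k∈₂) → disjoint (∈-divisors b (s * q) qs k∈₁) (∈-divisors (not b) s qs k∈₂))
  where
  unfold : ∀ b → Unique (divisors b (s * q) qs ++ divisors (not b) s qs) → Unique (divisors b s (q ∷ qs))
  unfold true  = λ u → u
  unfold false = λ u → u

  disjoint : ∀ {k} →
    ∃[ m ] (k ≡ s * q * m × m ∣ product qs × (∀ {q} → Prime q → All Prime qs → All (q ≢_) qs → q ∤ m)) →
    ∃[ m ] (k ≡ s * m × m ∣ product qs × (∀ {q} → Prime q → All Prime qs → All (q ≢_) qs → q ∤ m)) → ⊥
  disjoint (m , k≡ , _) (m′ , k≡′ , _ , ∤m′) = ∤m′ pq pqs q≢qs
    (subst (q ∣_) (*-cancelˡ-≡ _ _ s (trans (sym (*-assoc s q m)) (trans (sym k≡) k≡′))) (m∣m*n m))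

-- Euler's function of s ∏ qs when qs lists all primes dividing that product.
φ : ℕ → List ℕ → ℕ
φ s qs = s * product (map pred qs)

sum-∷ : ∀ b s q qs →
  sum (divisors b s (q ∷ qs)) ≡ sum (divisors b (s * q) qs) + sum (divisors (not b) s qs)
sum-∷ true  s q qs = sum-++ (divisors true (s * q) qs) (divisors false s qs)
sum-∷ false s q qs = sum-++ (divisors false (s * q) qs) (divisors true s qs)

-- Expand s ∏ (q - 1): choosing q or -1 in each factor produces exactly the indices, with sign given
-- by the parity of the number of omitted primes.
sum-divisors : ∀ s qs → All NonZero qs → sum (divisors true s qs) ≡ φ s qs + sum (divisors false s qs)
sum-divisors s [] [] = cong (_+ 0) (sym (*-identityʳ s))
sum-divisors s (suc q ∷ qs) (_ ∷ ≢0) = begin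
  sum (divisors true s (suc q ∷ qs))       ≡⟨ sum-∷ true s (suc q) qs ⟩
  sum (divisors true (s * suc q) qs) + F₂  ≡⟨ cong (_+ F₂) (sum-divisors (s * suc q) qs ≢0) ⟩
  s * suc q * ψ + F₁ + F₂                  ≡⟨ identity s q ψ F₁ F₂ ⟩
  s * (q * ψ) + (F₁ + (s * ψ + F₂))        ≡⟨ cong (λ t → s * (q * ψ) + (F₁ + t)) (sum-divisors s qs ≢0) ⟨
  s * (q * ψ) + (F₁ + sum (divisors true s qs))
                                           ≡⟨ cong (λ t → s * (q * ψ) + t) (sum-∷ false s (suc q) qs) ⟨
  φ s (suc q ∷ qs) + sum (divisors false s (suc q ∷ qs)) ∎
  where
  open ≡-Reasoning
  ψ  = product (map pred qs)
  F₁ = sum (divisors false (s * suc q) qs)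
  F₂ = sum (divisors false s qs)
  identity : ∀ s q x f g → s * (1 + q) * x + f + g ≡ s * (q * x) + (f + (s * x + g))
  identity = solve-∀

divisors-nonempty : ∀ s qs → ∃[ k ] ∃[ ks ] divisors true s qs ≡ k ∷ ks
divisors-nonempty s [] = s , [] , refl
divisors-nonempty s (q ∷ qs) with k , ks , eq ← divisors-nonempty (s * q) qs =
  k , ks ++ divisors false s qs , cong (_++ divisors false s qs) eq

module _ (z : ℕ) {{z≢0 : NonZero z}} (n s : ℕ) (3≤n : 3 ≤ n) (qs : List ℕ) (n≡ : s * product qs ≡ n)
         (unique : Unique qs) (primes : All Prime qs) where

  private
    F = sum (divisors false s qs)
    n≢0 : NonZero n
    n≢0 = >-nonZero (≤-trans (s≤s z≤n) 3≤n)
    s≢0 : NonZero s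
    s≢0 = m*n≢0⇒m≢0 s {{subst NonZero (sym n≡) n≢0}}

  divisors-∣ : ∀ b {k} → k ∈ divisors b s qs → k ∣ n
  divisors-∣ b k∈ with m , k≡ , m∣ , _ ← ∈-divisors b s qs k∈ = subst₂ _∣_ (sym k≡) n≡ (*-monoʳ-∣ s m∣)

  divisors-positive : ∀ b → All (1 ≤_) (divisors b s qs)
  divisors-positive b = All.tabulate λ k∈ → >-nonZero⁻¹ _ {{≢-nonZero λ { refl →
    ≢-nonZero⁻¹ n {{n≢0}} (0∣⇒≡0 (divisors-∣ b k∈)) }}}

  -- Write Σ₊ and Σ₋ for the sums of the even and the odd indices, so Σ₊ = φ + Σ₋. Then B ≤ W Σ₋ +
  -- 1, and V Σ₊ is at most the product of the V k over the even indices, which is at most 6 A.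
  W-φ*B<6A : (W (φ s qs) z + 1) * ∏W z (divisors false s qs) < 6 * ∏W z (divisors true s qs)
  W-φ*B<6A = begin-strict
    (W (φ s qs) z + 1) * ∏W z (divisors false s qs)  ≤⟨ *-monoʳ-≤ (W (φ s qs) z + 1) (∏W≤W-sum+1 z (divisors false s qs)) ⟩
    (W (φ s qs) z + 1) * (W F z + 1)                 ≤⟨ W+1-supermultiplicative z (φ s qs) F ⟩
    W (φ s qs + F) z + 1                             <⟨ +-monoʳ-< (W (φ s qs + F) z) (n<1+n 1) ⟩
    V (φ s qs + F) z                                 ≡⟨ cong (λ k → V k z) (sum-divisors s qs (All.map prime⇒nonZero primes)) ⟨
    V (sum (divisors true s qs)) z                   ≤⟨ V-sum (divisors-nonempty s qs) ⟩
    ∏V z (divisors true s qs)                        ≤⟨ ∏V≤6∏W z n _ 3≤n (divisors-unique true s {{s≢0}} qs unique primes)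
                                                        (divisors-positive true)
                                                        (All.tabulate λ k∈ → ∣⇒≤ {{n≢0}} (divisors-∣ true k∈)) ⟩
    6 * ∏W z (divisors true s qs)                    ∎
    where
    open ≤-Reasoning
    V-sum : ∃[ k ] ∃[ ks ] divisors true s qs ≡ k ∷ ks → V (sum (divisors true s qs)) z ≤ ∏V z (divisors true s qs)
    V-sum (k , ks , eq) = subst (λ ks → V (sum ks) z ≤ ∏V z ks) (sym eq) (V-sum≤∏V z k ks)

  ∏W-divisors-nonZero : ∀ b → NonZero (∏W z (divisors b s qs))
  ∏W-divisors-nonZero b = go (divisors b s qs) (divisors-positive b)
    where
    go : ∀ ks → All (1 ≤_) ks → NonZero (∏W z ks)
    go [] [] = _
    go (k ∷ ks) (1≤k ∷ pos) = m*n≢0 (W k z) _ {{W-nonZero k z {{>-nonZero 1≤k}}}} {{go ks pos}}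

-- Euler's function is at least 6 beyond 12

∏∏ : List ℕ → ℕ × ℕ
∏∏ qs = product qs , product (map pred qs)

∏∏-↭ : ∀ {xs ys} → xs ↭ ys → ∏∏ xs ≡ ∏∏ ys
∏∏-↭ xs↭ys = cong₂ _,_ (product-↭ xs↭ys) (product-↭ (map⁺ pred xs↭ys))

scale : ℕ → ℕ × ℕ → ℕ × ℕ
scale x (P , Q) = x * P , pred x * Q

-- A list without repetitions either avoids x or becomes one avoiding x after x is split off. Each
-- use therefore doubles the list of candidates.
∏∏-with : ∀ x (P : ℕ → Set) candidates →
  (∀ ys → Unique ys → All P ys → All (_≢ x) ys → ∏∏ ys ∈ candidates) →
  ∀ xs → Unique xs → All P xs → ∏∏ xs ∈ candidates ++ map (scale x) candidates
∏∏-with x P candidates without xs u Pxs with extract x xs u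
... | inj₁ ≢x = ∈-++⁺ˡ (without xs u Pxs ≢x)
... | inj₂ (ys , xs↭ , ≢x , u′) with _ ∷ Pys ← All-resp-↭ xs↭ Pxs =
  ∈-++⁺ʳ candidates (subst (_∈ map (scale x) candidates) (sym (∏∏-↭ xs↭)) (∈-map⁺ (scale x) (without ys u′ Pys ≢x)))

SmallPrime : ℕ → Set
SmallPrime q = Prime q × q < 7

smallPrime-cases : ∀ {q} → SmallPrime q → q ≢ 5 → q ≢ 3 → q ≢ 2 → ⊥
smallPrime-cases {0} (p0 , _) _ _ _ = ¬prime[0] p0
smallPrime-cases {1} (p1 , _) _ _ _ = ¬prime[1] p1
smallPrime-cases {2} _ _ _ ≢2 = ≢2 refl
smallPrime-cases {3} _ _ ≢3 _ = ≢3 refl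
smallPrime-cases {4} (p4 , _) _ _ _ = from-no (prime? 4) p4
smallPrime-cases {5} _ ≢5 _ _ = ≢5 refl
smallPrime-cases {6} (p6 , _) _ _ _ = from-no (prime? 6) p6
smallPrime-cases {suc (suc (suc (suc (suc (suc (suc _))))))} (_ , s≤s (s≤s (s≤s (s≤s (s≤s (s≤s (s≤s ()))))))) _ _ _

smallPrimes-∏∏ : ∀ qs → Unique qs → All SmallPrime qs →
  ∏∏ qs ∈ (1 , 1) ∷ (2 , 1) ∷ (3 , 2) ∷ (6 , 2) ∷ (5 , 4) ∷ (10 , 4) ∷ (15 , 8) ∷ (30 , 8) ∷ []
smallPrimes-∏∏ =
  ∏∏-with 5 SmallPrime ((1 , 1) ∷ (2 , 1) ∷ (3 , 2) ∷ (6 , 2) ∷ []) λ qs u small ≢5 →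
  ∏∏-with 3 (λ q → SmallPrime q × q ≢ 5) ((1 , 1) ∷ (2 , 1) ∷ []) (λ qs u small ≢3 →
  ∏∏-with 2 (λ q → (SmallPrime q × q ≢ 5) × q ≢ 3) ((1 , 1) ∷ []) none qs u (All.zip (small , ≢3)))
  qs u (All.zip (small , ≢5))
  where
  none : ∀ qs → Unique qs → All (λ q → (SmallPrime q × q ≢ 5) × q ≢ 3) qs → All (_≢ 2) qs → ∏∏ qs ∈ (1 , 1) ∷ []
  none [] _ _ _ = here refl
  none (q ∷ qs) _ (((sq , ≢5) , ≢3) ∷ _) (≢2 ∷ _) = ⊥-elim (smallPrime-cases sq ≢5 ≢3 ≢2)

-- It is applied with c the integer part of 12 / P, so that s P > 12 means s ≥ c + 1. The bound 6 is
-- attained for P = 6, at n = 18.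
φ-bound : ∀ s P Q c → c * P ≤ 12 → 6 ≤ suc c * Q → 12 < s * P → 6 ≤ s * Q
φ-bound s P Q c cP≤12 6≤cQ 12<sP = ≤-trans 6≤cQ (*-monoˡ-≤ Q c<s)
  where
  c<s : c < s
  c<s = ≰⇒> λ s≤c → <⇒≱ 12<sP (≤-trans (*-monoˡ-≤ P s≤c) cP≤12)

6≤φ-candidates : ∀ s → All (λ (P , Q) → 12 < s * P → 6 ≤ s * Q)
  ((1 , 1) ∷ (2 , 1) ∷ (3 , 2) ∷ (6 , 2) ∷ (5 , 4) ∷ (10 , 4) ∷ (15 , 8) ∷ (30 , 8) ∷ [])
6≤φ-candidates s =
    φ-bound s 1 1 12 (≤ᵇ⇒≤ _ _ tt) (≤ᵇ⇒≤ _ _ tt)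
  ∷ φ-bound s 2 1 6 (≤ᵇ⇒≤ _ _ tt) (≤ᵇ⇒≤ _ _ tt)
  ∷ φ-bound s 3 2 4 (≤ᵇ⇒≤ _ _ tt) (≤ᵇ⇒≤ _ _ tt)
  ∷ φ-bound s 6 2 2 (≤ᵇ⇒≤ _ _ tt) (≤ᵇ⇒≤ _ _ tt)
  ∷ φ-bound s 5 4 2 (≤ᵇ⇒≤ _ _ tt) (≤ᵇ⇒≤ _ _ tt)
  ∷ φ-bound s 10 4 1 (≤ᵇ⇒≤ _ _ tt) (≤ᵇ⇒≤ _ _ tt)
  ∷ φ-bound s 15 8 0 (≤ᵇ⇒≤ _ _ tt) (≤ᵇ⇒≤ _ _ tt)
  ∷ φ-bound s 30 8 0 (≤ᵇ⇒≤ _ _ tt) (≤ᵇ⇒≤ _ _ tt)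
  ∷ []

pred-nonZero : ∀ {q} → Prime q → NonZero (pred q)
pred-nonZero {suc (suc _)} _ = _
pred-nonZero {0} p0 = ⊥-elim (¬prime[0] p0)
pred-nonZero {1} p1 = ⊥-elim (¬prime[1] p1)

∏pred-nonZero : ∀ {qs} → All Prime qs → NonZero (product (map pred qs))
∏pred-nonZero [] = _
∏pred-nonZero {q ∷ qs} (pq ∷ pqs) = m*n≢0 (pred q) _ {{pred-nonZero pq}} {{∏pred-nonZero pqs}}

pred≤∏pred : ∀ {q qs} → All Prime qs → q ∈ qs → pred q ≤ product (map pred qs)
pred≤∏pred pqs q∈ = ∣⇒≤ {{∏pred-nonZero pqs}} (∈⇒∣product (∈-map⁺ pred q∈))

pred*pred≤∏pred : ∀ {p q qs} → All Prime qs → Unique qs → p ∈ qs → q ∈ qs → p ≢ q →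
                  pred p * pred q ≤ product (map pred qs)
pred*pred≤∏pred {p} {q} {qs} pqs u p∈ q∈ p≢q with extract p qs u
... | inj₁ ≢p = contradiction refl (All.lookup ≢p p∈)
... | inj₂ (qs′ , qs↭ , ≢p , u′) with _ ∷ pqs′ ← All-resp-↭ qs↭ pqs | ∈-resp-↭ qs↭ q∈
...   | here q≡p = contradiction (sym q≡p) p≢q
...   | there q∈′ = subst (pred p * pred q ≤_) (sym (product-↭ (map⁺ pred qs↭))) (*-monoʳ-≤ (pred p) (pred≤∏pred pqs′ q∈′))

∏pred≤φ : ∀ s qs .{{_ : NonZero s}} → product (map pred qs) ≤ φ s qs
∏pred≤φ s qs = m≤n*m _ s

-- A prime factor q ≥ 7 suffices on its own, as q - 1 ≥ 6. Otherwise the primes lie among 2, 3, 5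
-- and only eight radicals remain.
6≤φ : ∀ s qs → Unique qs → All Prime qs → 12 < s * product qs → 6 ≤ φ s qs
6≤φ s qs u pqs 12<n with any? (7 ≤?_) qs
... | yes big with q , q∈ , 7≤q ← find big =
  ≤-trans (pred-mono-≤ 7≤q) (≤-trans (pred≤∏pred pqs q∈) (∏pred≤φ s qs {{s≢0}}))
  where
  s≢0 : NonZero s
  s≢0 = m*n≢0⇒m≢0 s {{>-nonZero (≤-trans (s≤s z≤n) 12<n)}}
... | no ¬big = All.lookup (6≤φ-candidates s) (smallPrimes-∏∏ qs u
  (All.tabulate λ q∈ → All.lookup pqs q∈ , ≰⇒> λ 7≤q → ¬big (lose q∈ 7≤q))) 12<n

-- Existence of a primitive prime divisor of W n

squarefree-part : ∀ ps → All Prime ps → ∃[ s ] ∃[ qs ]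
  (s * product qs ≡ product ps × Unique qs × All Prime qs × (∀ {q} → q ∈ ps → q ∈ qs))
squarefree-part [] [] = 1 , [] , refl , [] , [] , λ ()
squarefree-part (p ∷ ps) (pp ∷ pps) with s , qs , s∏≡ , u , pqs , ⊆ ← squarefree-part ps pps
  with any? (p ≟_) qs
... | yes some = p * s , qs , trans (*-assoc p s (product qs)) (cong (p *_) s∏≡) , u , pqs ,
  λ { (here refl) → p∈ (find some) ; (there q∈) → ⊆ q∈ }
  where
  p∈ : ∃[ q ] (q ∈ qs × p ≡ q) → p ∈ qs
  p∈ (_ , q∈ , refl) = q∈
... | no none = s , p ∷ qs , trans (swap s p (product qs)) (cong (p *_) s∏≡) ,
  All.tabulate (λ q∈ p≡q → none (lose q∈ p≡q)) ∷ u , pp ∷ pqs ,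
  λ { (here refl) → here refl ; (there q∈) → there (⊆ q∈) }
  where
  swap : ∀ s p x → s * (p * x) ≡ p * (s * x)
  swap = solve-∀

prime∣^ : ∀ {q} → Prime q → ∀ p k → q ∣ p ^ k → q ∣ p
prime∣^ pq p zero    q∣1 = contradiction (∣1⇒≡1 q∣1) (prime≢1 pq)
prime∣^ pq p (suc k) q∣ = [ (λ q∣p → q∣p) , prime∣^ pq p k ]′ (euclidsLemma p (p ^ k) pq q∣)

module NoPrimitive-⊥
  (z n : ℕ) {{z≢0 : NonZero z}} (12<n : 12 < n)
  (s : ℕ) (qs : List ℕ) (n≡ : s * product qs ≡ n)
  (unique : Unique qs) (primes : All Prime qs) (complete : ∀ {q} → Prime q → q ∣ n → q ∈ qs)
  (imprimitive : ∀ {p} → Prime p → p ∣ W n z → ∃[ m ] (1 ≤ m × m < n × p ∣ W m z))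
  where

  open NoPrimitive z n 12<n s qs n≡ unique primes complete imprimitive

  private
    3≤n : 3 ≤ n
    3≤n = ≤-trans (m≤m+n 3 10) 12<n

    F = φ s qs

    n≢0 : NonZero n
    n≢0 = >-nonZero (≤-trans (s≤s z≤n) 12<n)

    s≢0 : NonZero s
    s≢0 = m*n≢0⇒m≢0 s {{subst NonZero (sym n≡) n≢0}}

  -- A common multiple K of the squares of all bad primes gives A ∣ K B, hence 6 A ≤ 6 K B ≤ (W F +
  -- 1) B, against the lower bound for A. What remains is to find such a K that is small.
  absurd : ∀ K .{{_ : NonZero K}} → (∀ {p} → Bad p → p * p ∣ K) → 6 * K ≤ W F z + 1 → ⊥
  absurd K {{K≢0}} bad∣K 6K≤ = <⇒≱ (W-φ*B<6A z n s 3≤n qs n≡ unique primes) (begin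
    6 * A                ≤⟨ *-monoʳ-≤ 6 (∣⇒≤ {{KB≢0}} (∣-locally A (K * B) {{A≢0}} local)) ⟩
    6 * (K * B)          ≡⟨ *-assoc 6 K B ⟨
    6 * K * B            ≤⟨ *-monoˡ-≤ B 6K≤ ⟩
    (W F z + 1) * B      ∎)
    where
    open ≤-Reasoning
    A≢0 : NonZero A
    A≢0 = ∏W-divisors-nonZero z n s 3≤n qs n≡ unique primes true

    B≢0 : NonZero B
    B≢0 = ∏W-divisors-nonZero z n s 3≤n qs n≡ unique primes false

    local : ∀ {p} → Prime p → ∃[ u ] (p ∤ u × A ∣ u * (K * B))
    local {p} pp = [ good , bad ]′ (good-or-bad pp)
      where
      swap : ∀ k u b → k * (u * b) ≡ u * (k * b)
      swap = solve-∀
      good : ∃[ u ] (p ∤ u × A ∣ u * B) → ∃[ u ] (p ∤ u × A ∣ u * (K * B))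
      good (u , p∤u , A∣) = u , p∤u , subst (A ∣_) (swap K u B) (∣n⇒∣m*n K A∣)
      enlarge : ∃[ u ] (p ∤ u × A ∣ u * (p * p * B)) → p * p ∣ K → ∃[ u ] (p ∤ u × A ∣ u * (K * B))
      enlarge (u , p∤u , A∣) p²∣K = u , p∤u , ∣-trans A∣ (*-monoʳ-∣ u (*-monoˡ-∣ B p²∣K))
      bad : Bad p → ∃[ u ] (p ∤ u × A ∣ u * (K * B))
      bad bp = enlarge (BadPrime.A∣p²B bp) (bad∣K bp)

    KB≢0 : NonZero (K * B)
    KB≢0 = m*n≢0 K B {{K≢0}} {{B≢0}}

  small-K : ∀ K k → K ≤ k * k → k ≤ F + 1 → 6 * K ≤ W F z + 1
  small-K K k K≤ k≤ = go (m≤n⇒∃[o]m+o≡n (6≤φ s qs unique primes (subst (12 <_) (sym n≡) 12<n)))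
    where
    go : ∃[ j ] 6 + j ≡ F → 6 * K ≤ W F z + 1
    go (j , eq) = ≤-trans (*-monoʳ-≤ 6 (≤-trans K≤ (*-mono-≤ k≤j+7 k≤j+7)))
      (subst (λ f → 6 * ((j + 7) * (j + 7)) ≤ W f z + 1) eq (6[j+7]²≤W+1 z j))
      where
      k≤j+7 : k ≤ j + 7
      k≤j+7 = subst (k ≤_) (trans (cong (_+ 1) (trans (sym eq) (+-comm 6 j))) (+-assoc j 6 1)) k≤

  large-K : ∀ K → K ≤ 4 * (F * F) → 8 ≤ F → 6 * K ≤ W F z + 1
  large-K K K≤ 8≤F = go (m≤n⇒∃[o]m+o≡n 8≤F)
    where
    go : ∃[ j ] 8 + j ≡ F → 6 * K ≤ W F z + 1
    go (j , eq) = begin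
      6 * K                        ≤⟨ *-monoʳ-≤ 6 K≤ ⟩
      6 * (4 * (F * F))            ≡⟨ *-assoc 6 4 (F * F) ⟨
      24 * (F * F)                 ≡⟨ cong (λ f → 24 * (f * f)) (trans (sym eq) (+-comm 8 j)) ⟩
      24 * ((j + 8) * (j + 8))     ≤⟨ 24[j+8]²≤W+1 z j ⟩
      W (8 + j) z + 1              ≡⟨ cong (λ f → W f z + 1) eq ⟩
      W F z + 1                    ∎
      where open ≤-Reasoning

  -- The rank r of p satisfies q ∣ r < 2 p < 2 q, hence n = q pⁱ⁺¹.
  module _ {p q : ℕ} (bad : Bad p) (q∈ : q ∈ qs) (p<q : p < q) where
    open Bad bad

    private
      pq : Prime q
      pq = All.lookup primes q∈

      q∣r : q ∣ r
      q∣r with euclidsLemma r (p ^ suc i) pq (subst (q ∣_) n≡rp^ (subst (q ∣_) n≡ (∣n⇒∣m*n s (∈⇒∣product q∈))))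
      ... | inj₁ q∣r  = q∣r
      ... | inj₂ q∣p^ = contradiction (prime∣prime⇒≡ pq isPrime (prime∣^ pq p (suc i) q∣p^)) (>⇒≢ p<q)

      r≡q : r ≡ q
      r≡q with q∣r
      ... | divides 0 r≡0 = contradiction (subst (1 ≤_) r≡0 (Rank.positive rank)) λ ()
      ... | divides 1 r≡q = trans r≡q (*-identityˡ q)
      ... | divides (suc (suc t)) r≡ = contradiction (rank<2p isPrime rank)
        (≤⇒≯ (≤-trans (*-monoʳ-≤ 2 (<⇒≤ p<q)) (subst (2 * q ≤_) (sym r≡) (*-monoˡ-≤ q (s≤s (s≤s (z≤n {t})))))))

      q<2p : q < 2 * p
      q<2p = subst (_< 2 * p) r≡q (rank<2p isPrime rank)

      p-1*q-1≤F : pred p * pred q ≤ F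
      p-1*q-1≤F = ≤-trans (pred*pred≤∏pred primes unique member q∈ (<⇒≢ p<q)) (∏pred≤φ s qs {{s≢0}})

      -- Since n = q pⁱ⁺¹, the only candidates for a bad prime are p and q.
      bad∣K : ∀ {p′} → Bad p′ → p′ * p′ ∣ p * q * (p * q)
      bad∣K {p′} bad′ = *-pres-∣ p′∣pq p′∣pq
        where
        pp′ = Bad.isPrime bad′
        p′∣pq : p′ ∣ p * q
        p′∣pq with euclidsLemma r (p ^ suc i) pp′ (subst (p′ ∣_) n≡rp^ (subst (p′ ∣_) n≡ (∣n⇒∣m*n s (∈⇒∣product (Bad.member bad′)))))
        ... | inj₁ p′∣r  = ∣n⇒∣m*n p (subst (p′ ∣_) r≡q p′∣r)
        ... | inj₂ p′∣p^ = ∣m⇒∣m*n q (prime∣^ pp′ p (suc i) p′∣p^)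

      -- The extreme case is p = 3, q = 5; primality of q rules out q = 4, where the product would
      -- be 6.
      8≤[p-1][q-1] : ∀ p q → p < q → q < 2 * p → Prime q → 3 ≤ p → 8 ≤ pred p * pred q
      8≤[p-1][q-1] 3 4 _ _ p4 _ = contradiction p4 (from-no (prime? 4))
      8≤[p-1][q-1] 3 (suc (suc (suc (suc (suc q))))) _ _ _ _ = *-monoʳ-≤ 2 (m≤m+n 4 q)
      8≤[p-1][q-1] (suc (suc (suc (suc p)))) q p<q _ _ _ =
        ≤-trans (m≤m+n 8 4) (*-mono-≤ (m≤m+n 3 p) (pred-mono-≤ (≤-trans (m≤m+n 5 p) p<q)))
      8≤[p-1][q-1] 3 (suc (suc (suc zero))) (s≤s (s≤s (s≤s ()))) _ _ _
      8≤[p-1][q-1] 3 (suc (suc zero)) (s≤s (s≤s ())) _ _ _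
      8≤[p-1][q-1] 3 (suc zero) (s≤s ()) _ _ _
      8≤[p-1][q-1] 2 _ _ _ _ (s≤s (s≤s ()))
      8≤[p-1][q-1] 1 _ _ _ _ (s≤s ())
      8≤[p-1][q-1] 0 _ _ _ _ ()

      pq≤2[p-1][q-1] : ∀ p q → p < q → 3 ≤ p → p * q ≤ 2 * (pred p * pred q)
      pq≤2[p-1][q-1] p q p<q 3≤p with a , refl ← m≤n⇒∃[o]m+o≡n 3≤p with b , refl ← m≤n⇒∃[o]m+o≡n p<q =
        subst ((3 + a) * (4 + a + b) ≤_) (identity a b) (m≤m+n _ (3 * a + b + a * a + a * b))
        where
        identity : ∀ a b → (3 + a) * (4 + a + b) + (3 * a + b + a * a + a * b) ≡ 2 * ((2 + a) * (3 + a + b))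
        identity = solve-∀

      square≤ : ∀ {x} → x ≤ 2 * F → x * x ≤ 4 * (F * F)
      square≤ x≤ = ≤-trans (*-mono-≤ x≤ x≤) (≤-reflexive (identity F))
        where
        identity : ∀ f → 2 * f * (2 * f) ≡ 4 * (f * f)
        identity = solve-∀

      bound : 6 * (p * q * (p * q)) ≤ W F z + 1
      bound with 3 ≤? p
      ... | yes 3≤p = large-K _ (square≤ (≤-trans (pq≤2[p-1][q-1] p q p<q 3≤p) (*-monoʳ-≤ 2 p-1*q-1≤F)))
                        (≤-trans (8≤[p-1][q-1] p q p<q q<2p pq 3≤p) p-1*q-1≤F)
      -- Here p ≤ 2 and q < 2 p leave only p q ≤ 6, so K is at most 6² and φ n ≥ 6 is sufficient.
      ... | no p≱3 = small-K _ 6 (*-mono-≤ pq≤6 pq≤6)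
                       (≤-trans (6≤φ s qs unique primes (subst (12 <_) (sym n≡) 12<n)) (m≤m+n F 1))
        where
        p≤2 : p ≤ 2
        p≤2 = s≤s⁻¹ (≰⇒> p≱3)
        pq≤6 : p * q ≤ 6
        pq≤6 = *-mono-≤ p≤2 (s≤s⁻¹ (≤-trans q<2p (*-monoʳ-≤ 2 p≤2)))

    private
      K≢0 : NonZero (p * q * (p * q))
      K≢0 = m*n≢0 (p * q) (p * q) {{pq≢0}} {{pq≢0}}
        where
        pq≢0 : NonZero (p * q)
        pq≢0 = m*n≢0 p q {{prime⇒nonZero isPrime}} {{prime⇒nonZero pq}}

    not-largest : ⊥
    not-largest = absurd (p * q * (p * q)) {{K≢0}} bad∣K bound

  largest : ∀ {p} → Bad p → ∀ {q} → q ∈ qs → q ≤ p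
  largest bad q∈ = ≮⇒≥ (not-largest bad q∈)

  -- As the goal is ⊥, the existence of a bad prime may be treated as decided. Two bad primes would
  -- each be the largest prime factor of n, so they coincide and K = p² works; with no bad prime K =
  -- 1 does.
  impossible : ⊥
  impossible = ¬¬-excluded-middle {A = ∃[ p ] Bad p} λ
    { (yes (p , bad)) → absurd (p * p) {{square≢0 bad}}
        (λ {p′} bad′ → ∣-reflexive (cong (λ x → x * x) (≤-antisym (largest bad (Bad.member bad′)) (largest bad′ (Bad.member bad)))))
        (small-K (p * p) p ≤-refl (p≤F+1 bad))
    ; (no ¬bad) → absurd 1 (λ {p} bad → contradiction (p , bad) ¬bad) (small-K 1 1 ≤-refl (m≤n+m 1 F)) }
    where
    square≢0 : ∀ {p} → Bad p → NonZero (p * p)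
    square≢0 {p} bad = m*n≢0 p p {{p≢0}} {{p≢0}}
      where p≢0 = prime⇒nonZero (Bad.isPrime bad)

    p≤F+1 : ∀ {p} → Bad p → p ≤ F + 1
    p≤F+1 {p} bad = begin
      p               ≡⟨ suc-pred p {{prime⇒nonZero (Bad.isPrime bad)}} ⟨
      suc (pred p)    ≤⟨ s≤s (≤-trans (pred≤∏pred primes (Bad.member bad)) (∏pred≤φ s qs {{s≢0}})) ⟩
      suc F           ≡⟨ +-comm 1 F ⟩
      F + 1           ∎
      where open ≤-Reasoning

-- Primes dividing the nonzero number W n are at most W n, so a bounded search either finds a
-- primitive one or refutes its existence. The contradiction is needed only in the second case, and
-- the witness stays constructive.
W-primitive : ∀ z n {{z≢0 : NonZero z}} → 12 < n →
  ∃[ p ] (Prime p × p ∣ W n z × (∀ {m} → 1 ≤ m → m < n → p ∤ W m z))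
W-primitive z n {{z≢0}} 12<n with anyUpTo? (λ p → prime? p ×-dec (p ∣? W n z) ×-dec ¬? (earlier? p)) (suc (W n z))
  where
  earlier? : ∀ p → Dec (∃[ m ] (m < n × 1 ≤ m × p ∣ W m z))
  earlier? p = anyUpTo? (λ m → (1 ≤? m) ×-dec (p ∣? W m z)) n
... | yes (p , _ , pp , p∣Wn , none) = p , pp , p∣Wn , λ 1≤m m<n p∣Wm → none (_ , m<n , 1≤m , p∣Wm)
... | no ∄p = ⊥-elim (contradictory (squarefree-part factors factorsPrime))
  where
  n≢0 : NonZero n
  n≢0 = >-nonZero (≤-trans (s≤s z≤n) 12<n)
  open PrimeFactorisation (factorise n {{n≢0}})

  imprimitive : ∀ {p} → Prime p → p ∣ W n z → ∃[ m ] (1 ≤ m × m < n × p ∣ W m z)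
  imprimitive {p} pp p∣Wn with anyUpTo? (λ m → (1 ≤? m) ×-dec (p ∣? W m z)) n
  ... | yes (m , m<n , 1≤m , p∣Wm) = m , 1≤m , m<n , p∣Wm
  ... | no none = contradiction (p , s≤s (∣⇒≤ {{W-nonZero n z {{n≢0}} {{z≢0}}}} p∣Wn) , pp , p∣Wn , none) ∄p

  contradictory : ∃[ s ] ∃[ qs ]
    (s * product qs ≡ product factors × Unique qs × All Prime qs × (∀ {q} → q ∈ factors → q ∈ qs)) → ⊥
  contradictory (s , qs , s∏≡ , unique , primes , ⊆) =
    NoPrimitive-⊥.impossible z n {{z≢0}} 12<n s qs (trans s∏≡ (sym isFactorisation)) unique primes
      (λ {q} pq q∣n → ⊆ (factorisationHasAllPrimeFactors pq (subst (q ∣_) isFactorisation q∣n) factorsPrime))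
      imprimitive

-- Norms and traces

ℚ-ring : AlmostCommutativeRing _ _
ℚ-ring = fromCommutativeRing ℚ.+-*-commutativeRing (λ p → dec⇒maybe (0ℚ ℚ.≟ p))

ι : ℤ → ℚ
ι a = a ℚ./ 1

ι≡mkℚ : ∀ a → ι a ≡ mkℚ a 0 (Coprimality.sym (Coprimality.1-coprimeTo (ℤ.∣ a ∣)))
ι≡mkℚ a = ℚ.↥p/↧p≡p (mkℚ a 0 _)

↥ι : ∀ a → ↥ ι a ≡ a
↥ι a = cong ↥_ (ι≡mkℚ a)

ι-injective : ∀ {a b} → ι a ≡ ι b → a ≡ b
ι-injective {a} {b} eq = trans (sym (↥ι a)) (trans (cong ↥_ eq) (↥ι b))

ι-+ : ∀ a b → ι (a ℤ.+ b) ≡ ι a ℚ.+ ι b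
ι-+ a b = sym (trans (cong₂ ℚ._+_ (ι≡mkℚ a) (ι≡mkℚ b))
  (cong ι (cong₂ ℤ._+_ (ℤ.*-identityʳ a) (ℤ.*-identityʳ b))))

ι-* : ∀ a b → ι (a ℤ.* b) ≡ ι a ℚ.* ι b
ι-* a b = sym (cong₂ ℚ._*_ (ι≡mkℚ a) (ι≡mkℚ b))

ι-neg : ∀ a → ι (ℤ.- a) ≡ ℚ.- ι a
ι-neg a = trans (ι≡mkℚ (ℤ.- a)) (trans (lemma a) (cong ℚ.-_ (sym (ι≡mkℚ a))))
  where
  lemma : ∀ a → mkℚ (ℤ.- a) 0 (Coprimality.sym (Coprimality.1-coprimeTo (ℤ.∣ ℤ.- a ∣)))
              ≡ ℚ.- mkℚ a 0 (Coprimality.sym (Coprimality.1-coprimeTo (ℤ.∣ a ∣)))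
  lemma (+ zero)      = refl
  lemma (+ suc n)     = refl
  lemma (ℤ.-[1+ n ])  = refl

Integer : ℚ → Set
Integer q = ∃[ a ] q ≡ ι a

Integer-+ : ∀ {p q} → Integer p → Integer q → Integer (p ℚ.+ q)
Integer-+ (a , refl) (b , refl) = a ℤ.+ b , sym (ι-+ a b)

Integer-* : ∀ {p q} → Integer p → Integer q → Integer (p ℚ.* q)
Integer-* (a , refl) (b , refl) = a ℤ.* b , sym (ι-* a b)

Integer-neg : ∀ {p} → Integer p → Integer (ℚ.- p)
Integer-neg (a , refl) = ℤ.- a , sym (ι-neg a)

denominator-clears : ∀ q → ι (+ ↧ₙ q) ℚ.* q ≡ ι (↥ q)
denominator-clears q@(mkℚ n d-1 _) = trans (cong (ℚ._* q) (ι≡mkℚ (+ suc d-1)))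
  (trans (ℚ.toℚᵘ-injective
    (ℚᵘ.≃-trans (ℚ.toℚᵘ-homo-* (mkℚ (+ suc d-1) 0 (Coprimality.sym (Coprimality.1-coprimeTo (suc d-1)))) q) (ℚᵘ.*≡* (cross n (+ suc d-1)))))
         (sym (ι≡mkℚ n)))
  where
  cross : ∀ n d → d ℤ.* n ℤ.* + 1 ≡ n ℤ.* (+ 1 ℤ.* d)
  cross n d = trans (ℤ.*-identityʳ (d ℤ.* n)) (trans (ℤ.*-comm d n) (cong (n ℤ.*_) (sym (ℤ.*-identityˡ d))))

-- A geometric progression with ratio a / b in lowest terms that stays in ℕ: all its
-- terms are divisible by b, and dividing by b gives another one.
geometric-descent : ∀ a b .{{_ : NonZero b}} → Coprime b a → ∀ m (c : ℕ → ℕ) → c 0 ≤ m → c 0 ≢ 0 →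
  (∀ n → c (suc n) * b ≡ c n * a) → b ≡ 1
geometric-descent a b coprime zero c c0≤0 c0≢0 step = contradiction (n≤0⇒n≡0 c0≤0) c0≢0
geometric-descent a b coprime (suc m) c c0≤ c0≢0 step with 2 ≤? b
... | yes 2≤b = geometric-descent a b coprime m c′ (s≤s⁻¹ (<-≤-trans c′0<c0 c0≤))
                  (λ c′0≡0 → c0≢0 (trans (c≡ 0) (cong (_* b) c′0≡0))) step′
  where
  b∣c : ∀ n → b ∣ c n
  b∣c n = coprime-divisor coprime (subst (b ∣_) (trans (step n) (*-comm (c n) a)) (n∣m*n (c (suc n))))

  c′ : ℕ → ℕ
  c′ n = quotient (b∣c n)

  c≡ : ∀ n → c n ≡ c′ n * b
  c≡ n = _∣_.equality (b∣c n)

  instance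
    c0-nonZero : NonZero (c 0)
    c0-nonZero = ≢-nonZero c0≢0

  c′0<c0 : c′ 0 < c 0
  c′0<c0 = quotient-< (b∣c 0) {{n>1⇒nonTrivial 2≤b}}

  step′ : ∀ n → c′ (suc n) * b ≡ c′ n * a
  step′ n = *-cancelʳ-≡ _ _ b (begin
    c′ (suc n) * b * b   ≡⟨ cong (_* b) (c≡ (suc n)) ⟨
    c (suc n) * b        ≡⟨ step n ⟩
    c n * a              ≡⟨ cong (_* a) (c≡ n) ⟩
    c′ n * b * a         ≡⟨ *-assoc (c′ n) b a ⟩
    c′ n * (b * a)       ≡⟨ cong (c′ n *_) (*-comm b a) ⟩
    c′ n * (a * b)       ≡⟨ *-assoc (c′ n) a b ⟨
    c′ n * a * b         ∎)
    where open ≡-Reasoning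
... | no b≱2 = ≤-antisym (s≤s⁻¹ (≰⇒> b≱2)) (>-nonZero⁻¹ b)

infixr 8 _^ℚ_
_^ℚ_ : ℚ → ℕ → ℚ
q ^ℚ zero  = 1ℚ
q ^ℚ suc n = q ℚ.* q ^ℚ n

-- ℤ is completely integrally closed: a single E ≠ 0 clearing the denominators of all powers of q
-- forces q to be an integer. The integers E qⁿ are a geometric progression whose ratio is q in
-- lowest terms.
powers-integer : ∀ q E → E ≢ + 0 → (∀ n → Integer (ι E ℚ.* q ^ℚ n)) → Integer q
powers-integer q@(mkℚ a b-1 coprime) E E≢0 int = a ,
  trans (sym (ℚ.*-identityˡ q)) (trans (cong (ℚ._* q) (cong (λ b → ι (+ b)) (sym b≡1))) (denominator-clears q))
  where
  b = suc b-1

  c : ℕ → ℤ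
  c n = proj₁ (int n)

  ι-step : ∀ n → ι (c (suc n) ℤ.* + b) ≡ ι (c n ℤ.* a)
  ι-step n = begin
    ι (c (suc n) ℤ.* + b)                    ≡⟨ ι-* (c (suc n)) (+ b) ⟩
    ι (c (suc n)) ℚ.* ι (+ b)                ≡⟨ cong (ℚ._* ι (+ b)) (proj₂ (int (suc n))) ⟨
    ι E ℚ.* (q ℚ.* q ^ℚ n) ℚ.* ι (+ b)       ≡⟨ rearrange (ι E) q (q ^ℚ n) (ι (+ b)) ⟩
    ι E ℚ.* q ^ℚ n ℚ.* (ι (+ b) ℚ.* q)       ≡⟨ cong₂ ℚ._*_ (proj₂ (int n)) (denominator-clears q) ⟩
    ι (c n) ℚ.* ι a                          ≡⟨ ι-* (c n) a ⟨
    ι (c n ℤ.* a)                            ∎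
    where
    open ≡-Reasoning
    rearrange : ∀ e q x b → e ℚ.* (q ℚ.* x) ℚ.* b ≡ e ℚ.* x ℚ.* (b ℚ.* q)
    rearrange = ring-identity ℚ-ring

  step : ∀ n → ℤ.∣ c (suc n) ∣ * b ≡ ℤ.∣ c n ∣ * ℤ.∣ a ∣
  step n = trans (sym (ℤ.abs-* (c (suc n)) (+ b))) (trans (cong ℤ.∣_∣ (ι-injective {c (suc n) ℤ.* + b} {c n ℤ.* a} (ι-step n))) (ℤ.abs-* (c n) a))

  c0≡E : c 0 ≡ E
  c0≡E = ι-injective (trans (sym (proj₂ (int 0))) (ℚ.*-identityʳ (ι E)))

  b≡1 : b ≡ 1
  b≡1 = geometric-descent (ℤ.∣ a ∣) b (Coprimality.sym (Coprimality.recompute coprime)) (ℤ.∣ c 0 ∣) (λ n → ℤ.∣ c n ∣) ≤-refl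
    (λ c0≡0 → E≢0 (trans (sym c0≡E) (ℤ.∣i∣≡0⇒i≡0 c0≡0))) step

-- Integrality of the trace and the norm

module Integrality (F : RealQuadraticField) where
  open RealQuadraticField F using (d)
  open QuadraticField F renaming (_+_ to _⊕_; _*_ to _⊗_; -_ to ⊝_; _-_ to _⊖_; _^_ to _^K_)

  -- The rational part of y times the conjugate of w.
  pairing : K → K → ℚ
  pairing y w = re y ℚ.* re w ℚ.+ ℚ.- (dℚ ℚ.* (im y ℚ.* im w))

  N T : K → ℚ
  N x = pairing x x
  T x = re x ℚ.+ re x

  norm≡N : ∀ x → norm x ≡ N x
  norm≡N x = identity dℚ (re x) (im x)
    where
    identity : ∀ d a b →
      (a ℚ.* 1ℚ ℚ.+ d ℚ.* (b ℚ.* 0ℚ)) ℚ.* (a ℚ.* 1ℚ ℚ.+ b ℚ.* 0ℚ)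
        ℚ.+ ℚ.- ((a ℚ.* 0ℚ ℚ.+ d ℚ.* (b ℚ.* 1ℚ)) ℚ.* (a ℚ.* 0ℚ ℚ.+ b ℚ.* 1ℚ))
      ≡ a ℚ.* a ℚ.+ ℚ.- (d ℚ.* (b ℚ.* b))
    identity = ring-identity ℚ-ring

  N-⊗ : ∀ x y → N (x ⊗ y) ≡ N x ℚ.* N y
  N-⊗ x y = identity dℚ (re x) (im x) (re y) (im y)
    where
    identity : ∀ d a b e f →
      (a ℚ.* e ℚ.+ d ℚ.* (b ℚ.* f)) ℚ.* (a ℚ.* e ℚ.+ d ℚ.* (b ℚ.* f))
        ℚ.+ ℚ.- (d ℚ.* ((a ℚ.* f ℚ.+ b ℚ.* e) ℚ.* (a ℚ.* f ℚ.+ b ℚ.* e)))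
      ≡ (a ℚ.* a ℚ.+ ℚ.- (d ℚ.* (b ℚ.* b))) ℚ.* (e ℚ.* e ℚ.+ ℚ.- (d ℚ.* (f ℚ.* f)))
    identity = ring-identity ℚ-ring

  N-1# : N 1# ≡ 1ℚ
  N-1# = identity dℚ
    where
    identity : ∀ d → 1ℚ ℚ.* 1ℚ ℚ.+ ℚ.- (d ℚ.* (0ℚ ℚ.* 0ℚ)) ≡ 1ℚ
    identity = ring-identity ℚ-ring

  norm-⊖1# : ∀ y → norm (y ⊖ 1#) ≡ N y ℚ.+ ℚ.- T y ℚ.+ 1ℚ
  norm-⊖1# y = trans (norm≡N (y ⊖ 1#)) (identity dℚ (re y) (im y))
    where
    identity : ∀ d a b →
      (a ℚ.+ ℚ.- 1ℚ) ℚ.* (a ℚ.+ ℚ.- 1ℚ) ℚ.+ ℚ.- (d ℚ.* ((b ℚ.+ ℚ.- 0ℚ) ℚ.* (b ℚ.+ ℚ.- 0ℚ)))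
      ≡ a ℚ.* a ℚ.+ ℚ.- (d ℚ.* (b ℚ.* b)) ℚ.+ ℚ.- (a ℚ.+ a) ℚ.+ 1ℚ
    identity = ring-identity ℚ-ring

  T-two-step : ∀ x y → T (x ⊗ (x ⊗ y)) ≡ T x ℚ.* T (x ⊗ y) ℚ.+ ℚ.- (N x ℚ.* T y)
  T-two-step x y = identity dℚ (re x) (im x) (re y) (im y)
    where
    identity : ∀ d a b e f →
      a ℚ.* (a ℚ.* e ℚ.+ d ℚ.* (b ℚ.* f)) ℚ.+ d ℚ.* (b ℚ.* (a ℚ.* f ℚ.+ b ℚ.* e))
        ℚ.+ (a ℚ.* (a ℚ.* e ℚ.+ d ℚ.* (b ℚ.* f)) ℚ.+ d ℚ.* (b ℚ.* (a ℚ.* f ℚ.+ b ℚ.* e)))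
      ≡ (a ℚ.+ a) ℚ.* (a ℚ.* e ℚ.+ d ℚ.* (b ℚ.* f) ℚ.+ (a ℚ.* e ℚ.+ d ℚ.* (b ℚ.* f)))
        ℚ.+ ℚ.- ((a ℚ.* a ℚ.+ ℚ.- (d ℚ.* (b ℚ.* b))) ℚ.* (e ℚ.+ e))
    identity = ring-identity ℚ-ring

  -- The trace is x plus its conjugate, and the conjugate of x can be moved to the conjugated
  -- argument w.
  T*pairing : ∀ x y w → T x ℚ.* pairing y w ≡ pairing (x ⊗ y) w ℚ.+ pairing y (x ⊗ w)
  T*pairing x y w = identity dℚ (re x) (im x) (re y) (im y) (re w) (im w)
    where
    identity : ∀ d a b e f g h →
      (a ℚ.+ a) ℚ.* (e ℚ.* g ℚ.+ ℚ.- (d ℚ.* (f ℚ.* h)))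
      ≡ (a ℚ.* e ℚ.+ d ℚ.* (b ℚ.* f)) ℚ.* g ℚ.+ ℚ.- (d ℚ.* ((a ℚ.* f ℚ.+ b ℚ.* e) ℚ.* h))
        ℚ.+ (e ℚ.* (a ℚ.* g ℚ.+ d ℚ.* (b ℚ.* h)) ℚ.+ ℚ.- (d ℚ.* (f ℚ.* (a ℚ.* h ℚ.+ b ℚ.* g))))
    identity = ring-identity ℚ-ring

  N-^K : ∀ x n → N (x ^K n) ≡ N x ^ℚ n
  N-^K x zero    = N-1#
  N-^K x (suc n) = trans (N-⊗ x (x ^K n)) (cong (N x ℚ.*_) (N-^K x n))

  -- Membership in D⁻¹ ℤ[√d], a lattice with a fixed denominator.
  IntegralAfter : ℕ → K → Set
  IntegralAfter D y = Integer (ι (+ D) ℚ.* re y) × Integer (ι (+ D) ℚ.* im y)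

  private
    Integer-scale : ∀ m D q → Integer (ι (+ D) ℚ.* q) → Integer (ι (+ (m * D)) ℚ.* q)
    Integer-scale m D q int = subst Integer (trans (sym (ℚ.*-assoc (ι (+ m)) (ι (+ D)) q))
      (cong (ℚ._* q) (trans (sym (ι-* (+ m) (+ D))) (cong ι (sym (ℤ.pos-* m D))))))
      (Integer-* {ι (+ m)} (+ m , refl) int)

    D[a+b] : ∀ D a b → D ℚ.* a ℚ.+ D ℚ.* b ≡ D ℚ.* (a ℚ.+ b)
    D[a+b] = ring-identity ℚ-ring

    D[-a] : ∀ D a → ℚ.- (D ℚ.* a) ≡ D ℚ.* (ℚ.- a)
    D[-a] = ring-identity ℚ-ring

  IntegralAfter-scale : ∀ m D y → IntegralAfter D y → IntegralAfter (m * D) y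
  IntegralAfter-scale m D y (r , i) = Integer-scale m D (re y) r , Integer-scale m D (im y) i

  IntegralAfter-⊕ : ∀ D y w → IntegralAfter D y → IntegralAfter D w → IntegralAfter D (y ⊕ w)
  IntegralAfter-⊕ D y w (r , i) (r′ , i′) =
    subst Integer (D[a+b] (ι (+ D)) (re y) (re w)) (Integer-+ r r′) ,
    subst Integer (D[a+b] (ι (+ D)) (im y) (im w)) (Integer-+ i i′)

  IntegralAfter-⊝ : ∀ D y → IntegralAfter D y → IntegralAfter D (⊝ y)
  IntegralAfter-⊝ D y (r , i) =
    subst Integer (D[-a] (ι (+ D)) (re y)) (Integer-neg r) ,
    subst Integer (D[-a] (ι (+ D)) (im y)) (Integer-neg i)

  IntegralAfter-fromℤ : ∀ D c y → IntegralAfter D y → IntegralAfter D (fromℤ c ⊗ y)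
  IntegralAfter-fromℤ D c y (r , i) =
    subst Integer (identity₁ (ι (+ D)) (ι c) dℚ (re y) (im y)) (Integer-* {ι c} (c , refl) r) ,
    subst Integer (identity₂ (ι (+ D)) (ι c) (re y) (im y)) (Integer-* {ι c} (c , refl) i)
    where
    identity₁ : ∀ D c d a b → c ℚ.* (D ℚ.* a) ≡ D ℚ.* (c ℚ.* a ℚ.+ d ℚ.* (0ℚ ℚ.* b))
    identity₁ = ring-identity ℚ-ring
    identity₂ : ∀ D c a b → c ℚ.* (D ℚ.* b) ≡ D ℚ.* (c ℚ.* b ℚ.+ 0ℚ ℚ.* a)
    identity₂ = ring-identity ℚ-ring

  IntegralAfter-0# : ∀ D y → IntegralAfter D (0# ⊗ y)
  IntegralAfter-0# D y =
    (+ 0 , identity₁ (ι (+ D)) dℚ (re y) (im y)) , (+ 0 , identity₂ (ι (+ D)) (re y) (im y))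
    where
    identity₁ : ∀ D d a b → D ℚ.* (0ℚ ℚ.* a ℚ.+ d ℚ.* (0ℚ ℚ.* b)) ≡ 0ℚ
    identity₁ = ring-identity ℚ-ring
    identity₂ : ∀ D a b → D ℚ.* (0ℚ ℚ.* b ℚ.+ 0ℚ ℚ.* a) ≡ 0ℚ
    identity₂ = ring-identity ℚ-ring

  common-denominator : ∀ y → ∃[ D ] (NonZero D × IntegralAfter D y)
  common-denominator y = ↧ₙ re y * ↧ₙ im y , m*n≢0 (↧ₙ re y) (↧ₙ im y) {{↧ₙ-nonZero (re y)}} {{↧ₙ-nonZero (im y)}} ,
    subst (λ D → Integer (ι (+ D) ℚ.* re y)) (*-comm (↧ₙ im y) (↧ₙ re y))
      (Integer-scale (↧ₙ im y) (↧ₙ re y) (re y) (↥ re y , denominator-clears (re y))) ,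
    Integer-scale (↧ₙ re y) (↧ₙ im y) (im y) (↥ im y , denominator-clears (im y))
    where
    ↧ₙ-nonZero : ∀ q → NonZero (↧ₙ q)
    ↧ₙ-nonZero (mkℚ _ _ _) = _

  common-denominator-of-powers : ∀ x k → ∃[ D ] (NonZero D × (∀ {i} → i < k → IntegralAfter D (x ^K i)))
  common-denominator-of-powers x zero = 1 , _ , λ ()
  common-denominator-of-powers x (suc k) =
    extend (common-denominator-of-powers x k) (common-denominator (x ^K k))
    where
    extend : ∃[ D ] (NonZero D × (∀ {i} → i < k → IntegralAfter D (x ^K i))) →
             ∃[ E ] (NonZero E × IntegralAfter E (x ^K k)) →
             ∃[ D ] (NonZero D × (∀ {i} → i < suc k → IntegralAfter D (x ^K i)))
    extend (D , D≢0 , int) (E , E≢0 , int′) = E * D , m*n≢0 E D {{E≢0}} {{D≢0}} , all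
      where
      all : ∀ {i} → i < suc k → IntegralAfter (E * D) (x ^K i)
      all {i} i<k+1 with i ≟ k
      ... | yes refl = subst (λ m → IntegralAfter m (x ^K k)) (*-comm D E) (IntegralAfter-scale D E (x ^K k) int′)
      ... | no i≢k = IntegralAfter-scale E D (x ^K i) (int (≤∧≢⇒< (s≤s⁻¹ i<k+1) i≢k))

  -- In Horner form, subtracting c xⁿ from (c + x e) xⁿ leaves e xⁿ⁺¹, so the coefficients are
  -- removed one at a time until only the leading power is left.
  evalMonic-power : ∀ D x cs n → (∀ {i} → i < length cs → IntegralAfter D (x ^K (n + i))) →
    IntegralAfter D (evalMonic cs x ⊗ x ^K n) → IntegralAfter D (x ^K (n + length cs))
  evalMonic-power D x [] n _ int = subst (IntegralAfter D)
    (trans (1#⊗ (x ^K n)) (cong (x ^K_) (sym (+-identityʳ n)))) int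
    where
    identity₁ : ∀ d a b → 1ℚ ℚ.* a ℚ.+ d ℚ.* (0ℚ ℚ.* b) ≡ a
    identity₁ = ring-identity ℚ-ring
    identity₂ : ∀ a b → 1ℚ ℚ.* b ℚ.+ 0ℚ ℚ.* a ≡ b
    identity₂ = ring-identity ℚ-ring
    1#⊗ : ∀ y → 1# ⊗ y ≡ y
    1#⊗ y = cong₂ ⟨_,_⟩ (identity₁ dℚ (re y) (im y)) (identity₂ (re y) (im y))
  evalMonic-power D x (c ∷ cs) n lower int = subst (λ k → IntegralAfter D (x ^K k)) (sym (+-suc n (length cs)))
    (evalMonic-power D x cs (suc n)
      (λ {i} i< → subst (λ k → IntegralAfter D (x ^K k)) (+-suc n i) (lower (s≤s i<)))
      (subst (IntegralAfter D) (isolate (evalMonic cs x) (x ^K n))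
        (IntegralAfter-⊕ D _ (⊝ (fromℤ c ⊗ x ^K n)) int
          (IntegralAfter-⊝ D (fromℤ c ⊗ x ^K n) (IntegralAfter-fromℤ D c (x ^K n)
            (subst (λ k → IntegralAfter D (x ^K k)) (+-identityʳ n) (lower (s≤s z≤n))))))))
    where
    isolate : ∀ e y → ((fromℤ c ⊕ x ⊗ e) ⊗ y) ⊕ (⊝ (fromℤ c ⊗ y)) ≡ e ⊗ (x ⊗ y)
    isolate e y = cong₂ ⟨_,_⟩ (identity₁ dℚ (ι c) (re x) (im x) (re e) (im e) (re y) (im y))
                              (identity₂ dℚ (ι c) (re x) (im x) (re e) (im e) (re y) (im y))
      where
      identity₁ : ∀ d c a b e f g h →
        (c ℚ.+ (a ℚ.* e ℚ.+ d ℚ.* (b ℚ.* f))) ℚ.* g ℚ.+ d ℚ.* ((0ℚ ℚ.+ (a ℚ.* f ℚ.+ b ℚ.* e)) ℚ.* h)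
          ℚ.+ ℚ.- (c ℚ.* g ℚ.+ d ℚ.* (0ℚ ℚ.* h))
        ≡ e ℚ.* (a ℚ.* g ℚ.+ d ℚ.* (b ℚ.* h)) ℚ.+ d ℚ.* (f ℚ.* (a ℚ.* h ℚ.+ b ℚ.* g))
      identity₁ = ring-identity ℚ-ring
      identity₂ : ∀ d c a b e f g h →
        (c ℚ.+ (a ℚ.* e ℚ.+ d ℚ.* (b ℚ.* f))) ℚ.* h ℚ.+ (0ℚ ℚ.+ (a ℚ.* f ℚ.+ b ℚ.* e)) ℚ.* g
          ℚ.+ ℚ.- (c ℚ.* h ℚ.+ 0ℚ ℚ.* g)
        ≡ e ℚ.* (a ℚ.* h ℚ.+ b ℚ.* g) ℚ.+ f ℚ.* (a ℚ.* g ℚ.+ d ℚ.* (b ℚ.* h))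
      identity₂ = ring-identity ℚ-ring

  module _ {x : K} (integral : IsIntegral x) where
    private
      cs = proj₁ integral
      k  = length cs
      D  = proj₁ (common-denominator-of-powers x k)
      -- The pairing is bilinear, so clearing it for two elements of D⁻¹ ℤ[√d] takes two factors D.
      E  = + (D * D)

      powers : ∀ n → IntegralAfter D (x ^K n)
      powers = <-rec _ go
        where
        go : ∀ n → (∀ {m} → m < n → IntegralAfter D (x ^K m)) → IntegralAfter D (x ^K n)
        go n rec with n <? k
        ... | yes n<k = proj₂ (proj₂ (common-denominator-of-powers x k)) n<k
        -- The monic relation, multiplied by the power of x with exponent n - k, expresses xⁿ
        -- through the k preceding powers.
        ... | no n≮k = subst (λ m → IntegralAfter D (x ^K m)) n≡ (evalMonic-power D x cs (n ∸ k)
            (λ {i} i<k → rec {n ∸ k + i} (subst (n ∸ k + i <_) n≡ (+-monoʳ-< (n ∸ k) i<k)))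
            (subst (λ e → IntegralAfter D (e ⊗ x ^K (n ∸ k))) (sym (proj₂ integral)) (IntegralAfter-0# D (x ^K (n ∸ k)))))
          where
          n≡ : n ∸ k + k ≡ n
          n≡ = m∸n+n≡m (≮⇒≥ n≮k)

      E≢0 : E ≢ + 0
      E≢0 E≡0 = ≢-nonZero⁻¹ (D * D) {{m*n≢0 D D {{D≢0}} {{D≢0}}}} (ℤ.+-injective E≡0)
        where D≢0 = proj₁ (proj₂ (common-denominator-of-powers x k))

      pairing-integer : ∀ y w → IntegralAfter D y → IntegralAfter D w → Integer (ι E ℚ.* pairing y w)
      pairing-integer y w (r , i) (r′ , i′) = subst Integer
        (trans (identity (ι (+ D)) dℚ (re y) (im y) (re w) (im w))
          (cong (ℚ._* pairing y w) (trans (sym (ι-* (+ D) (+ D))) (cong ι (sym (ℤ.pos-* D D))))))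
        (Integer-+ (Integer-* r r′) (Integer-neg (Integer-* {dℚ} (+ d , refl) (Integer-* i i′))))
        where
        identity : ∀ D d a b e f →
          D ℚ.* a ℚ.* (D ℚ.* e) ℚ.+ ℚ.- (d ℚ.* (D ℚ.* b ℚ.* (D ℚ.* f)))
          ≡ D ℚ.* D ℚ.* (a ℚ.* e ℚ.+ ℚ.- (d ℚ.* (b ℚ.* f)))
        identity = ring-identity ℚ-ring

      -- Each factor T x raises one of the two exponents i and j, so the induction has to run over
      -- all pairs. The case i = j = 0 is the one wanted, because the pairing of 1 with itself is 1.
      T-powers : ∀ n i j → Integer (ι E ℚ.* (T x ^ℚ n ℚ.* pairing (x ^K i) (x ^K j)))
      T-powers zero i j = subst (λ p → Integer (ι E ℚ.* p)) (sym (ℚ.*-identityˡ (pairing (x ^K i) (x ^K j))))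
        (pairing-integer (x ^K i) (x ^K j) (powers i) (powers j))
      T-powers (suc n) i j = subst Integer (begin
        ι E ℚ.* (t ℚ.* pairing (x ^K suc i) (x ^K j)) ℚ.+ ι E ℚ.* (t ℚ.* pairing (x ^K i) (x ^K suc j))
          ≡⟨ identity₁ (ι E) t _ _ ⟩
        ι E ℚ.* (t ℚ.* (pairing (x ^K suc i) (x ^K j) ℚ.+ pairing (x ^K i) (x ^K suc j)))
          ≡⟨ cong (λ p → ι E ℚ.* (t ℚ.* p)) (T*pairing x (x ^K i) (x ^K j)) ⟨
        ι E ℚ.* (t ℚ.* (T x ℚ.* pairing (x ^K i) (x ^K j)))
          ≡⟨ identity₂ (ι E) t (T x) _ ⟩
        ι E ℚ.* (T x ℚ.* t ℚ.* pairing (x ^K i) (x ^K j)) ∎)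
        (Integer-+ (T-powers n (suc i) j) (T-powers n i (suc j)))
        where
        open ≡-Reasoning
        t = T x ^ℚ n
        identity₁ : ∀ e t a b → e ℚ.* (t ℚ.* a) ℚ.+ e ℚ.* (t ℚ.* b) ≡ e ℚ.* (t ℚ.* (a ℚ.+ b))
        identity₁ = ring-identity ℚ-ring
        identity₂ : ∀ e t s a → e ℚ.* (t ℚ.* (s ℚ.* a)) ≡ e ℚ.* (s ℚ.* t ℚ.* a)
        identity₂ = ring-identity ℚ-ring

    trace-integer : Integer (T x)
    trace-integer = powers-integer (T x) E E≢0 λ n → subst (λ p → Integer (ι E ℚ.* p))
      (trans (cong (T x ^ℚ n ℚ.*_) N-1#) (ℚ.*-identityʳ (T x ^ℚ n))) (T-powers n 0 0)

    norm-integer : Integer (N x)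
    norm-integer = powers-integer (N x) E E≢0 λ n → subst (λ p → Integer (ι E ℚ.* p)) (N-^K x n)
      (pairing-integer (x ^K n) (x ^K n) (powers n) (powers n))

-- Lehmer–Pierce sequences

primitive-of-W : ∀ (Δ : ℕ → ℤ) z {{_ : NonZero z}} → (∀ n → ℤ.∣ Δ n ∣ ≡ W n z) →
  ∀ n → 12 < n → HasPrimitivePrimeDivisor Δ n
primitive-of-W Δ z Δ≡ n 12<n with p , pp , p∣Wn , p∤W ← W-primitive z n 12<n =
  p , pp , subst (p ∣_) (sym (Δ≡ n)) p∣Wn , λ m 1≤m m<n _ p∣Δm → p∤W 1≤m m<n (subst (p ∣_) (Δ≡ m) p∣Δm)

4*-%4 : ∀ j → (j + j + (j + j)) % 4 ≡ 0
4*-%4 j = n∣m⇒m%n≡0 _ 4 (divides j (identity j))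
  where
  identity : ∀ j → j + j + (j + j) ≡ j * 4
  identity = solve-∀

4*+2-%4 : ∀ j → (j + suc j + (j + suc j)) % 4 ≡ 2
4*+2-%4 j = trans (cong (_% 4) (identity j)) ([m+kn]%n≡m%n 2 j 4)
  where
  identity : ∀ j → j + (1 + j) + (j + (1 + j)) ≡ 2 + j * 4
  identity = solve-∀

%4≡2⇒2∣ : ∀ n → n % 4 ≡ 2 → 2 ∣ n
%4≡2⇒2∣ n n%4≡2 = subst (2 ∣_) (sym (m≡m%n+[m/n]*n n 4))
  (∣m∣n⇒∣m+n (subst (2 ∣_) (sym n%4≡2) ∣-refl) (∣n⇒∣m*n (n / 4) (divides 2 refl)))

-- A norm −1 unit with trace t has Δ (2 k) = −W k (t²) and Δ n ² = W n (t²) for odd n.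
module MinusOne (Δ : ℕ → ℤ) (z : ℕ) {{z≢0 : NonZero z}}
  (even : ∀ k → ℤ.∣ Δ (k + k) ∣ ≡ W k z)
  (odd : ∀ k → ℤ.∣ Δ (k + suc k) ∣ * ℤ.∣ Δ (k + suc k) ∣ ≡ W (k + suc k) z) where

  private
    δ : ℕ → ℕ
    δ n = ℤ.∣ Δ n ∣

  ∣δ-odd⇒∣W : ∀ {p} k → p ∣ δ (k + suc k) → p ∣ W (k + suc k) z
  ∣δ-odd⇒∣W {p} k p∣δ = subst (p ∣_) (odd k) (∣m⇒∣m*n (δ (k + suc k)) p∣δ)

  ∣W⇒∣δ-odd : ∀ {p} → Prime p → ∀ k → p ∣ W (k + suc k) z → p ∣ δ (k + suc k)
  ∣W⇒∣δ-odd {p} pp k p∣W = ∣square⇒∣ pp (δ (k + suc k)) (subst (p ∣_) (sym (odd k)) p∣W)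

  -- Odd terms of Δ have the same prime divisors as the terms of W with the same index. An earlier
  -- even index 2 j carries W j, whose index is smaller still.
  primitive-odd : ∀ k → 12 < k + suc k → HasPrimitivePrimeDivisor Δ (k + suc k)
  primitive-odd k 12<n with p , pp , p∣Wn , p∤W ← W-primitive z (k + suc k) 12<n =
    p , pp , ∣W⇒∣δ-odd pp k p∣Wn , λ m 1≤m m<n _ → earlier m 1≤m m<n (even⊎odd m)
    where
    earlier : ∀ m → 1 ≤ m → m < k + suc k → (∃[ j ] m ≡ j + j) ⊎ (∃[ j ] m ≡ j + suc j) → p ∤ δ m
    earlier m 1≤m m<n (inj₂ (j , refl)) p∣δ = p∤W 1≤m m<n (∣δ-odd⇒∣W j p∣δ)
    earlier m 1≤m m<n (inj₁ (suc j , refl)) p∣δ =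
      p∤W (s≤s z≤n) (≤-<-trans (m≤m+n (suc j) (suc j)) m<n) (subst (p ∣_) (even (suc j)) p∣δ)

  primitive-4* : ∀ j → 12 < j + j → HasPrimitivePrimeDivisor Δ (j + j + (j + j))
  primitive-4* j 12<k with p , pp , p∣Wk , p∤W ← W-primitive z (j + j) 12<k =
    p , pp , subst (p ∣_) (sym (even (j + j))) p∣Wk , λ m 1≤m m<n _ → earlier m 1≤m m<n (even⊎odd m)
    where
    k = j + j

    -- k is the rank of p, and it is even.
    p∤W-odd : ∀ i → p ∤ W (i + suc i) z
    p∤W-odd i p∣W = go (rank-exists pp z k (≤-trans (s≤s z≤n) 12<k) p∣Wk)
      where
      go : ∃[ r ] Rank p z r → ⊥
      go (r , rank) with m≤n⇒m<n∨m≡n (∣⇒≤ {{>-nonZero (≤-trans (s≤s z≤n) 12<k)}} (Rank.minimal rank p∣Wk))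
      ... | inj₁ r<k  = p∤W (Rank.positive rank) r<k (Rank.divides-W rank)
      ... | inj₂ r≡k = 2∤odd i (∣-trans (subst (2 ∣_) (sym (trans r≡k (k+k≡2*k j))) (m∣m*n j)) (Rank.minimal rank p∣W))

    earlier : ∀ m → 1 ≤ m → m < k + k → (∃[ j ] m ≡ j + j) ⊎ (∃[ j ] m ≡ j + suc j) → p ∤ δ m
    earlier m 1≤m m<n (inj₂ (i , refl)) p∣δ = p∤W-odd i (∣δ-odd⇒∣W i p∣δ)
    earlier m 1≤m m<n (inj₁ (suc i , refl)) p∣δ = p∤W (s≤s z≤n)
      (≰⇒> λ k≤ → <⇒≱ m<n (+-mono-≤ k≤ k≤)) (subst (p ∣_) (even (suc i)) p∣δ)

  -- For odd k the absolute value of Δ (2 k) is W k = (Δ k)², so every prime dividing Δ (2 k)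
  -- already divides Δ k, which is nonzero.
  imprimitive-4*+2 : ∀ j → ¬ HasPrimitivePrimeDivisor Δ (j + suc j + (j + suc j))
  imprimitive-4*+2 j (p , pp , p∣δ , none) = none k 1≤k (m<m+n k 1≤k) Δk≢0
    (∣W⇒∣δ-odd pp j (subst (p ∣_) (even k) p∣δ))
    where
    k = j + suc j
    1≤k : 1 ≤ k
    1≤k = ≤-trans (s≤s z≤n) (m≤n+m (suc j) j)
    Δk≢0 : Δ k ≢ + 0
    Δk≢0 Δk≡0 = ≢-nonZero⁻¹ (W k z) {{W-nonZero′}}
      (trans (sym (odd j)) (cong (λ x → ℤ.∣ x ∣ * ℤ.∣ x ∣) Δk≡0))
      where
      W-nonZero′ : NonZero (W k z)
      W-nonZero′ = W-nonZero k z {{>-nonZero 1≤k}}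

  characterisation : ∀ n → 24 < n → (¬ HasPrimitivePrimeDivisor Δ n) ⇔ (n % 4 ≡ 2)
  characterisation n 24<n = by-parity (even⊎odd n)
    where
    Goal = (¬ HasPrimitivePrimeDivisor Δ n) ⇔ (n % 4 ≡ 2)

    -- An even index 2 k refers to W k, so n > 24 is exactly what brings k beyond 12.
    halve : ∀ {k} → n ≡ k + k → 12 < k
    halve {k} n≡ = ≰⇒> λ k≤12 → <⇒≱ 24<n (subst (_≤ 24) (sym n≡) (+-mono-≤ k≤12 k≤12))

    by-half : ∀ k → n ≡ k + k → (∃[ j ] k ≡ j + j) ⊎ (∃[ j ] k ≡ j + suc j) → Goal
    by-half k n≡ (inj₁ (j , refl)) = mk⇔
      (λ ¬has → contradiction (subst (HasPrimitivePrimeDivisor Δ) (sym n≡) (primitive-4* j (halve n≡))) ¬has)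
      (λ n%4≡2 → contradiction (trans (sym n%4≡2) (trans (cong (_% 4) n≡) (4*-%4 j))) λ ())
    by-half k n≡ (inj₂ (j , refl)) = mk⇔
      (λ _ → trans (cong (_% 4) n≡) (4*+2-%4 j))
      (λ _ → subst (λ n → ¬ HasPrimitivePrimeDivisor Δ n) (sym n≡) (imprimitive-4*+2 j))

    by-parity : (∃[ k ] n ≡ k + k) ⊎ (∃[ k ] n ≡ k + suc k) → Goal
    by-parity (inj₁ (k , n≡)) = by-half k n≡ (even⊎odd k)
    by-parity (inj₂ (k , n≡)) = mk⇔
      (λ ¬has → contradiction (subst (HasPrimitivePrimeDivisor Δ) (sym n≡)
        (primitive-odd k (subst (12 <_) n≡ (≤-trans (m≤m+n 13 12) 24<n)))) ¬has)
      (λ n%4≡2 → contradiction (subst (2 ∣_) n≡ (%4≡2⇒2∣ n n%4≡2)) (2∤odd k))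

-- Traces of powers of an element of trace t and norm ν

lucas : ℤ → ℤ → ℕ → ℤ
lucas t ν zero          = + 2
lucas t ν (suc zero)    = t
lucas t ν (suc (suc n)) = t ℤ.* lucas t ν (suc n) ℤ.+ ℤ.- (ν ℤ.* lucas t ν n)

lucas-one : ∀ z n → lucas (+ (z + 2)) (+ 1) n ≡ + V n z × lucas (+ (z + 2)) (+ 1) (suc n) ≡ + V (suc n) z
lucas-one z zero = refl , cong (λ i → + (i + 2)) (sym (*-identityʳ z))
lucas-one z (suc n) with ih₀ , ih₁ ← lucas-one z n = ih₁ , (begin
  + (z + 2) ℤ.* lucas (+ (z + 2)) (+ 1) (suc n) ℤ.+ ℤ.- (+ 1 ℤ.* lucas (+ (z + 2)) (+ 1) n)
    ≡⟨ cong₂ (λ a b → + (z + 2) ℤ.* a ℤ.+ ℤ.- (+ 1 ℤ.* b)) ih₁ ih₀ ⟩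
  + (z + 2) ℤ.* + V (suc n) z ℤ.+ ℤ.- (+ 1 ℤ.* + V n z)
    ≡⟨ cong₂ (λ a b → a ℤ.+ ℤ.- b) recurrence (ℤ.*-identityˡ (+ V n z)) ⟩
  + V (2 + n) z ℤ.+ + V n z ℤ.+ ℤ.- + V n z
    ≡⟨ cancel (+ V (2 + n) z) (+ V n z) ⟩
  + V (2 + n) z ∎)
  where
  open ≡-Reasoning
  recurrence : + (z + 2) ℤ.* + V (suc n) z ≡ + V (2 + n) z ℤ.+ + V n z
  recurrence = trans (sym (ℤ.pos-* (z + 2) (V (suc n) z))) (cong +_ (sym (V-two-step n z)))
  cancel : ∀ a b → a ℤ.+ b ℤ.+ ℤ.- b ≡ a
  cancel = ℤ-identity

-- The conjugate of α is - α⁻¹ and z = t² belongs to the unit α². The odd case is the telescoping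
-- identity α^(2k+1) - α^(-2k-1) = (α - α⁻¹) (1 + Σ (α^(2j) + α^(-2j))), summed over 1 ≤ j ≤ k.
lucas-minus-one : ∀ t z → t ℤ.* t ≡ + z → ∀ k →
  lucas t (ℤ.- + 1) (k + k) ≡ + V k z × lucas t (ℤ.- + 1) (suc (k + k)) ≡ t ℤ.* + S k z
lucas-minus-one t z tt≡z zero = refl , sym (ℤ.*-identityʳ t)
lucas-minus-one t z tt≡z (suc k) with ih₀ , ih₁ ← lucas-minus-one t z tt≡z k =
  trans (cong (lucas t (ℤ.- + 1)) (cong suc (+-suc k k))) even ,
  trans (cong (λ i → lucas t (ℤ.- + 1) (2 + i)) (+-suc k k)) (begin
    t ℤ.* ℓ (2 + (k + k)) ℤ.+ ℤ.- (ℤ.- + 1 ℤ.* ℓ (1 + (k + k)))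
      ≡⟨ cong₂ (λ a b → t ℤ.* a ℤ.+ ℤ.- (ℤ.- + 1 ℤ.* b)) even ih₁ ⟩
    t ℤ.* + V (suc k) z ℤ.+ ℤ.- (ℤ.- + 1 ℤ.* (t ℤ.* + S k z))
      ≡⟨ identity₂ t (+ V (suc k) z) (+ S k z) ⟩
    t ℤ.* (+ S k z ℤ.+ + V (suc k) z)
      ≡⟨⟩
    t ℤ.* + S (suc k) z ∎)
  where
  open ≡-Reasoning
  ℓ = lucas t (ℤ.- + 1)
  identity₁ : ∀ t s v → t ℤ.* (t ℤ.* s) ℤ.+ ℤ.- (ℤ.- + 1 ℤ.* v) ≡ t ℤ.* t ℤ.* s ℤ.+ v
  identity₁ = ℤ-identity
  identity₂ : ∀ t v s → t ℤ.* v ℤ.+ ℤ.- (ℤ.- + 1 ℤ.* (t ℤ.* s)) ≡ t ℤ.* (s ℤ.+ v)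
  identity₂ = ℤ-identity
  regroup : ∀ w y → y + (w + 2) ≡ w + y + 2
  regroup = solve-∀
  even : ℓ (2 + (k + k)) ≡ + V (suc k) z
  even = begin
    t ℤ.* ℓ (1 + (k + k)) ℤ.+ ℤ.- (ℤ.- + 1 ℤ.* ℓ (k + k))
      ≡⟨ cong₂ (λ a b → t ℤ.* a ℤ.+ ℤ.- (ℤ.- + 1 ℤ.* b)) ih₁ ih₀ ⟩
    t ℤ.* (t ℤ.* + S k z) ℤ.+ ℤ.- (ℤ.- + 1 ℤ.* + V k z)
      ≡⟨ identity₁ t (+ S k z) (+ V k z) ⟩
    t ℤ.* t ℤ.* + S k z ℤ.+ + V k z
      ≡⟨ cong (λ x → x ℤ.* + S k z ℤ.+ + V k z) tt≡z ⟩
    + z ℤ.* + S k z ℤ.+ + V k z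
      ≡⟨ cong (λ x → x ℤ.+ + V k z) (sym (ℤ.pos-* z (S k z))) ⟩
    + (z * S k z + V k z)
      ≡⟨ cong (λ n → + n) (regroup (W k z) (z * S k z)) ⟩
    + V (suc k) z ∎

-- Bounds on the trace of a unit of norm 1 or -1

0≤p*p : ∀ p → 0ℚ ℚ.≤ p ℚ.* p
0≤p*p p with ℚ.≤-total 0ℚ p
... | inj₁ 0≤p = subst (ℚ._≤ p ℚ.* p) (ℚ.*-zeroʳ p) (ℚ.*-monoˡ-≤-nonNeg p {{ℚ.nonNegative 0≤p}} 0≤p)
... | inj₂ p≤0 = subst (ℚ._≤ p ℚ.* p) (ℚ.*-zeroʳ p) (ℚ.*-monoˡ-≤-nonPos p {{ℚ.nonPositive p≤0}} p≤0)

0<ι⇒positive : ∀ t → 0ℚ ℚ.< ι t → ∃[ n ] t ≡ + suc n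
0<ι⇒positive t 0<ιt with subst (0ℚ ℚ.<_) (ι≡mkℚ t) 0<ιt
0<ι⇒positive (+ zero)    _ | ℚ.*<* (ℤ.+<+ ())
0<ι⇒positive (+ suc n)   _ | _ = n , refl
0<ι⇒positive ℤ.-[1+ n ]  _ | ℚ.*<* ()

halve-≡ : ∀ a → a ≡ ℚ.½ ℚ.* (a ℚ.+ a)
halve-≡ a = sym (trans (ℚ.*-distribˡ-+ ℚ.½ a a) (trans (sym (ℚ.*-distribʳ-+ a ℚ.½ ℚ.½)) (ℚ.*-identityˡ a)))

clear-denominator : ∀ d b →
  ι (+ d ℤ.* (↥ b ℤ.* ↥ b)) ≡ ι (+ d) ℚ.* (b ℚ.* b) ℚ.* (ι (+ ↧ₙ b) ℚ.* ι (+ ↧ₙ b))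
clear-denominator d b = begin
  ι (+ d ℤ.* (p ℤ.* p))                                   ≡⟨ trans (ι-* (+ d) (p ℤ.* p)) (cong (ι (+ d) ℚ.*_) (ι-* p p)) ⟩
  ι (+ d) ℚ.* (ι p ℚ.* ι p)                               ≡⟨ cong (λ x → ι (+ d) ℚ.* (x ℚ.* x)) (denominator-clears b) ⟨
  ι (+ d) ℚ.* (q ℚ.* b ℚ.* (q ℚ.* b))                     ≡⟨ identity (ι (+ d)) q b ⟩
  ι (+ d) ℚ.* (b ℚ.* b) ℚ.* (q ℚ.* q)                     ∎
  where
  open ≡-Reasoning
  p = ↥ b
  q = ι (+ ↧ₙ b)
  identity : ∀ d q b → d ℚ.* (q ℚ.* b ℚ.* (q ℚ.* b)) ≡ d ℚ.* (b ℚ.* b) ℚ.* (q ℚ.* q)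
  identity = ring-identity ℚ-ring

db²≡0⇒b≡0 : ∀ d .{{_ : NonZero d}} b → ι (+ d) ℚ.* (b ℚ.* b) ≡ 0ℚ → b ≡ 0ℚ
db²≡0⇒b≡0 d b db²≡0 = ℚ.↥p≡0⇒p≡0 b (ℤ.∣i∣≡0⇒i≡0 (reduce (m*n≡0⇒m≡0∨n≡0 ∣p∣ p²≡0)))
  where
  ∣p∣ = ℤ.∣ ↥ b ∣

  dp²≡0 : d * (∣p∣ * ∣p∣) ≡ 0
  dp²≡0 = trans (cong (d *_) (sym (ℤ.abs-* (↥ b) (↥ b)))) (trans (sym (ℤ.abs-* (+ d) (↥ b ℤ.* ↥ b)))
    (cong ℤ.∣_∣ (ι-injective {+ d ℤ.* (↥ b ℤ.* ↥ b)} {+ 0} (trans (clear-denominator d b)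
      (trans (cong (ℚ._* (ι (+ ↧ₙ b) ℚ.* ι (+ ↧ₙ b))) db²≡0) (ℚ.*-zeroˡ (ι (+ ↧ₙ b) ℚ.* ι (+ ↧ₙ b))))))))

  p²≡0 : ∣p∣ * ∣p∣ ≡ 0
  p²≡0 = *-cancelˡ-≡ _ 0 d (trans dp²≡0 (sym (*-zeroʳ d)))

-- In lowest terms b = p / q the equation reads d p² = q², so p = ±1 and d = q². It is the case of
-- trace 0 and norm -1 that has to be excluded.
squarefree⇒no-sqrt : ∀ d → 1 < d → Squarefree d → ∀ b → ι (+ d) ℚ.* (b ℚ.* b) ≢ 1ℚ
squarefree⇒no-sqrt d 1<d squarefree b@(mkℚ p q-1 coprime) db²≡1 = <-irrefl (sym d≡1) 1<d
  where
  q = suc q-1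
  ∣p∣ = ℤ.∣ p ∣

  coprime′ : Coprime ∣p∣ q
  coprime′ = Coprimality.recompute coprime

  ιdp²≡ιq² : ι (+ d ℤ.* (p ℤ.* p)) ≡ ι (+ q ℤ.* + q)
  ιdp²≡ιq² = trans (clear-denominator d b) (trans (cong (ℚ._* (ι (+ q) ℚ.* ι (+ q))) db²≡1)
    (trans (ℚ.*-identityˡ _) (sym (ι-* (+ q) (+ q)))))

  dp²≡q² : d * (∣p∣ * ∣p∣) ≡ q * q
  dp²≡q² = trans (cong (d *_) (sym (ℤ.abs-* p p))) (trans (sym (ℤ.abs-* (+ d) (p ℤ.* p)))
    (trans (cong ℤ.∣_∣ (ι-injective {+ d ℤ.* (p ℤ.* p)} {+ q ℤ.* + q} ιdp²≡ιq²)) (ℤ.abs-* (+ q) (+ q))))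

  p≡1 : ∣p∣ ≡ 1
  p≡1 = coprime′ (∣-refl , coprime-divisor coprime′ (subst (∣p∣ ∣_) dp²≡q² (∣n⇒∣m*n d (m∣m*n ∣p∣))))

  d≡q² : d ≡ q * q
  d≡q² = trans (sym (*-identityʳ d)) (trans (cong (λ x → d * (x * x)) (sym p≡1)) dp²≡q²)

  d≡1 : d ≡ 1
  d≡1 = trans d≡q² (cong (λ x → x * x) (squarefree q (∣-reflexive (sym d≡q²))))

module Traces (F : RealQuadraticField) where
  open RealQuadraticField F using (d; 1<d; squarefree)
  open QuadraticField F renaming (_+_ to _⊕_; _*_ to _⊗_; -_ to ⊝_; _-_ to _⊖_; _^_ to _^K_)
  open Integrality F

  private
    im² : K → ℚ
    im² x = dℚ ℚ.* (im x ℚ.* im x)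

    0≤im² : ∀ x → 0ℚ ℚ.≤ im² x
    0≤im² x = subst (ℚ._≤ im² x) (ℚ.*-zeroʳ dℚ)
      (ℚ.*-monoˡ-≤-nonNeg dℚ {{ℚ.normalize-nonNeg d 1}} (0≤p*p (im x)))

    re²≡ : ∀ x → re x ℚ.* re x ≡ N x ℚ.+ im² x
    re²≡ x = identity (re x ℚ.* re x) (im² x)
      where
      identity : ∀ a x → a ≡ a ℚ.+ ℚ.- x ℚ.+ x
      identity = ring-identity ℚ-ring

    x<1+x : ∀ x → x ℚ.< 1ℚ ℚ.+ x
    x<1+x x = subst (ℚ._< 1ℚ ℚ.+ x) (ℚ.+-identityˡ x) (ℚ.+-monoˡ-< x (from-yes (0ℚ ℚ.<? 1ℚ)))

  -- If a ≤ 0 < a + b r with r² ≤ d, then a² ≤ (b r)² ≤ d b².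
  positive⇒0<re : ∀ x → N x ≡ 1ℚ → Positive x → 0ℚ ℚ.< re x
  positive⇒0<re x Nx≡1 (r , _ , (0≤r , r²<d) , _ , 0<a+br , _) = ℚ.≰⇒> λ a≤0 →
    ℚ.<-irrefl refl (ℚ.<-≤-trans (x<1+x (im² x)) (1+im²≤im² a≤0))
    where
    a = re x
    b = im x
    u = b ℚ.* r

    module _ (a≤0 : a ℚ.≤ 0ℚ) where
      c = ℚ.- a

      0≤c : 0ℚ ℚ.≤ c
      0≤c = ℚ.neg-antimono-≤ a≤0

      c≤u : c ℚ.≤ u
      c≤u = subst₂ ℚ._≤_ (ℚ.+-identityʳ c) (cancel a u) (ℚ.+-monoʳ-≤ c (ℚ.<⇒≤ 0<a+br))
        where
        cancel : ∀ a u → ℚ.- a ℚ.+ (a ℚ.+ u) ≡ u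
        cancel = ring-identity ℚ-ring

      1+im²≤im² : 1ℚ ℚ.+ im² x ℚ.≤ im² x
      1+im²≤im² = begin
        1ℚ ℚ.+ im² x               ≡⟨ cong (ℚ._+ im² x) Nx≡1 ⟨
        N x ℚ.+ im² x              ≡⟨ re²≡ x ⟨
        a ℚ.* a                    ≡⟨ negate a ⟩
        c ℚ.* c                    ≤⟨ ℚ.*-monoˡ-≤-nonNeg c {{ℚ.nonNegative 0≤c}} c≤u ⟩
        c ℚ.* u                    ≤⟨ ℚ.*-monoʳ-≤-nonNeg u {{ℚ.nonNegative (ℚ.≤-trans 0≤c c≤u)}} c≤u ⟩
        u ℚ.* u                    ≡⟨ regroup b r ⟩
        b ℚ.* b ℚ.* (r ℚ.* r)      ≤⟨ ℚ.*-monoˡ-≤-nonNeg (b ℚ.* b) {{ℚ.nonNegative (0≤p*p b)}} (ℚ.<⇒≤ r²<d) ⟩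
        b ℚ.* b ℚ.* dℚ             ≡⟨ ℚ.*-comm (b ℚ.* b) dℚ ⟩
        im² x                      ∎
        where
        open ℚ.≤-Reasoning
        negate : ∀ a → a ℚ.* a ≡ ℚ.- a ℚ.* ℚ.- a
        negate = ring-identity ℚ-ring
        regroup : ∀ b r → b ℚ.* r ℚ.* (b ℚ.* r) ≡ b ℚ.* b ℚ.* (r ℚ.* r)
        regroup = ring-identity ℚ-ring

  T²≡ : ∀ x → T x ℚ.* T x ≡ N x ℚ.+ N x ℚ.+ N x ℚ.+ N x ℚ.+ (im² x ℚ.+ im² x ℚ.+ im² x ℚ.+ im² x)
  T²≡ x = trans (double (re x)) (trans (cong (λ y → y ℚ.+ y ℚ.+ y ℚ.+ y) (re²≡ x)) (interleave (N x) (im² x)))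
    where
    double : ∀ a → (a ℚ.+ a) ℚ.* (a ℚ.+ a) ≡ a ℚ.* a ℚ.+ a ℚ.* a ℚ.+ a ℚ.* a ℚ.+ a ℚ.* a
    double = ring-identity ℚ-ring
    interleave : ∀ n y → (n ℚ.+ y) ℚ.+ (n ℚ.+ y) ℚ.+ (n ℚ.+ y) ℚ.+ (n ℚ.+ y)
                       ≡ n ℚ.+ n ℚ.+ n ℚ.+ n ℚ.+ (y ℚ.+ y ℚ.+ y ℚ.+ y)
    interleave = ring-identity ℚ-ring

  -- Positivity of x gives t > 0, and t² = 4 + 4 d b² ≥ 4 then gives t ≥ 2. In the case t = 2 one
  -- gets b = 0 and x = 1.
  trace≥3 : ∀ x t → T x ≡ ι t → N x ≡ 1ℚ → x ≢ 1# → Positive x →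
            ∃[ z ] (NonZero z × t ≡ + (z + 2))
  trace≥3 x t T≡ Nx≡1 x≢1 x>0 = go (0<ι⇒positive t (subst (0ℚ ℚ.<_) T≡ 0<T))
    where
    0<re : 0ℚ ℚ.< re x
    0<re = positive⇒0<re x Nx≡1 x>0

    0<T : 0ℚ ℚ.< T x
    0<T = ℚ.+-mono-< 0<re 0<re

    4im² : ℚ
    4im² = im² x ℚ.+ im² x ℚ.+ im² x ℚ.+ im² x

    0≤4im² : 0ℚ ℚ.≤ 4im²
    0≤4im² = ℚ.+-mono-≤ (ℚ.+-mono-≤ (ℚ.+-mono-≤ (0≤im² x) (0≤im² x)) (0≤im² x)) (0≤im² x)

    ι²≡ : ι t ℚ.* ι t ≡ ι (+ 4) ℚ.+ 4im²
    ι²≡ = trans (cong (λ y → y ℚ.* y) (sym T≡)) (trans (T²≡ x) (cong (λ n → n ℚ.+ n ℚ.+ n ℚ.+ n ℚ.+ 4im²) Nx≡1))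

    4≤ι² : ι (+ 4) ℚ.≤ ι t ℚ.* ι t
    4≤ι² = subst (ι (+ 4) ℚ.≤_) (sym ι²≡) (subst (ℚ._≤ ι (+ 4) ℚ.+ 4im²) (ℚ.+-identityʳ (ι (+ 4))) (ℚ.+-monoʳ-≤ (ι (+ 4)) 0≤4im²))

    t≢2 : t ≢ + 2
    t≢2 refl = x≢1 (cong₂ ⟨_,_⟩ re≡1 im≡0)
      where
      re≡1 : re x ≡ 1ℚ
      re≡1 = trans (halve-≡ (re x)) (cong (ℚ.½ ℚ.*_) T≡)
      im²≡0 : im² x ≡ 0ℚ
      im²≡0 = trans (identity (re x ℚ.* re x) (im² x)) (cong₂ (λ a n → a ℚ.* a ℚ.+ ℚ.- n) re≡1 Nx≡1)
        where
        identity : ∀ a y → y ≡ a ℚ.+ ℚ.- (a ℚ.+ ℚ.- y)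
        identity = ring-identity ℚ-ring
      im≡0 : im x ≡ 0ℚ
      im≡0 = db²≡0⇒b≡0 d {{>-nonZero (<-trans (n<1+n 0) 1<d)}} (im x) im²≡0

    go : ∃[ n ] t ≡ + suc n → ∃[ z ] (NonZero z × t ≡ + (z + 2))
    go (0 , refl) = contradiction 4≤ι² (from-no (ι (+ 4) ℚ.≤? 1ℚ))
    go (1 , t≡2) = contradiction t≡2 t≢2
    go (suc (suc n) , t≡) = suc n , _ , trans t≡ (cong (λ k → + suc k) (sym (+-comm n 2)))

  trace≢0 : ∀ x t → T x ≡ ι t → N x ≡ ℚ.- 1ℚ → t ≢ + 0
  trace≢0 x t T≡ Nx≡-1 refl = squarefree⇒no-sqrt d 1<d squarefree (im x) (begin
    im² x                     ≡⟨ identity (re x ℚ.* re x) (im² x) ⟩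
    re x ℚ.* re x ℚ.+ ℚ.- N x ≡⟨ cong₂ (λ a n → a ℚ.* a ℚ.+ ℚ.- n) (trans (halve-≡ (re x)) (cong (ℚ.½ ℚ.*_) T≡)) Nx≡-1 ⟩
    1ℚ                        ∎)
    where
    open ≡-Reasoning
    identity : ∀ a y → y ≡ a ℚ.+ ℚ.- (a ℚ.+ ℚ.- y)
    identity = ring-identity ℚ-ring

-- Absolute values of the Lehmer-Pierce terms

i*i≡+ : ∀ i → i ℤ.* i ≡ + (ℤ.∣ i ∣ * ℤ.∣ i ∣)
i*i≡+ (+ n)       = sym (ℤ.pos-* n n)
i*i≡+ ℤ.-[1+ n ]  = refl

[-1]^2k : ∀ k → (ℤ.- + 1) ℤ.^ (k + k) ≡ + 1
[-1]^2k zero    = refl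
[-1]^2k (suc k) = trans (cong (λ i → ℤ.- + 1 ℤ.* (ℤ.- + 1) ℤ.^ i) (+-suc k k))
  (cong (λ x → ℤ.- + 1 ℤ.* (ℤ.- + 1 ℤ.* x)) ([-1]^2k k))

[-1]^[2k+1] : ∀ k → (ℤ.- + 1) ℤ.^ (k + suc k) ≡ ℤ.- + 1
[-1]^[2k+1] k = trans (cong ((ℤ.- + 1) ℤ.^_) (+-suc k k)) (cong (ℤ.- + 1 ℤ.*_) ([-1]^2k k))

-- The norm of y - 1 is N y - T y + 1, taken at y = αⁿ.
lehmer-pierce : ℤ → ℤ → ℕ → ℤ
lehmer-pierce t ν n = ν ℤ.^ n ℤ.+ ℤ.- lucas t ν n ℤ.+ + 1

private
  1-[w+2]+1 : ∀ w → + 1 ℤ.+ ℤ.- (w ℤ.+ + 2) ℤ.+ + 1 ≡ ℤ.- w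
  1-[w+2]+1 = ℤ-identity

  -1-x+1 : ∀ x → ℤ.- + 1 ℤ.+ ℤ.- x ℤ.+ + 1 ≡ ℤ.- x
  -1-x+1 = ℤ-identity

∣lehmer-pierce-one∣ : ∀ z n → ℤ.∣ lehmer-pierce (+ (z + 2)) (+ 1) n ∣ ≡ W n z
∣lehmer-pierce-one∣ z n = trans (cong ℤ.∣_∣ (trans
  (cong₂ (λ a b → a ℤ.+ ℤ.- b ℤ.+ + 1) (ℤ.^-zeroˡ n) (proj₁ (lucas-one z n))) (1-[w+2]+1 (+ W n z))))
  (ℤ.∣-i∣≡∣i∣ (+ W n z))

module _ (t : ℤ) where
  private
    z = ℤ.∣ t ∣ * ℤ.∣ t ∣

  ∣lehmer-pierce-even∣ : ∀ k → ℤ.∣ lehmer-pierce t (ℤ.- + 1) (k + k) ∣ ≡ W k z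
  ∣lehmer-pierce-even∣ k = trans (cong ℤ.∣_∣ (trans
    (cong₂ (λ a b → a ℤ.+ ℤ.- b ℤ.+ + 1) ([-1]^2k k) (proj₁ (lucas-minus-one t z (i*i≡+ t) k)))
    (1-[w+2]+1 (+ W k z)))) (ℤ.∣-i∣≡∣i∣ (+ W k z))

  ∣lehmer-pierce-odd∣ : ∀ k → ℤ.∣ lehmer-pierce t (ℤ.- + 1) (k + suc k) ∣ ≡ ℤ.∣ t ∣ * S k z
  ∣lehmer-pierce-odd∣ k = trans (cong ℤ.∣_∣ (trans
    (cong₂ (λ a b → a ℤ.+ ℤ.- b ℤ.+ + 1) ([-1]^[2k+1] k)
      (trans (cong (lucas t (ℤ.- + 1)) (+-suc k k)) (proj₂ (lucas-minus-one t z (i*i≡+ t) k))))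
    (-1-x+1 (t ℤ.* + S k z)))) (trans (ℤ.∣-i∣≡∣i∣ (t ℤ.* + S k z)) (ℤ.abs-* t (+ S k z)))

  ∣lehmer-pierce-odd∣² : .{{_ : NonZero z}} → ∀ k →
    ℤ.∣ lehmer-pierce t (ℤ.- + 1) (k + suc k) ∣ * ℤ.∣ lehmer-pierce t (ℤ.- + 1) (k + suc k) ∣ ≡ W (k + suc k) z
  ∣lehmer-pierce-odd∣² k = trans (cong (λ x → x * x) (∣lehmer-pierce-odd∣ k))
    (trans (identity (ℤ.∣ t ∣) (S k z)) (sym (W-odd k z)))
    where
    identity : ∀ t s → t * s * (t * s) ≡ t * t * (s * s)
    identity = solve-∀

module LehmerPierce (F : RealQuadraticField) where
  open QuadraticField F renaming (_+_ to _⊕_; _*_ to _⊗_; -_ to ⊝_; _-_ to _⊖_; _^_ to _^K_)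
  open Integrality F

  module _ (x : K) (t ν : ℤ) (T≡ : T x ≡ ι t) (N≡ : N x ≡ ι ν) where

    N-power : ∀ n → N (x ^K n) ≡ ι (ν ℤ.^ n)
    N-power zero    = N-1#
    N-power (suc n) = trans (N-⊗ x (x ^K n)) (trans (cong₂ ℚ._*_ N≡ (N-power n)) (sym (ι-* ν (ν ℤ.^ n))))

    T-power : ∀ n → T (x ^K n) ≡ ι (lucas t ν n)
    T-power zero          = refl
    T-power (suc zero)    = trans (cong (λ a → a ℚ.+ a) (re-⊗1# dℚ (re x) (im x))) T≡
      where
      re-⊗1# : ∀ d a b → a ℚ.* 1ℚ ℚ.+ d ℚ.* (b ℚ.* 0ℚ) ≡ a
      re-⊗1# = ring-identity ℚ-ring
    T-power (suc (suc n)) = begin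
      T (x ⊗ (x ⊗ x ^K n))                                    ≡⟨ T-two-step x (x ^K n) ⟩
      T x ℚ.* T (x ^K suc n) ℚ.+ ℚ.- (N x ℚ.* T (x ^K n))     ≡⟨ cong₂ (λ a b → a ℚ.+ ℚ.- b)
                                                                  (trans (cong₂ ℚ._*_ T≡ (T-power (suc n))) (sym (ι-* t a)))
                                                                  (trans (cong₂ ℚ._*_ N≡ (T-power n)) (sym (ι-* ν b))) ⟩
      ι (t ℤ.* a) ℚ.+ ℚ.- ι (ν ℤ.* b)                         ≡⟨ cong (ι (t ℤ.* a) ℚ.+_) (ι-neg (ν ℤ.* b)) ⟨
      ι (t ℤ.* a) ℚ.+ ι (ℤ.- (ν ℤ.* b))                       ≡⟨ ι-+ (t ℤ.* a) (ℤ.- (ν ℤ.* b)) ⟨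
      ι (t ℤ.* a ℤ.+ ℤ.- (ν ℤ.* b))                           ∎
      where
      open ≡-Reasoning
      a = lucas t ν (suc n)
      b = lucas t ν n

    isLehmerPierce : IsLehmerPierce x (lehmer-pierce t ν)
    isLehmerPierce n _ = sym (begin
      norm (x ^K n ⊖ 1#)                          ≡⟨ norm-⊖1# (x ^K n) ⟩
      N (x ^K n) ℚ.+ ℚ.- T (x ^K n) ℚ.+ 1ℚ        ≡⟨ cong₂ (λ a b → a ℚ.+ ℚ.- b ℚ.+ 1ℚ) (N-power n) (T-power n) ⟩
      ι a ℚ.+ ℚ.- ι b ℚ.+ ι (+ 1)                 ≡⟨ cong (λ c → ι a ℚ.+ c ℚ.+ ι (+ 1)) (ι-neg b) ⟨
      ι a ℚ.+ ι (ℤ.- b) ℚ.+ ι (+ 1)               ≡⟨ cong (ℚ._+ ι (+ 1)) (ι-+ a (ℤ.- b)) ⟨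
      ι (a ℤ.+ ℤ.- b) ℚ.+ ι (+ 1)                 ≡⟨ ι-+ (a ℤ.+ ℤ.- b) (+ 1) ⟨
      ι (a ℤ.+ ℤ.- b ℤ.+ + 1)                     ∎)
      where
      open ≡-Reasoning
      a = ν ℤ.^ n
      b = lucas t ν n

theorem1p4 : (F : RealQuadraticField) → let open QuadraticField F in
    (α : K) → IsIntegral α → IsUnit α → α ≢ 1# → α ≢ (- 1#) → Positive α →
    Σ[ Δ ∈ (ℕ → ℤ) ]
    ( IsLehmerPierce α Δ
    × (norm α ≡ 1ℚ → ∀ n → 12 < n → HasPrimitivePrimeDivisor Δ n)
    × (norm α ≡ (-ℚ 1ℚ) → ∀ n → 24 < n →
    ((¬ HasPrimitivePrimeDivisor Δ n) ⇔ (n % 4 ≡ 2))) )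
theorem1p4 F α integral _ α≢1 _ α>0 =
  lehmer-pierce t ν , isLehmerPierce α t ν T≡ N≡ , norm-one , norm-minus-one
  where
  open QuadraticField F using (norm)
  open Integrality F
  open Traces F
  open LehmerPierce F

  t = proj₁ (trace-integer integral)
  ν = proj₁ (norm-integer integral)
  T≡ = proj₂ (trace-integer integral)
  N≡ = proj₂ (norm-integer integral)

  norm-one : norm α ≡ 1ℚ → ∀ n → 12 < n → HasPrimitivePrimeDivisor (lehmer-pierce t ν) n
  norm-one norm≡1 = conclude (trace≥3 α t T≡ N≡1 α≢1 α>0)
    where
    N≡1 : N α ≡ 1ℚ
    N≡1 = trans (sym (norm≡N α)) norm≡1

    ν≡1 : ν ≡ + 1
    ν≡1 = ι-injective {ν} {+ 1} (trans (sym N≡) N≡1)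

    conclude : ∃[ z ] (NonZero z × t ≡ + (z + 2)) → ∀ n → 12 < n → HasPrimitivePrimeDivisor (lehmer-pierce t ν) n
    conclude (z , z≢0 , t≡) = primitive-of-W (lehmer-pierce t ν) z {{z≢0}} λ n →
      trans (cong₂ (λ t ν → ℤ.∣ lehmer-pierce t ν n ∣) t≡ ν≡1) (∣lehmer-pierce-one∣ z n)

  norm-minus-one : norm α ≡ (-ℚ 1ℚ) → ∀ n → 24 < n →
    (¬ HasPrimitivePrimeDivisor (lehmer-pierce t ν) n) ⇔ (n % 4 ≡ 2)
  norm-minus-one norm≡-1 = subst
    (λ ν → ∀ n → 24 < n → (¬ HasPrimitivePrimeDivisor (lehmer-pierce t ν) n) ⇔ (n % 4 ≡ 2)) (sym ν≡-1)
    (MinusOne.characterisation (lehmer-pierce t (ℤ.- + 1)) _ {{z≢0}}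
      (∣lehmer-pierce-even∣ t) (∣lehmer-pierce-odd∣² t {{z≢0}}))
    where
    N≡-1 : N α ≡ -ℚ 1ℚ
    N≡-1 = trans (sym (norm≡N α)) norm≡-1

    ν≡-1 : ν ≡ ℤ.- + 1
    ν≡-1 = ι-injective {ν} {ℤ.- + 1} (trans (sym N≡) N≡-1)

    ∣t∣≢0 : NonZero (ℤ.∣ t ∣)
    ∣t∣≢0 = ≢-nonZero λ ∣t∣≡0 → trace≢0 α t T≡ N≡-1 (ℤ.∣i∣≡0⇒i≡0 ∣t∣≡0)

    z≢0 : NonZero (ℤ.∣ t ∣ * ℤ.∣ t ∣)
    z≢0 = m*n≢0 (ℤ.∣ t ∣) (ℤ.∣ t ∣) {{∣t∣≢0}} {{∣t∣≢0}}
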